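{- Let $k\geq 4$ be an integer and let $\mathcal H$ be a $\{2,3\}$-uniform linear hypergraph on $n$ vertices that contains no Berge path of length $k$ as a subhypergraph. Then the number of edges of the $2$-shadow $\partial\mathcal H$ is at most $\frac{k-1}{2}n$.
   Context: A hypergraph $\mathcal H$ is a family of subsets (hyperedges) of a finite vertex set $V(\mathcal H)$. For a set of integers $R$, $\mathcal H$ is $R$-uniform if the size of every hyperedge belongs to $R$; thus a $\{2,3\}$-uniform hypergraph has all hyperedges of size $2$ or $3$. It is linear if any two distinct hyperedges share at most one vertex. The $2$-shadow $\partial\mathcal H$ is the graph on vertex set $V(\mathcal H)$ whose edge set is $\{\{u,v\}: u\neq v,\ \{u,v\}\subseteq h \text{ for some } h\in E(\mathcal H)\}$. A Berge path of length $k$ in $\mathcal H$ is an alternating sequence $v_1,h_1,v_2,h_2,\dots,h_k,v_{k+1}$ of pairwise distinct vertices $v_1,\dots,v_{k+1}$ and pairwise distinct hyperedges $h_1,\dots,h_k$ of $\mathcal H$ such that $\{v_i,v_{i+1}\}\subseteq h_i$ for all $i\in\{1,\dots,k\}$. -}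

module Defs where

open import Data.Fin.Base using (Fin; suc; inject₁)
open import Data.Fin.Properties using (_≟_; _<?_)
open import Data.Fin.Subset using (Subset; _∈_; _∩_; ∣_∣)
open import Data.Fin.Subset.Properties using (_∈?_)
open import Data.List.Base using (List; allFin; cartesianProduct; filter; length)
open import Data.List.Membership.Propositional using () renaming (_∈_ to _∈ˡ_)
open import Data.List.Relation.Unary.Any as Any using (Any; any?)
open import Data.List.Relation.Unary.Unique.Propositional using (Unique)
open import Data.Nat.Base using (ℕ; suc; _≤_)
open import Data.Product.Base using (_×_; _,_; map; swap)
open import Function.Base using (_∘_)
open import Function.Definitions using (Injective)
open import Level using (0ℓ)
open import Relation.Binary.Core using (Rel)
open import Relation.Binary.Definitions using (Decidable; Irreflexive; Symmetric)
open import Relation.Binary.PropositionalEquality using (_≡_; _≢_; sym)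
open import Relation.Nullary.Decidable using (_×-dec_; ¬?)
open import Relation.Unary using (Pred)

-- The list enumerates the set of hyperedges; its order is irrelevant below.
record Hypergraph (n : ℕ) : Set where
  field
    hyperedges : List (Subset n)
    unique     : Unique hyperedges

open Hypergraph public

Uniform : ∀ {n} → Pred ℕ 0ℓ → Hypergraph n → Set
Uniform R H = ∀ {h} → h ∈ˡ hyperedges H → R ∣ h ∣

Linear : ∀ {n} → Hypergraph n → Set
Linear H = ∀ {g h} → g ∈ˡ hyperedges H → h ∈ˡ hyperedges H → g ≢ h → ∣ g ∩ h ∣ ≤ 1

-- The i-th hyperedge joins the vertices at positions inject₁ i and suc i.
record BergePath {n : ℕ} (H : Hypergraph n) (k : ℕ) : Set where
  field
    vertex              : Fin (suc k) → Fin n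
    hyperedge           : Fin k → Subset n
    vertex-injective    : Injective _≡_ _≡_ vertex
    hyperedge-injective : Injective _≡_ _≡_ hyperedge
    hyperedge∈H         : ∀ i → hyperedge i ∈ˡ hyperedges H
    incident            : ∀ i → vertex (inject₁ i) ∈ hyperedge i × vertex (suc i) ∈ hyperedge i

record Graph (n : ℕ) : Set₁ where
  field
    Adj     : Rel (Fin n) 0ℓ
    adj?    : Decidable Adj
    symm    : Symmetric Adj
    irrefl  : Irreflexive _≡_ Adj

-- Each edge {u , v} is listed once, as the pair with u < v.
edges : ∀ {n} → Graph n → List (Fin n × Fin n)
edges {n} G = filter (λ (u , v) → u <? v ×-dec Graph.adj? G u v) (cartesianProduct (allFin n) (allFin n))

edgeCount : ∀ {n} → Graph n → ℕ
edgeCount G = length (edges G)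

∂ : ∀ {n} → Hypergraph n → Graph n
∂ H = record
  { Adj    = λ u v → u ≢ v × Any (λ h → u ∈ h × v ∈ h) (hyperedges H)
  ; adj?   = λ u v → ¬? (u ≟ v) ×-dec any? (λ h → u ∈? h ×-dec v ∈? h) (hyperedges H)
  ; symm   = map (_∘ sym) (Any.map swap)
  ; irrefl = λ u≡v (u≢v , _) → u≢v u≡v
  }

{-# OPTIONS --safe #-}
{-
Write k = K + 1 and argue by contradiction, taking a vertex set U, minimal under inclusion, whose induced shadow has more than
K |U| / 2 edges. Deleting a set S from U then destroys more than K |S| / 2 edges. For S a vertex, an edge, a triangle or a
4-cycle this bounds degree sums from below; moreover the shadow on U is connected and |U| exceeds K + 1.

Let ℓ be the length of a longest Berge path in U. A Berge cycle of length ℓ + 1 is impossible by connectedness, and one of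
length ℓ by counting the edges between the cycle and the remaining vertices. A cycle of length ℓ - 1 together with a further
hyperedge h through two vertices off the cycle is impossible as well: those two vertices would have degree sum exactly K + 2,
and exchanging them with two neighbours on the cycle gives a 4-cycle in the shadow violating the bound for 4-cycles.

Hence in a longest path from s to t the end s cannot be joined to q while t is joined to p, for p, q consecutive on the path:
the crossing closes a cycle missing at most p and q. Here the third vertex of the hyperedge at either end of the path is not
counted, so the two degrees add up to at most ℓ + 2, and rotations of the path dispose of the remaining cases, separately
for K odd and K even.
-}
module Submission where

-- The crossing argument for graphs closes a cycle through all vertices of a longest path. For Berge
-- paths the hyperedge that joins an end to a distant vertex may already be in use at that vertex,
-- and the cycle must then skip this vertex to free the hyperedge. Either end can cost one vertex,
-- so cycles of three lengths have to be excluded. The shortest is needed only when both vertices at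
-- the gap are skipped, and then the hyperedge of the gap joins them. Parity enters because degrees
-- are integers. Every degree exceeds K / 2, so the ends of a longest path have degree sum at least
-- K + 1 for K odd and at least K + 2 for K even, against the upper bound ℓ + 2 ≤ K + 2. For K even
-- every estimate is therefore tight. For K odd one unit of slack remains, but two vertices of
-- degree (K + 1) / 2 cannot be adjacent. Only vertices are deleted, never hyperedges: a path in U
-- may use any hyperedge with two vertices in U, so no smaller hypergraph has to be built.

module Development where
  open import Data.Bool.Base using (Bool; true; false; T)
  open import Data.Empty using (⊥; ⊥-elim)
  open import Data.Fin.Base using (Fin; zero; suc)
  import Data.Fin.Properties as Fin
  open import Data.List.Base using (List; []; _∷_; _++_; [_]; length; map; concatMap)
  open import Data.List.Membership.Propositional using (_∈_; _∉_)
  open import Data.List.Membership.Propositional.Properties using (∈-++⁺ˡ; ∈-++⁺ʳ; ∈-++⁻; ∈-∃++; ∈-length)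
  open import Data.List.Properties using (length-++; length-tabulate; ++-assoc; ++-identityʳ; ∷-injective; ∷ʳ-injectiveʳ)
  open import Data.List.Relation.Binary.Permutation.Propositional using (_↭_; ↭-refl; ↭-sym; ↭-trans; ↭-reflexive; prep; swap)
  open import Data.List.Relation.Binary.Permutation.Propositional.Properties using (shift; shifts; ↭-length; All-resp-↭; ∈-resp-↭; ++-comm; ++⁺; ++⁺ˡ; ++⁺ʳ)
  open import Data.List.Relation.Unary.All as All using (All; []; _∷_)
  import Data.List.Relation.Unary.All.Properties as All
  open import Data.List.Relation.Unary.AllPairs using ([]; _∷_)
  open import Data.List.Relation.Unary.Any using (here; there)
  open import Data.List.Relation.Unary.Unique.Propositional using (Unique)
  open import Data.List.Relation.Unary.Unique.Propositional.Properties using () renaming (Unique[x∷xs]⇒x∉xs to head∉)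
  open import Data.Maybe.Base using (Maybe; just; nothing; is-just)
  open import Data.Nat.Base
  open import Data.Nat.Properties
  open import Data.Nat.Tactic.RingSolver using (solve-∀)
  open import Data.Product.Base using (Σ; ∃; ∃₂; _×_; _,_; proj₁; proj₂)
  open import Data.Sum.Base using (_⊎_; inj₁; inj₂)
  open import Data.Vec.Base using (Vec; []; _∷_; lookup)
  open import Function.Base using (_∘_; _$_; id; case_of_)
  open import Relation.Binary.Definitions using (DecidableEquality)
  open import Relation.Binary.PropositionalEquality hiding ([_])
  open import Relation.Nullary using (¬_; Dec; yes; no)
  open import Relation.Nullary.Decidable using (_×-dec_; ¬?)

  -- Reflection for regrouping concatenated blocks of a list

  data Tree (n : ℕ) : Set where
    leaf : Fin n → Tree n
    _⊕_  : Tree n → Tree n → Tree n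

  infixr 5 _⊕_

  pattern `0 = leaf zero
  pattern `1 = leaf (suc zero)
  pattern `2 = leaf (suc (suc zero))
  pattern `3 = leaf (suc (suc (suc zero)))
  pattern `4 = leaf (suc (suc (suc (suc zero))))
  pattern `5 = leaf (suc (suc (suc (suc (suc zero)))))
  pattern `6 = leaf (suc (suc (suc (suc (suc (suc zero))))))
  pattern `7 = leaf (suc (suc (suc (suc (suc (suc (suc zero)))))))

  leaves : ∀ {n} → Tree n → List (Fin n)
  leaves (leaf i) = i ∷ []
  leaves (s ⊕ t)  = leaves s ++ leaves t

  remove : ∀ {n} (i : Fin n) js → Maybe (∃ λ ks → js ↭ i ∷ ks)
  remove i [] = nothing
  remove i (j ∷ js) with i Fin.≟ j
  ... | yes refl = just (js , ↭-refl)
  ... | no _ with remove i js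
  ...   | nothing       = nothing
  ...   | just (ks , p) = just (j ∷ ks , ↭-trans (prep j p) (swap j i ↭-refl))

  difference : ∀ {n} (is js : List (Fin n)) → Maybe (∃ λ ks → js ↭ is ++ ks)
  difference [] js = just (js , ↭-refl)
  difference (i ∷ is) js with remove i js
  ... | nothing = nothing
  ... | just (ks , p) with difference is ks
  ...   | nothing       = nothing
  ...   | just (ls , q) = just (ls , ↭-trans p (prep i q))

  -- A Boolean, so that for closed trees the hidden argument `T (t ⊑ s)` of the lemmas below
  -- evaluates to the unit type and is filled in silently. Regrouping the blocks of a path then
  -- costs no more than writing two trees.
  _⊑_ : ∀ {n} → Tree n → Tree n → Bool
  t ⊑ s = is-just (difference (leaves t) (leaves s))

  isEmpty : ∀ {n} {t s : Tree n} → Maybe (∃ λ ks → leaves s ↭ leaves t ++ ks) → Bool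
  isEmpty (just ([] , _)) = true
  isEmpty _               = false

  _≋_ : ∀ {n} → Tree n → Tree n → Bool
  t ≋ s = isEmpty {t = t} {s} (difference (leaves t) (leaves s))

  module _ {A : Set} where

    []≢∷ʳ : ∀ (xs : List A) {x} → [] ≢ xs ++ [ x ]
    []≢∷ʳ [] ()
    []≢∷ʳ (_ ∷ _) ()

    ⟦_⟧ : ∀ {n} → Tree n → Vec (List A) n → List A
    ⟦ leaf i ⟧ ρ = lookup ρ i
    ⟦ s ⊕ t ⟧  ρ = ⟦ s ⟧ ρ ++ ⟦ t ⟧ ρ

    flatten : ∀ {n} → Vec (List A) n → List (Fin n) → List A
    flatten ρ = concatMap (lookup ρ)

    -- Opaque, so that paths carrying such proofs stay small when types are normalised.
    opaque
      flatten-++ : ∀ {n} (ρ : Vec (List A) n) is js → flatten ρ (is ++ js) ↭ flatten ρ is ++ flatten ρ js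
      flatten-++ ρ [] js = ↭-refl
      flatten-++ ρ (i ∷ is) js =
        ↭-trans (++⁺ˡ (lookup ρ i) (flatten-++ ρ is js)) (↭-reflexive (sym (++-assoc (lookup ρ i) _ _)))

      flatten-↭ : ∀ {n} (ρ : Vec (List A) n) {is js} → is ↭ js → flatten ρ is ↭ flatten ρ js
      flatten-↭ ρ _↭_.refl         = ↭-refl
      flatten-↭ ρ (prep i p)       = ++⁺ˡ (lookup ρ i) (flatten-↭ ρ p)
      flatten-↭ ρ (swap i j p)     = ↭-trans (shifts (lookup ρ i) (lookup ρ j)) (++⁺ˡ (lookup ρ j) (++⁺ˡ (lookup ρ i) (flatten-↭ ρ p)))
      flatten-↭ ρ (_↭_.trans p q)  = ↭-trans (flatten-↭ ρ p) (flatten-↭ ρ q)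

      ⟦⟧-flatten : ∀ {n} (ρ : Vec (List A) n) t → ⟦ t ⟧ ρ ↭ flatten ρ (leaves t)
      ⟦⟧-flatten ρ (leaf i) = ↭-reflexive (sym (++-identityʳ _))
      ⟦⟧-flatten ρ (s ⊕ t) =
        ↭-trans (++⁺ (⟦⟧-flatten ρ s) (⟦⟧-flatten ρ t)) (↭-sym (flatten-++ ρ (leaves s) (leaves t)))

      ⊑-sound : ∀ {n} (ρ : Vec (List A) n) t s {_ : T (t ⊑ s)} → ∃ λ zs → ⟦ s ⟧ ρ ↭ ⟦ t ⟧ ρ ++ zs
      ⊑-sound ρ t s {ok} with difference (leaves t) (leaves s)
      ... | just (ks , p) = flatten ρ ks ,
        ↭-trans (⟦⟧-flatten ρ s) (↭-trans (flatten-↭ ρ p)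
          (↭-trans (flatten-++ ρ (leaves t) ks) (++⁺ʳ _ (↭-sym (⟦⟧-flatten ρ t)))))

      perm : ∀ {n} (ρ : Vec (List A) n) t s {_ : T (t ≋ s)} → ⟦ s ⟧ ρ ↭ ⟦ t ⟧ ρ
      perm ρ t s {ok} with difference (leaves t) (leaves s)
      ... | just ([] , p) =
        ↭-trans (⟦⟧-flatten ρ s) (↭-trans (flatten-↭ ρ p)
          (↭-trans (flatten-++ ρ (leaves t) []) (↭-trans (↭-reflexive (++-identityʳ _)) (↭-sym (⟦⟧-flatten ρ t)))))

      Unique-resp-↭ : {xs ys : List A} → xs ↭ ys → Unique xs → Unique ys
      Unique-resp-↭ _↭_.refl u = u
      Unique-resp-↭ (prep x p) (x∉ ∷ u) = All-resp-↭ p x∉ ∷ Unique-resp-↭ p u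
      Unique-resp-↭ (swap x y p) ((x≢y ∷ x∉) ∷ y∉ ∷ u) =
        ((x≢y ∘ sym) ∷ All-resp-↭ p y∉) ∷ All-resp-↭ p x∉ ∷ Unique-resp-↭ p u
      Unique-resp-↭ (_↭_.trans p q) u = Unique-resp-↭ q (Unique-resp-↭ p u)

      Unique-++ˡ : ∀ (xs : List A) {ys} → Unique (xs ++ ys) → Unique xs
      Unique-++ˡ [] u = []
      Unique-++ˡ (x ∷ xs) (x∉ ∷ u) = All.++⁻ˡ xs x∉ ∷ Unique-++ˡ xs u

      uniq : ∀ {n} (ρ : Vec (List A) n) t s {_ : T (t ⊑ s)} → Unique (⟦ s ⟧ ρ) → Unique (⟦ t ⟧ ρ)
      uniq ρ t s {ok} u = Unique-++ˡ _ (Unique-resp-↭ (proj₂ (⊑-sound ρ t s {ok})) u)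

      all : ∀ {P : A → Set} {n} (ρ : Vec (List A) n) t s {_ : T (t ⊑ s)} → All P (⟦ s ⟧ ρ) → All P (⟦ t ⟧ ρ)
      all ρ t s {ok} u = All.++⁻ˡ _ (All-resp-↭ (proj₂ (⊑-sound ρ t s {ok})) u)

      len : ∀ {n} (ρ : Vec (List A) n) t s {_ : T (t ≋ s)} → length (⟦ s ⟧ ρ) ≡ length (⟦ t ⟧ ρ)
      len ρ t s {ok} = ↭-length (perm ρ t s {ok})

      uniq-∷ : ∀ {x : A} {xs} → x ∉ xs → Unique xs → Unique (x ∷ xs)
      uniq-∷ x∉ u = All.¬Any⇒All¬ _ x∉ ∷ u

      disjoint-++ : ∀ (xs : List A) {ys x y} → Unique (xs ++ ys) → x ∈ xs → y ∈ ys → x ≢ y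
      disjoint-++ (_ ∷ xs) (x∉ ∷ u) (here refl) y∈ refl = All.All¬⇒¬Any x∉ (∈-++⁺ʳ xs y∈)
      disjoint-++ (_ ∷ xs) (x∉ ∷ u) (there x∈) y∈ = disjoint-++ xs u x∈ y∈

    -- Finite sums and counting by indicators

    ∑ : (A → ℕ) → List A → ℕ
    ∑ f []       = 0
    ∑ f (x ∷ xs) = f x + ∑ f xs

    ∑-++ : ∀ f xs {ys} → ∑ f (xs ++ ys) ≡ ∑ f xs + ∑ f ys
    ∑-++ f [] = refl
    ∑-++ f (x ∷ xs) = trans (cong (f x +_) (∑-++ f xs)) (sym (+-assoc (f x) _ _))

    ∑-↭ : ∀ f {xs ys} → xs ↭ ys → ∑ f xs ≡ ∑ f ys
    ∑-↭ f _↭_.refl = refl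
    ∑-↭ f (prep x p) = cong (f x +_) (∑-↭ f p)
    ∑-↭ f (swap x y p) =
      trans (sym (+-assoc (f x) (f y) _)) (trans (cong₂ _+_ (+-comm (f x) (f y)) (∑-↭ f p)) (+-assoc (f y) (f x) _))
    ∑-↭ f (_↭_.trans p q) = trans (∑-↭ f p) (∑-↭ f q)

    ∑-mono : ∀ {f g} xs → (∀ {x} → x ∈ xs → f x ≤ g x) → ∑ f xs ≤ ∑ g xs
    ∑-mono [] le = z≤n
    ∑-mono (x ∷ xs) le = +-mono-≤ (le (here refl)) (∑-mono xs (le ∘ there))

    ∑-+ : ∀ f g xs → ∑ (λ x → f x + g x) xs ≡ ∑ f xs + ∑ g xs
    ∑-+ f g [] = refl
    ∑-+ f g (x ∷ xs) = trans (cong (f x + g x +_) (∑-+ f g xs)) (+-+-interchange (f x) (g x) _ _)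
      where
      +-+-interchange : ∀ a b c d → a + b + (c + d) ≡ a + c + (b + d)
      +-+-interchange a b c d = trans (+-assoc a b _) (trans (cong (a +_)
        (trans (sym (+-assoc b c d)) (trans (cong (_+ d) (+-comm b c)) (+-assoc c b d)))) (sym (+-assoc a c _)))

    ∑-const : ∀ c xs → ∑ (λ _ → c) xs ≡ c * length xs
    ∑-const c [] = sym (*-zeroʳ c)
    ∑-const c (x ∷ xs) = trans (cong (c +_) (∑-const c xs)) (sym (*-suc c _))

    ∑-zero : ∀ {f} xs → (∀ {x} → x ∈ xs → f x ≡ 0) → ∑ f xs ≡ 0
    ∑-zero [] z = refl
    ∑-zero (x ∷ xs) z = cong₂ _+_ (z (here refl)) (∑-zero xs (z ∘ there))

    term≤∑ : ∀ f {xs x} → x ∈ xs → f x ≤ ∑ f xs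
    term≤∑ f (here refl) = m≤m+n _ _
    term≤∑ f {y ∷ _} (there x∈) = ≤-trans (term≤∑ f x∈) (m≤n+m _ (f y))

    ∑-deficit : ∀ f xs {x} → (∀ {y} → y ∈ xs → f y ≤ 1) → x ∈ xs → f x ≡ 0 → ∑ f xs < length xs
    ∑-deficit f (_ ∷ xs) le (here refl) fx≡0 rewrite fx≡0 =
      s≤s (≤-trans (∑-mono xs (le ∘ there)) (≤-reflexive (trans (∑-const 1 xs) (*-identityˡ _))))
    ∑-deficit f (_ ∷ xs) le (there x∈) fx≡0 = ≤-trans (≤-reflexive (sym (+-suc _ _))) (+-mono-≤ (le (here refl)) (∑-deficit f xs (le ∘ there) x∈ fx≡0))

  ∑-swap : ∀ {A B : Set} (f : A → B → ℕ) xs ys →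
           ∑ (λ x → ∑ (f x) ys) xs ≡ ∑ (λ y → ∑ (λ x → f x y) xs) ys
  ∑-swap f [] ys = sym (∑-zero ys (λ _ → refl))
  ∑-swap f (x ∷ xs) ys = trans (cong (∑ (f x) ys +_) (∑-swap f xs ys)) (sym (∑-+ (f x) _ ys))

  𝟙 : ∀ {P : Set} → Dec P → ℕ
  𝟙 (yes _) = 1
  𝟙 (no _)  = 0

  𝟙≤1 : ∀ {P : Set} (d : Dec P) → 𝟙 d ≤ 1
  𝟙≤1 (yes _) = ≤-refl
  𝟙≤1 (no _)  = z≤n

  𝟙-yes : ∀ {P : Set} (d : Dec P) → P → 𝟙 d ≡ 1
  𝟙-yes (yes _) p = refl
  𝟙-yes (no ¬p) p = ⊥-elim (¬p p)

  𝟙-no : ∀ {P : Set} (d : Dec P) → ¬ P → 𝟙 d ≡ 0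
  𝟙-no (yes p) ¬p = ⊥-elim (¬p p)
  𝟙-no (no _)  ¬p = refl

  𝟙-mono : ∀ {P Q : Set} (d : Dec P) (e : Dec Q) → (P → Q) → 𝟙 d ≤ 𝟙 e
  𝟙-mono (no _) e f = z≤n
  𝟙-mono (yes p) e f = ≤-reflexive (sym (𝟙-yes e (f p)))

  𝟙-mono⊎ : ∀ {P Q R : Set} (d : Dec P) (e : Dec Q) (f : Dec R) → (P → Q ⊎ R) → 𝟙 d ≤ 𝟙 e + 𝟙 f
  𝟙-mono⊎ (no _) e f g = z≤n
  𝟙-mono⊎ (yes p) e f g with g p
  ... | inj₁ q = ≤-trans (≤-reflexive (sym (𝟙-yes e q))) (m≤m+n _ _)
  ... | inj₂ r = ≤-trans (≤-reflexive (sym (𝟙-yes f r))) (m≤n+m _ (𝟙 e))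

  module _ {A : Set} {P : A → Set} (P? : ∀ x → Dec (P x)) where

    count : List A → ℕ
    count = ∑ (𝟙 ∘ P?)

    count-witness : ∀ xs → 1 ≤ count xs → ∃ λ x → x ∈ xs × P x
    count-witness (x ∷ xs) le with P? x
    ... | yes p = x , here refl , p
    ... | no _ with count-witness xs le
    ...   | y , y∈ , p = y , there y∈ , p

    count-two : ∀ xs → Unique xs → 2 ≤ count xs → ∃₂ λ x y → x ∈ xs × y ∈ xs × x ≢ y × P x × P y
    count-two (x ∷ xs) (x∉ ∷ u) le with P? x
    ... | no _ with count-two xs u le
    ...   | y , z , y∈ , z∈ , rest = y , z , there y∈ , there z∈ , rest
    count-two (x ∷ xs) (x∉ ∷ u) (s≤s le) | yes p with count-witness xs le
    ... | y , y∈ , q = x , y , here refl , there y∈ , All.lookup x∉ y∈ , p , q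

    count≤1 : ∀ xs → Unique xs → (∀ {x y} → x ∈ xs → y ∈ xs → P x → P y → x ≡ y) → count xs ≤ 1
    count≤1 [] u same = z≤n
    count≤1 (x ∷ xs) (x∉ ∷ u) same with P? x
    ... | no _  = count≤1 xs u (λ y∈ z∈ → same (there y∈) (there z∈))
    ... | yes p = s≤s (≤-reflexive (∑-zero xs λ {y} y∈ → 𝟙-no (P? y) λ q →
                    All.lookup x∉ y∈ (same (here refl) (there y∈) p q)))

    count≤2 : ∀ xs → Unique xs →
              (∀ {x y z} → x ∈ xs → y ∈ xs → z ∈ xs → P x → P y → P z → x ≢ y → x ≢ z → y ≢ z → ⊥) →
              count xs ≤ 2
    count≤2 [] u three = z≤n
    count≤2 (x ∷ xs) (x∉ ∷ u) three with P? x
    ... | no _  = count≤2 xs u (λ a b c → three (there a) (there b) (there c))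
    ... | yes p = s≤s (rest xs x∉ u λ y∈ z∈ q r y≢z → three (here refl) (there y∈) (there z∈) p q r
                    (All.lookup x∉ y∈) (All.lookup x∉ z∈) y≢z)
      where
      rest : ∀ ys → All (x ≢_) ys → Unique ys → (∀ {y z} → y ∈ ys → z ∈ ys → P y → P z → y ≢ z → ⊥) → count ys ≤ 1
      rest [] _ _ _ = z≤n
      rest (y ∷ ys) (_ ∷ x∉) (y∉ ∷ u) two with P? y
      ... | no _  = rest ys x∉ u (λ a b → two (there a) (there b))
      ... | yes q = s≤s (≤-reflexive (∑-zero ys λ {z} z∈ → 𝟙-no (P? z) λ r →
                      two (here refl) (there z∈) q r (All.lookup y∉ z∈)))

    find : ∀ xs → (∃ λ x → x ∈ xs × P x) ⊎ (∀ {x} → x ∈ xs → ¬ P x)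
    find [] = inj₂ λ ()
    find (x ∷ xs) with P? x | find xs
    ... | yes p | _ = inj₁ (x , here refl , p)
    ... | no _  | inj₁ (y , y∈ , p) = inj₁ (y , there y∈ , p)
    ... | no ¬p | inj₂ none = inj₂ λ { (here refl) → ¬p ; (there y∈) → none y∈ }

  -- Incidence structures, Berge paths and their cuts

  record Incidence : Set₁ where
    infix 4 _◂_ _◂?_
    field
      V E    : Set
      _≟ⱽ_   : DecidableEquality V
      _≟ᴱ_   : DecidableEquality E
      _◂_    : V → E → Set
      _◂?_   : ∀ v e → Dec (v ◂ e)
      -- A field of its own, since the abstract type `E` cannot be searched.
      link?  : ∀ a b → Dec (∃ λ e → a ◂ e × b ◂ e)
      linear : ∀ {a b e f} → a ≢ b → a ◂ e → b ◂ e → a ◂ f → b ◂ f → e ≡ f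
      size≤3 : ∀ {a b c d e} → a ◂ e → b ◂ e → c ◂ e → d ◂ e →
               a ≢ b → a ≢ c → a ≢ d → b ≢ c → b ≢ d → c ≢ d → ⊥

  module Shadow (I : Incidence) where
    open Incidence I public

    Adj : V → V → Set
    Adj a b = a ≢ b × ∃ λ e → a ◂ e × b ◂ e

    opaque
      Adj? : ∀ a b → Dec (Adj a b)
      Adj? a b = ¬? (a ≟ⱽ b) ×-dec link? a b

    Adj-sym : ∀ {a b} → Adj a b → Adj b a
    Adj-sym (a≢b , e , a◂ , b◂) = a≢b ∘ sym , e , b◂ , a◂

    opaque
      fourth : ∀ {a b c d e} → a ≢ b → a ≢ c → b ≢ c → a ◂ e → b ◂ e → c ◂ e → d ◂ e → d ≢ a → d ≢ b → d ≡ c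
      fourth {c = c} {d} a≢b a≢c b≢c a◂ b◂ c◂ d◂ d≢a d≢b with d ≟ⱽ c
      ... | yes d≡c = d≡c
      ... | no d≢c = ⊥-elim (size≤3 a◂ b◂ c◂ d◂ a≢b a≢c (d≢a ∘ sym) b≢c (d≢b ∘ sym) (d≢c ∘ sym))

    -- A Berge path when vs and es are repetition-free.
    data Seg : V → V → List V → List E → Set where
      pt   : ∀ a → Seg a a [ a ] []
      step : ∀ {a b c e vs es} → a ◂ e → b ◂ e → Seg b c vs es → Seg a c (a ∷ vs) (e ∷ es)

    join : ∀ {a b c d e vs es ws fs} → Seg a b vs es → b ◂ e → c ◂ e → Seg c d ws fs →
           Seg a d (vs ++ ws) (es ++ e ∷ fs)
    join (pt a) b◂ c◂ S = step b◂ c◂ S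
    join (step x y R) b◂ c◂ S = step x y (join R b◂ c◂ S)

    rv : ∀ {A : Set} → List A → List A
    rv []       = []
    rv (x ∷ xs) = rv xs ++ [ x ]

    opaque
      rv-↭ : ∀ {A : Set} (xs : List A) → xs ↭ rv xs
      rv-↭ [] = ↭-refl
      rv-↭ (x ∷ xs) = ↭-trans (prep x (rv-↭ xs)) (++-comm [ x ] (rv xs))

    rev : ∀ {a b vs es} → Seg a b vs es → Seg b a (rv vs) (rv es)
    rev (pt a) = pt a
    rev (step a◂ b◂ S) = join (rev S) b◂ a◂ (pt _)

    opaque
      start∈ : ∀ {a b vs es} → Seg a b vs es → a ∈ vs
      start∈ (pt a) = here refl
      start∈ (step _ _ _) = here refl

      end∈ : ∀ {a b vs es} → Seg a b vs es → b ∈ vs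
      end∈ (pt a) = here refl
      end∈ (step _ _ S) = there (end∈ S)

      length-Seg : ∀ {a b vs es} → Seg a b vs es → length vs ≡ suc (length es)
      length-Seg (pt a) = refl
      length-Seg (step _ _ S) = cong suc (length-Seg S)

    -- Equations take the place of list indices, because unification cannot invert `++`.
    record Cut (a b : V) (vs : List V) (es : List E) : Set where
      constructor cut
      field
        {p q}     : V
        {g}       : E
        {vs₁ vs₂} : List V
        {es₁ es₂} : List E
        left      : Seg a p vs₁ es₁
        p◂        : p ◂ g
        q◂        : q ◂ g
        right     : Seg q b vs₂ es₂
        vs≡       : vs ≡ vs₁ ++ vs₂
        es≡       : es ≡ es₁ ++ g ∷ es₂

    stepCut : ∀ {a b c e vs es} → a ◂ e → b ◂ e → Cut b c vs es → Cut a c (a ∷ vs) (e ∷ es)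
    stepCut a◂ b◂ (cut L p◂ q◂ R v≡ e≡) = cut (step a◂ b◂ L) p◂ q◂ R (cong (_ ∷_) v≡) (cong (_ ∷_) e≡)

    cutV : ∀ {a b c vs es} → Seg a b vs es → c ∈ vs → a ≡ c ⊎ Σ (Cut a b vs es) λ C → Cut.q C ≡ c
    cutV (pt a) (here refl) = inj₁ refl
    cutV (step _ _ _) (here refl) = inj₁ refl
    cutV (step a◂ b◂ S) (there c∈) with cutV S c∈
    ... | inj₁ refl = inj₂ (cut (pt _) a◂ b◂ S refl refl , refl)
    ... | inj₂ (C , q≡) = inj₂ (stepCut a◂ b◂ C , q≡)

    cutE : ∀ {a b e vs es} → Seg a b vs es → e ∈ es → Σ (Cut a b vs es) λ C → Cut.g C ≡ e
    cutE (step a◂ b◂ S) (here refl) = cut (pt _) a◂ b◂ S refl refl , refl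
    cutE (step a◂ b◂ S) (there e∈) with cutE S e∈
    ... | C , g≡ = stepCut a◂ b◂ C , g≡

    opaque
      ends : ∀ {a b e vs es} → Seg a b vs es → Unique vs → e ∈ es →
             ∃₂ λ c d → c ∈ vs × d ∈ vs × c ≢ d × c ◂ e × d ◂ e
      ends (step a◂ b◂ S) (a∉ ∷ _) (here refl) =
        _ , _ , here refl , there (start∈ S) , All.lookup a∉ (start∈ S) , a◂ , b◂
      ends (step _ _ S) (_ ∷ u) (there e∈) with ends S u e∈
      ... | c , d , c∈ , d∈ , rest = c , d , there c∈ , there d∈ , rest

      -- Two of the at most three vertices of a used hyperedge are consecutive on the path, which
      -- leaves room for one outside vertex only.
      no-edge : ∀ {a b e x y vs es} → Seg a b vs es → Unique vs → e ∈ es →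
                x ≢ y → x ∉ vs → y ∉ vs → x ◂ e → y ◂ e → ⊥
      no-edge S u e∈ x≢y x∉ y∉ x◂ y◂ with ends S u e∈
      ... | c , d , c∈ , d∈ , c≢d , c◂ , d◂ =
        size≤3 c◂ d◂ x◂ y◂ c≢d (λ { refl → x∉ c∈ }) (λ { refl → y∉ c∈ }) (λ { refl → x∉ d∈ }) (λ { refl → y∉ d∈ }) x≢y

    record Snoc (a c : V) (vs : List V) (es : List E) : Set where
      constructor snoc
      field
        {p}  : V
        {f}  : E
        {ws} : List V
        {fs} : List E
        init : Seg a p ws fs
        p◂   : p ◂ f
        c◂   : c ◂ f
        vs≡  : vs ≡ ws ++ [ c ]
        es≡  : es ≡ fs ++ [ f ]

    unsnoc : ∀ {a b c e vs es} → a ◂ e → b ◂ e → Seg b c vs es → Snoc a c (a ∷ vs) (e ∷ es)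
    unsnoc a◂ b◂ (pt _) = snoc (pt _) a◂ b◂ refl refl
    unsnoc a◂ b◂ (step x y S) with unsnoc x y S
    ... | snoc S′ p◂ c◂ v≡ e≡ = snoc (step a◂ b◂ S′) p◂ c◂ (cong (_ ∷_) v≡) (cong (_ ∷_) e≡)

    snoc? : ∀ {a b vs es} → Seg a b vs es → a ≡ b ⊎ Snoc a b vs es
    snoc? (pt _) = inj₁ refl
    snoc? (step a◂ b◂ S) = inj₂ (unsnoc a◂ b◂ S)

    opaque
      -- A hyperedge of the path that also has a vertex off the path meets the path only in the two
      -- vertices it joins; one that contains the end `s` must therefore be the last.
      last-edge : ∀ {p s q e vs es} (S : Seg p s vs es) → Unique vs → e ∈ es → s ◂ e → q ◂ e → q ∉ vs →
                  ∃ λ x → ∃₂ λ ws fs → Seg p x ws fs × x ◂ e × vs ≡ ws ++ [ s ] × es ≡ fs ++ [ e ]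
      last-edge (step a◂ b◂ (pt _)) u (here refl) s◂ q◂ q∉ = _ , _ , _ , pt _ , a◂ , refl , refl
      last-edge (step {a} {b} a◂ b◂ (step {b = b′} x y S)) ((a∉ ∷ a∉′) ∷ b∉ ∷ _) (here refl) s◂ q◂ q∉ =
        ⊥-elim (size≤3 a◂ b◂ s◂ q◂ a∉ (All.lookup a∉′ (end∈ S)) (λ { refl → q∉ (here refl) })
          (All.lookup b∉ (end∈ S)) (λ { refl → q∉ (there (here refl)) }) (λ { refl → q∉ (there (there (end∈ S))) }))
      last-edge (step a◂ b◂ S) (_ ∷ u) (there e∈) s◂ q◂ q∉ with last-edge S u e∈ s◂ q◂ (q∉ ∘ there)
      ... | x , ws , fs , S′ , x◂ , v≡ , e≡ = x , _ , _ , step a◂ b◂ S′ , x◂ , cong (_ ∷_) v≡ , cong (_ ∷_) e≡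

      first-edge : ∀ {a b x e vs es} → Seg a b vs es → Unique vs → e ∈ es → a ◂ e → x ◂ e → x ∉ vs →
                   ∃ λ a′ → ∃₂ λ ws fs → a′ ◂ e × Seg a′ b ws fs × vs ≡ a ∷ ws × es ≡ e ∷ fs
      first-edge (step a◂ b◂ S) u (here refl) _ _ _ = _ , _ , _ , b◂ , S , refl , refl
      first-edge (step _ _ S) (a∉ ∷ u) (there e∈) a◂ x◂ x∉ =
        ⊥-elim (no-edge S u e∈ (λ { refl → x∉ (here refl) }) (λ a∈ → All.lookup a∉ a∈ refl) (x∉ ∘ there) a◂ x◂)

      propagate : ∀ {P : V → Set} {c d ws fs} → Seg c d ws fs → (∀ (X : Cut c d ws fs) → P (Cut.p X) → P (Cut.q X)) → P c →
                  ∀ {q} → q ∈ ws → P q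
      propagate (pt _) next pc (here refl) = pc
      propagate (step _ _ _) next pc (here refl) = pc
      propagate (step x y S) next pc (there q∈) = propagate S (λ X → next (stepCut x y X)) (next (cut (pt _) x y S refl refl) pc) q∈

    -- Counting adjacent ordered pairs

    _~_ : V → V → ℕ
    a ~ b = 𝟙 (Adj? a b)

    ~-sym : ∀ a b → a ~ b ≡ b ~ a
    ~-sym a b = ≤-antisym (𝟙-mono (Adj? a b) (Adj? b a) Adj-sym) (𝟙-mono (Adj? b a) (Adj? a b) Adj-sym)

    ~-irrefl : ∀ a → a ~ a ≡ 0
    ~-irrefl a = 𝟙-no (Adj? a a) (λ (a≢a , _) → a≢a refl)

    -- Pairs are ordered: `D U U` is twice the number of edges inside `U`, so the bound K |U| / 2 on
    -- edges becomes `K * length U`.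
    D : List V → List V → ℕ
    D as bs = ∑ (λ a → ∑ (a ~_) bs) as

    D-sym : ∀ as bs → D as bs ≡ D bs as
    D-sym as bs = trans (∑-swap _~_ as bs) (∑-cong bs λ b → ∑-cong as λ a → ~-sym a b)
      where
      ∑-cong : ∀ {f g : V → ℕ} xs → (∀ x → f x ≡ g x) → ∑ f xs ≡ ∑ g xs
      ∑-cong [] eq = refl
      ∑-cong (x ∷ xs) eq = cong₂ _+_ (eq x) (∑-cong xs eq)

    D-↭ʳ : ∀ as {bs cs} → bs ↭ cs → D as bs ≡ D as cs
    D-↭ʳ [] p = refl
    D-↭ʳ (a ∷ as) p = cong₂ _+_ (∑-↭ (a ~_) p) (D-↭ʳ as p)

    D-++ʳ : ∀ as bs {cs} → D as (bs ++ cs) ≡ D as bs + D as cs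
    D-++ʳ [] bs = refl
    D-++ʳ (a ∷ as) bs {cs} rewrite ∑-++ (a ~_) bs {cs} | D-++ʳ as bs {cs} = interchange (∑ (a ~_) bs) _ _ _
      where
      open import Algebra.Properties.CommutativeSemigroup +-commutativeSemigroup using (interchange)

    D-split : ∀ {us} ss ws → us ↭ ss ++ ws → D us us ≡ D ss ss + (D ss ws + D ss ws) + D ws ws
    D-split {us} ss ws p = begin
      D us us                                           ≡⟨ ∑-↭ (λ a → ∑ (a ~_) us) p ⟩
      D (ss ++ ws) us                                   ≡⟨ D-↭ʳ (ss ++ ws) p ⟩
      D (ss ++ ws) (ss ++ ws)                           ≡⟨ ∑-++ (λ a → ∑ (a ~_) (ss ++ ws)) ss ⟩
      D ss (ss ++ ws) + D ws (ss ++ ws)                 ≡⟨ cong₂ _+_ (D-++ʳ ss ss) (D-++ʳ ws ss) ⟩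
      (D ss ss + D ss ws) + (D ws ss + D ws ws)         ≡⟨ cong (λ z → (D ss ss + D ss ws) + (z + D ws ws)) (D-sym ws ss) ⟩
      (D ss ss + D ss ws) + (D ss ws + D ws ws)         ≡⟨ sym (+-assoc (D ss ss + D ss ws) _ _) ⟩
      (D ss ss + D ss ws) + D ss ws + D ws ws           ≡⟨ cong (_+ D ws ws) (+-assoc (D ss ss) _ _) ⟩
      D ss ss + (D ss ws + D ss ws) + D ws ws           ∎
      where open ≡-Reasoning

    row : ∀ {xs a b} → b ∈ xs → a ~ b ≡ 0 → suc (∑ (a ~_) xs) ≤ length xs
    row {_ ∷ xs} {a} (here refl) eq rewrite eq = s≤s (≤-trans (∑-mono xs (λ {b} _ → 𝟙≤1 (Adj? a b)))
      (≤-reflexive (trans (∑-const 1 xs) (*-identityˡ _))))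
    row {b ∷ _} {a} (there b∈) eq = s≤s (≤-trans (+-monoˡ-≤ _ (𝟙≤1 (Adj? a b))) (row b∈ eq))

    D-bound : ∀ xs → D xs xs + length xs ≤ length xs * length xs
    D-bound xs = begin
      D xs xs + length xs                         ≡⟨ cong (D xs xs +_) (sym (trans (∑-const 1 xs) (*-identityˡ _))) ⟩
      D xs xs + ∑ (λ _ → 1) xs                    ≡⟨ sym (∑-+ _ (λ _ → 1) xs) ⟩
      ∑ (λ a → ∑ (a ~_) xs + 1) xs                ≤⟨ ∑-mono xs (λ {a} a∈ → ≤-trans (≤-reflexive (+-comm _ 1)) (row a∈ (~-irrefl a))) ⟩
      ∑ (λ _ → length xs) xs                      ≡⟨ ∑-const (length xs) xs ⟩
      length xs * length xs                       ∎
      where open ≤-Reasoning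

    -- The absent edge is missing once in the row of `a` and once in its column.
    D-bound-non-edge : ∀ {a b} xs → b ∈ xs → a ~ b ≡ 0 →
                       D (a ∷ xs) (a ∷ xs) + suc (length xs) + 2 ≤ suc (length xs) * suc (length xs)
    D-bound-non-edge {a} xs b∈ a≁b = begin
      D (a ∷ xs) (a ∷ xs) + suc n + 2                        ≡⟨ cong (λ z → z + suc n + 2) (D-split [ a ] xs ↭-refl) ⟩
      a ~ a + 0 + 0 + (R + 0 + (R + 0)) + D xs xs + suc n + 2 ≡⟨ cong (λ z → z + 0 + 0 + (R + 0 + (R + 0)) + D xs xs + suc n + 2) (~-irrefl a) ⟩
      0 + (R + 0 + (R + 0)) + D xs xs + suc n + 2            ≡⟨ lemma₁ R (D xs xs) n ⟩
      suc R + suc R + (D xs xs + n) + 1                      ≤⟨ +-monoˡ-≤ 1 (+-mono-≤ (+-mono-≤ (row b∈ a≁b) (row b∈ a≁b)) (D-bound xs)) ⟩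
      n + n + n * n + 1                                      ≡⟨ lemma₂ n ⟩
      suc n * suc n                                          ∎
      where
      open ≤-Reasoning
      n = length xs
      R = ∑ (a ~_) xs
      lemma₁ : ∀ x y z → 0 + (x + 0 + (x + 0)) + y + suc z + 2 ≡ suc x + suc x + (y + z) + 1
      lemma₁ = solve-∀
      lemma₂ : ∀ x → x + x + x * x + 1 ≡ suc x * suc x
      lemma₂ = solve-∀

    -- A minimal dense vertex set and its degree bounds

    record Minimal : Set where
      field
        U        : List V
        K        : ℕ
        K≥3      : 3 ≤ K
        U-unique : Unique U
        dense    : K * length U < D U U
        sparse   : ∀ s {ss ws} → U ↭ (s ∷ ss) ++ ws → D ws ws ≤ K * length ws

  module Minimality (I : Incidence) (M : Shadow.Minimal I) where
    open Shadow I
    open Minimal M public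

    deg : V → ℕ
    deg v = ∑ (v ~_) U

    Good : List V → Set
    Good vs = Unique vs × All (_∈ U) vs

    complement : ∀ vs → Good vs → ∃ λ ws → U ↭ vs ++ ws
    complement [] _ = U , ↭-refl
    complement (v ∷ vs) (v∉ ∷ u , v∈U ∷ vs∈U) with complement vs (u , vs∈U)
    ... | ws , p with ∈-++⁻ vs (∈-resp-↭ p v∈U)
    ...   | inj₁ v∈vs = ⊥-elim (All.lookup v∉ v∈vs refl)
    ...   | inj₂ v∈ws with ∈-∃++ v∈ws
    ...     | xs , ys , refl = xs ++ ys , ↭-trans p (↭-trans (++⁺ˡ vs (shift v xs ys)) (shift v vs (xs ++ ys)))

    -- Passing from `U` to `ws` destroys `D S S + 2 * D S ws` ordered pairs, which is more than
    -- `K * length S`; a further `D S S` on both sides turns the count into twice the degree sum.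
    excess : ∀ s ss → Good (s ∷ ss) → K * length (s ∷ ss) + D (s ∷ ss) (s ∷ ss) < 2 * ∑ deg (s ∷ ss)
    excess s ss good with complement (s ∷ ss) good
    ... | ws , p = begin-strict
      K * length S + D S S                          <⟨ +-monoˡ-< (D S S) gain ⟩
      D S S + (D S ws + D S ws) + D S S             ≡⟨ lemma (D S S) (D S ws) ⟩
      2 * (D S S + D S ws)                          ≡⟨ cong (2 *_) (sym (D-++ʳ S S)) ⟩
      2 * D S (S ++ ws)                             ≡⟨ cong (2 *_) (sym (D-↭ʳ S p)) ⟩
      2 * ∑ deg S                                   ∎
      where
      open ≤-Reasoning
      S = s ∷ ss
      lemma : ∀ x y → x + (y + y) + x ≡ 2 * (x + y)
      lemma = solve-∀
      gain : K * length S < D S S + (D S ws + D S ws)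
      gain = +-cancelʳ-< (K * length ws) _ _ (begin-strict
        K * length S + K * length ws               ≡⟨ sym (*-distribˡ-+ K (length S) (length ws)) ⟩
        K * (length S + length ws)                 ≡⟨ cong (K *_) (sym (trans (↭-length p) (length-++ S))) ⟩
        K * length U                               <⟨ dense ⟩
        D U U                                      ≡⟨ D-split S ws p ⟩
        D S S + (D S ws + D S ws) + D ws ws        ≤⟨ +-monoʳ-≤ _ (sparse s {ss} {ws} p) ⟩
        D S S + (D S ws + D S ws) + K * length ws  ∎)

    ∈U : ∀ {vs v} → Good vs → v ∈ vs → v ∈ U
    ∈U (_ , vs∈U) = All.lookup vs∈U

    deg-min : ∀ {v} → v ∈ U → K < 2 * deg v
    deg-min {v} v∈ = begin-strict
      K                       ≡⟨ sym (*-identityʳ K) ⟩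
      K * 1                   ≤⟨ m≤m+n _ _ ⟩
      K * 1 + D [ v ] [ v ]   <⟨ excess v [] ([] ∷ [] , v∈ ∷ []) ⟩
      2 * ∑ deg [ v ]         ≡⟨ cong (2 *_) (+-identityʳ (deg v)) ⟩
      2 * deg v               ∎
      where open ≤-Reasoning

    ~-Adj : ∀ {a b} → Adj a b → a ~ b ≡ 1
    ~-Adj {a} {b} = 𝟙-yes (Adj? a b)

    deg-edge : ∀ {a b} → a ∈ U → b ∈ U → Adj a b → 2 + K ≤ deg a + deg b
    deg-edge {a} {b} a∈ b∈ a~b = *-cancelˡ-< 2 _ _ (begin-strict
      2 * (1 + K)                             ≡⟨ lemma K ⟩
      K * 2 + (0 + (1 + 0) + (1 + (0 + 0) + 0)) ≡⟨ cong (K * 2 +_) (sym rows) ⟩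
      K * 2 + D S S                           <⟨ excess a [ b ] ((proj₁ a~b ∷ []) ∷ [] ∷ [] , a∈ ∷ b∈ ∷ []) ⟩
      2 * (deg a + (deg b + 0))               ≡⟨ cong (λ z → 2 * (deg a + z)) (+-identityʳ _) ⟩
      2 * (deg a + deg b)                     ∎)
      where
      open ≤-Reasoning
      S = a ∷ [ b ]
      lemma : ∀ x → 2 * (1 + x) ≡ x * 2 + 2
      lemma = solve-∀
      rows : D S S ≡ 2
      rows rewrite ~-irrefl a | ~-irrefl b | ~-Adj a~b | ~-Adj (Adj-sym a~b) = refl

    deg-triangle : ∀ {a b c} → a ∈ U → b ∈ U → c ∈ U → Adj a b → Adj a c → Adj b c →
                   3 * K + 6 < 2 * (deg a + deg b + deg c)
    deg-triangle {a} {b} {c} a∈ b∈ c∈ a~b a~c b~c = begin-strict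
      3 * K + 6                               ≡⟨ cong₂ _+_ (*-comm 3 K) (sym rows) ⟩
      K * 3 + D S S                           <⟨ excess a (b ∷ [ c ]) ((proj₁ a~b ∷ proj₁ a~c ∷ []) ∷ (proj₁ b~c ∷ []) ∷ [] ∷ [] , a∈ ∷ b∈ ∷ c∈ ∷ []) ⟩
      2 * (deg a + (deg b + (deg c + 0)))     ≡⟨ lemma (deg a) (deg b) (deg c) ⟩
      2 * (deg a + deg b + deg c)             ∎
      where
      open ≤-Reasoning
      S = a ∷ b ∷ [ c ]
      lemma : ∀ x y z → 2 * (x + (y + (z + 0))) ≡ 2 * (x + y + z)
      lemma = solve-∀
      rows : D S S ≡ 6
      rows rewrite ~-irrefl a | ~-irrefl b | ~-irrefl c | ~-Adj a~b | ~-Adj (Adj-sym a~b)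
                 | ~-Adj a~c | ~-Adj (Adj-sym a~c) | ~-Adj b~c | ~-Adj (Adj-sym b~c) = refl

    deg-4-cycle : ∀ {a b c d} → a ∈ U → b ∈ U → c ∈ U → d ∈ U → a ≢ c → b ≢ d →
                  Adj a b → Adj b c → Adj c d → Adj d a →
                  2 * K + 4 < deg a + deg b + (deg c + deg d)
    deg-4-cycle {a} {b} {c} {d} a∈ b∈ c∈ d∈ a≢c b≢d a~b b~c c~d d~a = *-cancelˡ-< 2 _ _ (begin-strict
      2 * (2 * K + 4)                         ≡⟨ lemma₁ K ⟩
      K * 4 + 8                               ≤⟨ +-monoʳ-≤ (K * 4) rows ⟩
      K * 4 + D S S                           <⟨ excess a (b ∷ c ∷ [ d ])
         ((proj₁ a~b ∷ a≢c ∷ (proj₁ d~a ∘ sym) ∷ []) ∷ (proj₁ b~c ∷ b≢d ∷ []) ∷ (proj₁ c~d ∷ []) ∷ [] ∷ [] , a∈ ∷ b∈ ∷ c∈ ∷ d∈ ∷ []) ⟩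
      2 * (deg a + (deg b + (deg c + (deg d + 0)))) ≡⟨ lemma₂ (deg a) (deg b) (deg c) (deg d) ⟩
      2 * (deg a + deg b + (deg c + deg d))   ∎)
      where
      open ≤-Reasoning
      S = a ∷ b ∷ c ∷ [ d ]
      lemma₁ : ∀ x → 2 * (2 * x + 4) ≡ x * 4 + 8
      lemma₁ = solve-∀
      lemma₂ : ∀ x y z w → 2 * (x + (y + (z + (w + 0)))) ≡ 2 * (x + y + (z + w))
      lemma₂ = solve-∀
      lemma₃ : ∀ x y z w → 0 + (1 + (x + (1 + 0))) + (1 + (0 + (1 + (z + 0))) + (y + (1 + (0 + (1 + 0))) + (1 + (w + (1 + (0 + 0))) + 0))) ≡ 8 + (x + y + z + w)
      lemma₃ = solve-∀
      rows : 8 ≤ D S S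
      rows rewrite ~-irrefl a | ~-irrefl b | ~-irrefl c | ~-irrefl d | ~-Adj a~b | ~-Adj (Adj-sym a~b)
                 | ~-Adj b~c | ~-Adj (Adj-sym b~c) | ~-Adj c~d | ~-Adj (Adj-sym c~d) | ~-Adj d~a | ~-Adj (Adj-sym d~a) =
        ≤-trans (m≤m+n 8 _) (≤-reflexive (sym (lemma₃ (a ~ c) (c ~ a) (b ~ d) (d ~ b))))

    -- Both sides are proper parts of `U` and hence sparse; without edges between them their bounds
    -- would add up to the bound that `U` violates.
    connected : ∀ s ss w ws → U ↭ (s ∷ ss) ++ (w ∷ ws) → (∀ {x y} → x ∈ s ∷ ss → y ∈ w ∷ ws → ¬ Adj x y) → ⊥
    connected s ss w ws p apart = <-irrefl refl (begin-strict
      K * length U                            <⟨ dense ⟩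
      D U U                                   ≡⟨ D-split S W p ⟩
      D S S + (D S W + D S W) + D W W         ≡⟨ cong (λ z → D S S + (z + z) + D W W) none ⟩
      D S S + 0 + D W W                       ≡⟨ cong (_+ D W W) (+-identityʳ (D S S)) ⟩
      D S S + D W W                           ≤⟨ +-mono-≤ (sparse w {ws} {S} (↭-trans p (++-comm S W))) (sparse s {ss} {W} p) ⟩
      K * length S + K * length W             ≡⟨ sym (*-distribˡ-+ K (length S) (length W)) ⟩
      K * (length S + length W)               ≡⟨ cong (K *_) (sym (trans (↭-length p) (length-++ S))) ⟩
      K * length U                            ∎)
      where
      open ≤-Reasoning
      S = s ∷ ss
      W = w ∷ ws
      none : D S W ≡ 0
      none = ∑-zero S λ {x} x∈ → ∑-zero W λ {y} y∈ → 𝟙-no (Adj? x y) (apart x∈ y∈)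

    -- The average degree exceeds K, yet no degree exceeds `length U` minus one.
    K+2≤∣U∣ : 2 + K ≤ length U
    K+2≤∣U∣ = *-cancelʳ-< _ (1 + K) (length U) (begin-strict
      (1 + K) * length U               ≡⟨ +-comm (length U) _ ⟩
      K * length U + length U          <⟨ +-monoˡ-< (length U) dense ⟩
      D U U + length U                 ≤⟨ D-bound U ⟩
      length U * length U              ∎)
      where open ≤-Reasoning

    mates : E → V → ℕ
    mates f x = count (λ w → (w ◂? f) ×-dec ¬? (w ≟ⱽ x)) U

    mates≤2 : ∀ {f x} → x ◂ f → mates f x ≤ 2
    mates≤2 xf = count≤2 _ U U-unique λ _ _ _ (uf , u≢x) (vf , v≢x) (wf , w≢x) u≢v u≢w v≢w →
      size≤3 xf uf vf wf (u≢x ∘ sym) (v≢x ∘ sym) (w≢x ∘ sym) u≢v u≢w v≢w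

    deg≤2 : ∀ {f x} → x ◂ f → (∀ {w} → w ∈ U → Adj x w → w ◂ f) → deg x ≤ 2
    deg≤2 {f} {x} xf inside = ≤-trans (∑-mono U λ {w} w∈ → 𝟙-mono (Adj? x w) ((w ◂? f) ×-dec ¬? (w ≟ⱽ x))
      λ x~w → inside w∈ x~w , proj₁ x~w ∘ sym) (mates≤2 xf)

    -- Here `K≥3` enters: the degree sum along an edge is at least 5.
    low-edge : ∀ {x y} → x ∈ U → y ∈ U → Adj x y → deg x ≤ 2 → deg y ≤ 2 → ⊥
    low-edge x∈ y∈ x~y dx dy = <-irrefl refl (≤-trans (+-monoʳ-≤ 2 K≥3) (≤-trans (deg-edge x∈ y∈ x~y) (+-mono-≤ dx dy)))

    -- Longest paths and opened Berge cycles

    record Longest : Set where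
      field
        ℓ       : ℕ
        ℓ≤K     : ℓ ≤ K
        ℓ≥2     : 2 ≤ ℓ
        longest : ∀ {a b vs es} → Seg a b vs es → Good vs → Unique es → length vs ≤ suc ℓ

    module LongestPath (Λ : Longest) where
      open Longest Λ public

      opaque
        good : ∀ {n} (ρ : Vec (List V) n) t s {_ : T (t ⊑ s)} → Good (⟦ s ⟧ ρ) → Good (⟦ t ⟧ ρ)
        good ρ t s {ok} (u , a) = uniq ρ t s {ok} u , all ρ t s {ok} a

        Good-↭ : ∀ {vs ws} → vs ↭ ws → Good vs → Good ws
        Good-↭ p (u , a) = Unique-resp-↭ p u , All-resp-↭ p a

        Good-∷ : ∀ {v vs} → v ∈ U → v ∉ vs → Good vs → Good (v ∷ vs)
        Good-∷ v∈ v∉ (u , a) = uniq-∷ v∉ u , v∈ ∷ a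

        -- The path visits its blocks in the order of `t` and `t′`, whereas freshness and length are
        -- known in the more convenient order of `s` and `s′`. The hyperedges may be a proper part
        -- of `s′`.
        too-long : ∀ {n} (ρ : Vec (List V) n) t s {_ : T (t ⊑ s)} {_ : T (t ≋ s)} → Good (⟦ s ⟧ ρ) → length (⟦ s ⟧ ρ) ≡ 2 + ℓ →
                   ∀ {m} (σ : Vec (List E) m) t′ s′ {_ : T (t′ ⊑ s′)} → Unique (⟦ s′ ⟧ σ) →
                   ∀ {a b} → Seg a b (⟦ t ⟧ ρ) (⟦ t′ ⟧ σ) → ⊥
        too-long ρ t s {ok} {ok′} gd ln σ t′ s′ {ok″} u S = <-irrefl refl (begin-strict
          suc ℓ                 <⟨ ≤-refl ⟩
          2 + ℓ                 ≡⟨ trans (sym ln) (len ρ t s {ok′}) ⟩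
          length (⟦ t ⟧ ρ)      ≤⟨ longest S (good ρ t s {ok} gd) (uniq σ t′ s′ {ok″} u) ⟩
          suc ℓ                 ∎)
          where open ≤-Reasoning

      -- A Berge cycle opened at its hyperedge g, which joins the last vertex b back to the first vertex a.
      record Cyc : Set where
        constructor cyc
        field
          {a b} : V
          {g}   : E
          {vs}  : List V
          {es}  : List E
          seg   : Seg a b vs es
          a◂    : a ◂ g
          b◂    : b ◂ g
          gd    : Good vs
          ue    : Unique (g ∷ es)

      open Cyc public

      _≈_ : Cyc → Cyc → Set
      C ≈ C′ = vs C ↭ vs C′ × (g C ∷ es C) ↭ (g C′ ∷ es C′)

      ≈-refl : ∀ {C} → C ≈ C
      ≈-refl = ↭-refl , ↭-refl

      ≈-trans : ∀ {A B C} → A ≈ B → B ≈ C → A ≈ C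
      ≈-trans (p , q) (p′ , q′) = ↭-trans p p′ , ↭-trans q q′

      g∉es : ∀ C → g C ∉ es C
      g∉es C = head∉ (ue C)

      rotate : ∀ C → (X : Cut (a C) (b C) (vs C) (es C)) →
               Σ Cyc λ C′ → C ≈ C′ × a C′ ≡ Cut.q X × b C′ ≡ Cut.p X × g C′ ≡ Cut.g X
      rotate (cyc {g = h} S a◂ b◂ gd ue) (cut {g = f} {vs₁} {vs₂} {es₁} {es₂} L p◂ q◂ R refl refl) =
        cyc (join R b◂ a◂ L) q◂ p◂ (good ρ (`1 ⊕ `0) (`0 ⊕ `1) gd) (uniq σ (`3 ⊕ `1 ⊕ `2 ⊕ `0) (`2 ⊕ `0 ⊕ `3 ⊕ `1) ue) ,
        (perm ρ (`1 ⊕ `0) (`0 ⊕ `1) , perm σ (`3 ⊕ `1 ⊕ `2 ⊕ `0) (`2 ⊕ `0 ⊕ `3 ⊕ `1)) , refl , refl , refl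
        where
        ρ = vs₁ ∷ vs₂ ∷ []
        σ = es₁ ∷ es₂ ∷ [ h ] ∷ [ f ] ∷ []

      mirror : ∀ C → Σ Cyc λ C′ → C ≈ C′ × a C′ ≡ b C × b C′ ≡ a C × g C′ ≡ g C
      mirror C@(cyc S a◂ b◂ gd ue) = cyc (rev S) b◂ a◂ (Good-↭ (rv-↭ _) gd) (Unique-resp-↭ (prep _ (rv-↭ _)) ue) ,
        (rv-↭ _ , prep _ (rv-↭ _)) , refl , refl , refl

      _∈ᴱ?_ : ∀ e es → Dec (e ∈ es)
      e ∈ᴱ? es = Any.any? (e ≟ᴱ_) es
        where import Data.List.Relation.Unary.Any as Any

      _∈ⱽ?_ : ∀ v vs → Dec (v ∈ vs)
      v ∈ⱽ? vs = Any.any? (v ≟ⱽ_) vs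
        where import Data.List.Relation.Unary.Any as Any

      -- If `e` is a hyperedge of the cycle, the cycle is opened at `e` itself, otherwise at `c`.
      -- Either way the vertex at the opening lies on `e`, and `e` is free to lead out of the cycle.
      attach : ∀ C {c e} → c ∈ vs C → c ◂ e → Σ Cyc λ C′ → C ≈ C′ × a C′ ◂ e × e ∉ es C′
      attach C {c} {e} c∈ c◂ with e ∈ᴱ? (g C ∷ es C)
      ... | yes (here refl) = C , ≈-refl {C} , a◂ C , g∉es C
      ... | yes (there e∈) with cutE (seg C) e∈
      ...   | X , refl with rotate C X
      ...     | C′ , eq , refl , refl , refl = C′ , eq , a◂ C′ , g∉es C′
      attach C {c} {e} c∈ c◂ | no e∉ with cutV (seg C) c∈
      ... | inj₁ refl = C , ≈-refl {C} , c◂ , e∉ ∘ there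
      ... | inj₂ (X , refl) with rotate C X
      ...   | C′ , eq , refl , _ , _ = C′ , eq , c◂ , λ e∈ → e∉ (∈-resp-↭ (↭-sym (proj₂ eq)) (there e∈))

      search : ∀ xs ys → (∃₂ λ x y → x ∈ xs × y ∈ ys × Adj x y) ⊎ (∀ {x y} → x ∈ xs → y ∈ ys → ¬ Adj x y)
      search xs ys with find (λ x → reach x) xs
        where
        reach : ∀ x → Dec (∃ λ y → y ∈ ys × Adj x y)
        reach x with find (Adj? x) ys
        ... | inj₁ r    = yes r
        ... | inj₂ none = no λ (y , y∈ , x~y) → none y∈ x~y
      ... | inj₁ (x , x∈ , y , y∈ , x~y) = inj₁ (x , y , x∈ , y∈ , x~y)
      ... | inj₂ none = inj₂ λ x∈ y∈ x~y → none x∈ (_ , y∈ , x~y)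

      linked : ∀ {S W x y} → U ↭ S ++ W → x ∈ S → y ∈ W → (∀ {x y} → x ∈ S → y ∈ W → ¬ Adj x y) → ⊥
      linked {S = _ ∷ _} {_ ∷ _} p _ _ = connected _ _ _ _ p

      -- ℓ + 1 ≤ K + 1 < ∣U∣, so something is left over.
      outside : ∀ {vs} → Good vs → length vs ≤ suc ℓ → ∃₂ λ w ws → U ↭ vs ++ w ∷ ws
      outside {vs} gd le with complement vs gd
      ... | [] , p = ⊥-elim (<-irrefl refl (begin-strict
          suc ℓ            <⟨ s≤s (s≤s ℓ≤K) ⟩
          2 + K            ≤⟨ K+2≤∣U∣ ⟩
          length U         ≡⟨ trans (↭-length p) (trans (length-++ vs) (+-identityʳ _)) ⟩
          length vs        ≤⟨ le ⟩
          suc ℓ            ∎))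
          where open ≤-Reasoning
      ... | w ∷ ws , p = w , ws , p

      ∉-complement : ∀ {vs ws w} → U ↭ vs ++ ws → w ∈ ws → w ∉ vs
      ∉-complement {vs} p w∈ w∈vs = disjoint-++ vs (Unique-resp-↭ p U-unique) w∈vs w∈ refl

      ∈-complement : ∀ {vs ws w} → U ↭ vs ++ ws → w ∈ ws → w ∈ U
      ∈-complement {vs} p w∈ = ∈-resp-↭ (↭-sym p) (∈-++⁺ʳ vs w∈)

      no-long-cycle : (C : Cyc) → length (vs C) ≢ suc ℓ
      no-long-cycle C ln with outside (gd C) (≤-reflexive ln)
      ... | w , ws , p with search (vs C) (w ∷ ws)
      ...   | inj₂ apart = linked p (start∈ (seg C)) (here refl) apart
      ...   | inj₁ (c , x , c∈ , x∈ , c≢x , e , c◂ , x◂) with attach C c∈ c◂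
      ...     | C′ , eq , a◂e , e∉ =
        too-long (vs C′ ∷ [ x ] ∷ []) (`1 ⊕ `0) (`1 ⊕ `0)
          (Good-∷ (∈-complement p x∈) (λ x∈′ → ∉-complement p x∈ (∈-resp-↭ (↭-sym (proj₁ eq)) x∈′)) (gd C′))
          (cong suc (trans (sym (↭-length (proj₁ eq))) ln))
          (es C′ ∷ [ e ] ∷ []) (`1 ⊕ `0) (`1 ⊕ `0) (uniq-∷ e∉ (drop-head (ue C′)))
          (step x◂ a◂e (seg C′))
        where
        drop-head : ∀ {A : Set} {x : A} {xs} → Unique (x ∷ xs) → Unique xs
        drop-head (_ ∷ u) = u

      -- Shifting `h` by one place along the path pairs each `h p` with the `f q` across the gap;
      -- only `f a` and `h b` find no partner.
      gap-sum : ∀ (f h : V → ℕ) N {a b vs es} → Seg a b vs es → (∀ (X : Cut a b vs es) → f (Cut.q X) + h (Cut.p X) ≤ N) →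
                ∑ f vs + ∑ h vs ≤ N * length es + (f a + h b)
      gap-sum f h N (pt a) bound = ≤-trans (≤-reflexive (cong₂ _+_ (+-identityʳ (f a)) (+-identityʳ (h a)))) (m≤n+m _ (N * 0))
      gap-sum f h N {a} {b} (step {b = a′} {vs = vs} {es} a◂ a′◂ S) bound = begin
        f a + F + (h a + H)                        ≡⟨ lemma₁ (f a) (h a) F H ⟩
        f a + h a + (F + H)                        ≤⟨ +-monoʳ-≤ (f a + h a) (gap-sum f h N S λ X → bound (stepCut a◂ a′◂ X)) ⟩
        f a + h a + (N * length es + (f a′ + h b)) ≡⟨ lemma₂ (f a) (h a) (f a′) (h b) (N * length es) ⟩
        f a′ + h a + (N * length es + (f a + h b)) ≤⟨ +-monoˡ-≤ _ (bound (cut (pt _) a◂ a′◂ S refl refl)) ⟩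
        N + (N * length es + (f a + h b))          ≡⟨ sym (+-assoc N _ _) ⟩
        N + N * length es + (f a + h b)            ≡⟨ cong (_+ (f a + h b)) (sym (*-suc N (length es))) ⟩
        N * suc (length es) + (f a + h b)          ∎
        where
        open ≤-Reasoning
        F = ∑ f vs
        H = ∑ h vs
        lemma₁ : ∀ x y z w → x + z + (y + w) ≡ x + y + (z + w)
        lemma₁ = solve-∀
        lemma₂ : ∀ x y z w n → x + y + (n + (z + w)) ≡ z + y + (n + (x + w))
        lemma₂ = solve-∀

      next : Cyc → Cyc
      next C@(cyc (pt _) _ _ _ _) = C
      next (cyc {g = h} (step {a} {e = e} {vs} {es} a◂e a′◂e S) a◂ b◂ gd ue) =
        cyc (join S b◂ a◂ (pt a)) a′◂e a◂e (good (vs ∷ [ a ] ∷ []) (`0 ⊕ `1) (`1 ⊕ `0) gd)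
          (uniq (es ∷ [ h ] ∷ [ e ] ∷ []) (`2 ⊕ `0 ⊕ `1) (`1 ⊕ `2 ⊕ `0) ue)

      next-≈ : ∀ C → C ≈ next C
      next-≈ C@(cyc (pt _) _ _ _ _) = ≈-refl {C}
      next-≈ (cyc {g = h} (step {a} {e = e} {vs} {es} _ _ _) _ _ _ _) =
        perm (vs ∷ [ a ] ∷ []) (`0 ⊕ `1) (`1 ⊕ `0) , perm (es ∷ [ h ] ∷ [ e ] ∷ []) (`2 ⊕ `0 ⊕ `1) (`1 ⊕ `2 ⊕ `0)

      b-next : ∀ C → b (next C) ≡ a C
      b-next (cyc (pt _) _ _ _ _) = refl
      b-next (cyc (step _ _ _) _ _ _ _) = refl

      vs-next : ∀ C {x xs} → vs C ≡ x ∷ xs → a C ≡ x × vs (next C) ≡ xs ++ [ x ]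
      vs-next (cyc (pt _) _ _ _ _) refl = refl , refl
      vs-next (cyc (step _ _ _) _ _ _ _) refl = refl , refl

      orbit : ℕ → Cyc → List Cyc
      orbit zero    C = []
      orbit (suc n) C = C ∷ orbit n (next C)

      orbit-sum : ∀ (X : V → ℕ) C xs ys → vs C ≡ xs ++ ys → ∑ (X ∘ a) (orbit (length xs) C) ≡ ∑ X xs
      orbit-sum X C [] ys eq = refl
      orbit-sum X C (x ∷ xs) ys eq with vs-next C eq
      ... | a≡ , eq′ = cong₂ _+_ (cong X a≡) (orbit-sum X (next C) xs (ys ++ [ x ]) (trans eq′ (++-assoc xs ys [ x ])))

      orbit-vs : ∀ (X : V → ℕ) C → ∑ (X ∘ a) (orbit (length (vs C)) C) ≡ ∑ X (vs C)
      orbit-vs X C = orbit-sum X C (vs C) [] (sym (++-identityʳ _))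

      orbit-next : ∀ (F : Cyc → ℕ) n C → ∑ (F ∘ next) (orbit n C) ≡ ∑ F (orbit n (next C))
      orbit-next F zero C = refl
      orbit-next F (suc n) C = cong (F (next C) +_) (orbit-next F n (next C))

      next-sum : ∀ (X : V → ℕ) C → ∑ (X ∘ a ∘ next) (orbit (length (vs C)) C) ≡ ∑ X (vs C)
      next-sum X C = begin
        ∑ (X ∘ a ∘ next) (orbit (length (vs C)) C)     ≡⟨ orbit-next (X ∘ a) (length (vs C)) C ⟩
        ∑ (X ∘ a) (orbit (length (vs C)) (next C))     ≡⟨ cong (λ n → ∑ (X ∘ a) (orbit n (next C))) (↭-length (proj₁ (next-≈ C))) ⟩
        ∑ (X ∘ a) (orbit (length (vs (next C))) (next C)) ≡⟨ orbit-vs X (next C) ⟩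
        ∑ X (vs (next C))                              ≡⟨ sym (∑-↭ X (proj₁ (next-≈ C))) ⟩
        ∑ X (vs C)                                     ∎
        where open ≡-Reasoning

      -- Averaging over all openings: each vertex occurs once as `b`, once as `a` and once as the
      -- vertex after `a`, so a bound on three consecutive vertices becomes one on the whole cycle.
      cyclic-sum : ∀ (X Y Z : V → ℕ) N C → (∀ C′ → C ≈ C′ → X (b C′) + (Y (a C′) + Z (a (next C′))) ≤ N) →
                   ∑ X (vs C) + (∑ Y (vs C) + ∑ Z (vs C)) ≤ N * length (vs C)
      cyclic-sum X Y Z N C bound = begin
        ∑ X (vs C) + (∑ Y (vs C) + ∑ Z (vs C))  ≡⟨ cong₂ _+_ (sym (orbit-vs X C)) (cong₂ _+_ (sym (next-sum Y C)) (sym next²-sum)) ⟩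
        ∑ (X ∘ a) O + (∑ (Y ∘ a ∘ next) O + ∑ (Z ∘ a ∘ next ∘ next) O) ≡⟨ cong (∑ (X ∘ a) O +_) (sym (∑-+ (Y ∘ a ∘ next) (Z ∘ a ∘ next ∘ next) O)) ⟩
        ∑ (X ∘ a) O + ∑ (λ C → Y (a (next C)) + Z (a (next (next C)))) O ≡⟨ sym (∑-+ (X ∘ a) _ O) ⟩
        ∑ (λ C → X (a C) + (Y (a (next C)) + Z (a (next (next C))))) O   ≤⟨ each (length (vs C)) C (≈-refl {C}) ⟩
        N * length (vs C)                       ∎
        where
        open ≤-Reasoning
        O = orbit (length (vs C)) C
        next²-sum : ∑ (Z ∘ a ∘ next ∘ next) O ≡ ∑ Z (vs C)
        next²-sum = trans (orbit-next (Z ∘ a ∘ next) (length (vs C)) C)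
          (trans (cong (λ n → ∑ (Z ∘ a ∘ next) (orbit n (next C))) (↭-length (proj₁ (next-≈ C))))
            (trans (next-sum Z (next C)) (sym (∑-↭ Z (proj₁ (next-≈ C))))))
        each : ∀ n C′ → C ≈ C′ → ∑ (λ C → X (a C) + (Y (a (next C)) + Z (a (next (next C))))) (orbit n C′) ≤ N * n
        each zero C′ eq = z≤n
        each (suc n) C′ eq = ≤-trans
          (+-mono-≤ (≤-trans (≤-reflexive (cong (λ v → X v + (Y (a (next C′)) + Z (a (next (next C′))))) (sym (b-next C′)))) (bound (next C′) eq′))
                    (each n (next C′) eq′))
          (≤-reflexive (sym (*-suc N n)))
          where
          eq′ : C ≈ next C′
          eq′ = ≈-trans {C} {C′} {next C′} eq (next-≈ C′)

      -- Three outsiders attached to a path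

      Port : List E → V → V → Set
      Port es c x = c ≢ x × ∃ λ e → c ◂ e × x ◂ e × e ∉ es

      opaque
        Port? : ∀ es c x → Dec (Port es c x)
        Port? es c x with c ≟ⱽ x | link? c x
        ... | yes c≡x | _ = no λ (c≢x , _) → c≢x c≡x
        ... | no c≢x | no ¬l = no λ (_ , e , c◂ , x◂ , _) → ¬l (e , c◂ , x◂)
        ... | no c≢x | yes (e , c◂ , x◂) with e ∈ᴱ? es
        ...   | no e∉ = yes (c≢x , e , c◂ , x◂ , e∉)
        ...   | yes e∈ = no λ (_ , e′ , c◂′ , x◂′ , e′∉) → e′∉ (subst (_∈ es) (linear c≢x c◂ x◂ c◂′ x◂′) e∈)

      on : E → List V → ℕ
      on e = count (_◂? e)

      on≤2 : ∀ {e p xs} → Unique xs → p ∉ xs → p ◂ e → on e xs ≤ 2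
      on≤2 {e} u p∉ p◂ = count≤2 (_◂? e) _ u λ x∈ y∈ z∈ x◂ y◂ z◂ x≢y x≢z y≢z →
        size≤3 p◂ x◂ y◂ z◂ (λ { refl → p∉ x∈ }) (λ { refl → p∉ y∈ }) (λ { refl → p∉ z∈ }) x≢y x≢z y≢z

      on≤1 : ∀ {e p q xs} → Unique xs → p ∉ xs → q ∉ xs → p ≢ q → p ◂ e → q ◂ e → on e xs ≤ 1
      on≤1 {e} u p∉ q∉ p≢q p◂ q◂ = count≤1 (_◂? e) _ u same
        where
        same : ∀ {x y} → x ∈ _ → y ∈ _ → x ◂ e → y ◂ e → x ≡ y
        same {x} {y} x∈ y∈ x◂ y◂ with x ≟ⱽ y
        ... | yes eq = eq
        ... | no x≢y = ⊥-elim (size≤3 p◂ q◂ x◂ y◂ p≢q (λ { refl → p∉ x∈ }) (λ { refl → p∉ y∈ })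
                         (λ { refl → q∉ x∈ }) (λ { refl → q∉ y∈ }) x≢y)

      -- Three vertices z, x, y attached to a path R which covers everything else:
      -- the hyperedges {z, r, x} and {z, b, y} hang at its ends r and b, so the three outsiders play symmetric roles.
      module Triad {z x y r b vs es A B} (R : Seg r b vs es) (gd : Good (z ∷ x ∷ y ∷ vs))
                   (ln : length (z ∷ x ∷ y ∷ vs) ≡ 2 + ℓ) (ue : Unique (A ∷ B ∷ es))
                   (zA : z ◂ A) (rA : r ◂ A) (xA : x ◂ A) (zB : z ◂ B) (bB : b ◂ B) (yB : y ◂ B) where

        T₃ : List V
        T₃ = z ∷ x ∷ y ∷ []

        u-T₃ : Unique T₃
        u-T₃ = Unique-++ˡ T₃ (proj₁ gd)

        off : ∀ {t c} → t ∈ T₃ → c ∈ vs → t ≢ c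
        off = disjoint-++ T₃ (proj₁ gd)

        off′ : ∀ {c} → c ∈ vs → c ∉ T₃
        off′ c∈ c∈T = off c∈T c∈ refl

        uv : Unique vs
        uv = uniq (T₃ ∷ vs ∷ []) `1 (`0 ⊕ `1) (proj₁ gd)

        tz : z ∈ T₃
        tz = here refl
        tx : x ∈ T₃
        tx = there (here refl)
        ty : y ∈ T₃
        ty = there (there (here refl))

        z≢x : z ≢ x
        z≢x = λ { refl → head∉ u-T₃ (here refl) }
        z≢y : z ≢ y
        z≢y = λ { refl → head∉ u-T₃ (there (here refl)) }
        x≢y : x ≢ y
        x≢y = λ { refl → head∉ (uniq ([ z ] ∷ (x ∷ [ y ]) ∷ []) `1 (`0 ⊕ `1) u-T₃) (here refl) }

        -- The hyperedge of the gap itself is left out, since a path that makes a detour at the gap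
        -- sets it free.
        busy : Cut r b vs es → List E
        busy X = A ∷ B ∷ Cut.es₁ X ++ Cut.es₂ X

        -- A Hamiltonian path entering the outsiders between p and q.
        insert : ∀ {u v e f} (X : Cut r b vs es) → u ∈ T₃ → v ∈ T₃ → u ◂ e → Cut.p X ◂ e → v ◂ f → Cut.q X ◂ f →
                 e ≢ f → e ∉ busy X → f ∉ busy X → ⊥
        insert {u} {v} {e} {f} (cut {g = g} {vs₁} {vs₂} {es₁} {es₂} R₁ _ _ R₂ refl refl) u∈ v∈ ue′ pe vf qf e≢f e∉ f∉ = go u∈ v∈ ue′ vf
          where
          ρ : Vec (List V) 5
          ρ = vs₁ ∷ vs₂ ∷ [ z ] ∷ [ x ] ∷ [ y ] ∷ []
          σ : Vec (List E) 6
          σ = es₁ ∷ es₂ ∷ [ A ] ∷ [ B ] ∷ [ e ] ∷ [ f ] ∷ []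
          s : Tree 5
          s = `2 ⊕ `3 ⊕ `4 ⊕ `0 ⊕ `1
          s′ : Tree 6
          s′ = `4 ⊕ `5 ⊕ `2 ⊕ `3 ⊕ `0 ⊕ `1
          uu : Unique (e ∷ f ∷ A ∷ B ∷ es₁ ++ es₂)
          uu = uniq-∷ (λ { (here e≡f) → e≢f e≡f ; (there e∈) → e∉ e∈ }) (uniq-∷ f∉
                 (uniq (es₁ ∷ es₂ ∷ [ A ] ∷ [ B ] ∷ [ g ] ∷ []) (`2 ⊕ `3 ⊕ `0 ⊕ `1) (`2 ⊕ `3 ⊕ `0 ⊕ `4 ⊕ `1) ue))
          -- `A` and `B` either prolong `R` at its ends or link the outsiders in the order x, z, y;
          -- each of the nine choices of (u, v) admits a combination that visits everything.
          go : u ∈ T₃ → v ∈ T₃ → u ◂ e → v ◂ f → ⊥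
          go (there (here refl)) (there (here refl)) ue vf = too-long ρ (`2 ⊕ `0 ⊕ `3 ⊕ `1 ⊕ `4) s gd ln σ (`2 ⊕ `0 ⊕ `4 ⊕ `5 ⊕ `1 ⊕ `3) s′ uu
            (step zA rA (join R₁ pe ue (step vf qf (join R₂ bB yB (pt y)))))
          go (there (there (here refl))) (there (there (here refl))) ue vf = too-long ρ (`3 ⊕ `0 ⊕ `4 ⊕ `1 ⊕ `2) s gd ln σ (`2 ⊕ `0 ⊕ `4 ⊕ `5 ⊕ `1 ⊕ `3) s′ uu
            (step xA rA (join R₁ pe ue (step vf qf (join R₂ bB zB (pt z)))))
          go (here refl) (here refl) ue vf = too-long ρ (`3 ⊕ `0 ⊕ `2 ⊕ `1 ⊕ `4) s gd ln σ (`2 ⊕ `0 ⊕ `4 ⊕ `5 ⊕ `1 ⊕ `3) s′ uu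
            (step xA rA (join R₁ pe ue (step vf qf (join R₂ bB yB (pt y)))))
          go (there (here refl)) (here refl) ue vf = too-long ρ (`0 ⊕ `3 ⊕ `2 ⊕ `1 ⊕ `4) s gd ln σ (`0 ⊕ `4 ⊕ `2 ⊕ `5 ⊕ `1 ⊕ `3) s′ uu
            (join R₁ pe ue (step xA zA (step vf qf (join R₂ bB yB (pt y)))))
          go (here refl) (there (here refl)) ue vf = too-long ρ (`0 ⊕ `2 ⊕ `3 ⊕ `1 ⊕ `4) s gd ln σ (`0 ⊕ `4 ⊕ `2 ⊕ `5 ⊕ `1 ⊕ `3) s′ uu
            (join R₁ pe ue (step zA xA (step vf qf (join R₂ bB yB (pt y)))))
          go (there (there (here refl))) (here refl) ue vf = too-long ρ (`3 ⊕ `0 ⊕ `4 ⊕ `2 ⊕ `1) s gd ln σ (`2 ⊕ `0 ⊕ `4 ⊕ `3 ⊕ `5 ⊕ `1) s′ uu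
            (step xA rA (join R₁ pe ue (step yB zB (step vf qf R₂))))
          go (here refl) (there (there (here refl))) ue vf = too-long ρ (`3 ⊕ `0 ⊕ `2 ⊕ `4 ⊕ `1) s gd ln σ (`2 ⊕ `0 ⊕ `4 ⊕ `3 ⊕ `5 ⊕ `1) s′ uu
            (step xA rA (join R₁ pe ue (step zB yB (step vf qf R₂))))
          go (there (here refl)) (there (there (here refl))) ue vf = too-long ρ (`0 ⊕ `3 ⊕ `2 ⊕ `4 ⊕ `1) s gd ln σ (`0 ⊕ `4 ⊕ `2 ⊕ `3 ⊕ `5 ⊕ `1) s′ uu
            (join R₁ pe ue (step xA zA (step zB yB (step vf qf R₂))))
          go (there (there (here refl))) (there (here refl)) ue vf = too-long ρ (`0 ⊕ `4 ⊕ `2 ⊕ `3 ⊕ `1) s gd ln σ (`0 ⊕ `4 ⊕ `3 ⊕ `2 ⊕ `5 ⊕ `1) s′ uu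
            (join R₁ pe ue (step yB zB (step zA xA (step vf qf R₂))))

        W : V → ℕ
        W c = ∑ (c ~_) T₃

        W≤3 : ∀ c → W c ≤ 3
        W≤3 c = ∑-mono T₃ λ {t} _ → 𝟙≤1 (Adj? c t)

        -- How many outsiders one side of a gap can meet through busy hyperedges: the third vertex
        -- of the neighbouring hyperedge of `R`, or the two outsiders on `A` or `B` if that side is
        -- a single end vertex of `R`.
        slots : List E → ℕ
        slots []      = 2
        slots (_ ∷ _) = 1

        1≤slots : ∀ es → 1 ≤ slots es
        1≤slots []      = s≤s z≤n
        1≤slots (_ ∷ _) = ≤-refl

        record Slot (X : Cut r b vs es) (c : V) (n : ℕ) : Set where
          field
            edge     : E
            few      : on edge T₃ ≤ n
            classify : ∀ {t e} → t ∈ T₃ → c ◂ e → t ◂ e → e ∈ busy X → e ≡ edge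

        only-A : ∀ {c} → c ∈ vs → c ◂ A → c ≡ r
        only-A c∈ cA = fourth z≢x (off tz (start∈ R)) (off tx (start∈ R)) zA xA rA cA (off tz c∈ ∘ sym) (off tx c∈ ∘ sym)

        only-B : ∀ {c} → c ∈ vs → c ◂ B → c ≡ b
        only-B c∈ cB = fourth z≢y (off tz (end∈ R)) (off ty (end∈ R)) zB yB bB cB (off tz c∈ ∘ sym) (off ty c∈ ∘ sym)

        initLast : ∀ {A : Set} (x : A) xs → ∃₂ λ ys y → x ∷ xs ≡ ys ++ [ y ]
        initLast x [] = [] , x , refl
        initLast x (x′ ∷ xs) with initLast x′ xs
        ... | ys , y , eq = x ∷ ys , y , cong (x ∷_) eq

        two-ends : ∀ {c d e ws fs} → Seg c d ws fs → Unique ws → (∀ {w} → w ∈ ws → w ∉ T₃) → e ∈ fs → on e T₃ ≤ 1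
        two-ends S u away e∈ with ends S u e∈
        ... | c , d , c∈ , d∈ , c≢d , c◂ , d◂ = on≤1 u-T₃ (away c∈) (away d∈) c≢d c◂ d◂

        left-slot : (X : Cut r b vs es) → Slot X (Cut.p X) (slots (Cut.es₁ X))
        left-slot X@(cut {p} {q} {vs₁ = vs₁} {vs₂} {es₁} {es₂} R₁ p◂ q◂ R₂ refl refl) = aux R₁ refl {refl}
          where
          u₁ : Unique vs₁
          u₁ = Unique-++ˡ vs₁ uv
          u₂ : Unique vs₂
          u₂ = uniq (vs₁ ∷ vs₂ ∷ []) `1 (`0 ⊕ `1) uv
          p∈ : p ∈ vs
          p∈ = ∈-++⁺ˡ (end∈ R₁)
          class : ∀ {t e} → t ∈ T₃ → p ◂ e → t ◂ e → e ∈ busy X → (e ≡ A × p ≡ r) ⊎ (∃ λ fs → es₁ ≡ fs ++ [ e ])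
          class t∈ pe te (here refl) = inj₁ (refl , only-A p∈ pe)
          class t∈ pe te (there (here refl)) = ⊥-elim (disjoint-++ vs₁ uv (end∈ R₁) (subst (_∈ vs₂) (sym (only-B p∈ pe)) (end∈ R₂)) refl)
          class t∈ pe te (there (there e∈)) with ∈-++⁻ es₁ e∈
          ... | inj₁ e∈₁ with last-edge R₁ u₁ e∈₁ pe te (λ t∈′ → off t∈ (∈-++⁺ˡ t∈′) refl)
          ...   | _ , _ , fs , _ , _ , _ , eq = inj₂ (fs , eq)
          class t∈ pe te (there (there e∈)) | inj₂ e∈₂ =
            ⊥-elim (no-edge R₂ u₂ e∈₂ (off t∈ p∈ ∘ sym) (λ p∈₂ → disjoint-++ vs₁ uv (end∈ R₁) p∈₂ refl)
                      (λ t∈′ → off t∈ (∈-++⁺ʳ vs₁ t∈′) refl) pe te)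
          aux : ∀ {ws fs} (S : Seg r p ws fs) → vs₁ ≡ ws → {eq : es₁ ≡ fs} → Slot X p (slots fs)
          aux (pt _) _ {refl} = record
            { edge = A ; few = on≤2 u-T₃ (off′ (start∈ R)) rA
            ; classify = λ t∈ pe te e∈ → case class t∈ pe te e∈ of λ
                { (inj₁ (e≡A , _)) → e≡A ; (inj₂ (fs , eq)) → ⊥-elim ([]≢∷ʳ fs eq) } }
          aux (step {e = e₀} {es = fs} _ _ S) refl {refl} with initLast e₀ fs
          ... | ys , e₁ , eq₁ = record
            { edge = e₁
            ; few = two-ends R₁ u₁ (off′ ∘ ∈-++⁺ˡ) (subst (e₁ ∈_) (sym eq₁) (∈-++⁺ʳ ys (here refl)))
            ; classify = λ t∈ pe te e∈ → case class t∈ pe te e∈ of λ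
                { (inj₁ (_ , refl)) → ⊥-elim (head∉ u₁ (end∈ S))
                ; (inj₂ (fs′ , eq)) → ∷ʳ-injectiveʳ fs′ ys (trans (sym eq) eq₁) } }

        right-slot : (X : Cut r b vs es) → Slot X (Cut.q X) (slots (Cut.es₂ X))
        right-slot X@(cut {p} {q} {vs₁ = vs₁} {vs₂} {es₁} {es₂} R₁ p◂ q◂ R₂ refl refl) = aux R₂ refl {refl}
          where
          u₁ : Unique vs₁
          u₁ = Unique-++ˡ vs₁ uv
          u₂ : Unique vs₂
          u₂ = uniq (vs₁ ∷ vs₂ ∷ []) `1 (`0 ⊕ `1) uv
          q∈ : q ∈ vs
          q∈ = ∈-++⁺ʳ vs₁ (start∈ R₂)
          class : ∀ {t e} → t ∈ T₃ → q ◂ e → t ◂ e → e ∈ busy X → (e ≡ B × q ≡ b) ⊎ (∃ λ fs → es₂ ≡ e ∷ fs)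
          class t∈ qe te (here refl) = ⊥-elim (disjoint-++ vs₁ uv (subst (_∈ vs₁) (sym (only-A q∈ qe)) (start∈ R₁)) (start∈ R₂) refl)
          class t∈ qe te (there (here refl)) = inj₁ (refl , only-B q∈ qe)
          class t∈ qe te (there (there e∈)) with ∈-++⁻ es₁ e∈
          ... | inj₁ e∈₁ = ⊥-elim (no-edge R₁ u₁ e∈₁ (off t∈ q∈ ∘ sym) (λ q∈₁ → disjoint-++ vs₁ uv q∈₁ (start∈ R₂) refl)
                      (λ t∈′ → off t∈ (∈-++⁺ˡ t∈′) refl) qe te)
          ... | inj₂ e∈₂ with first-edge R₂ u₂ e∈₂ qe te (λ t∈′ → off t∈ (∈-++⁺ʳ vs₁ t∈′) refl)
          ...   | _ , _ , fs , _ , _ , _ , eq = inj₂ (fs , eq)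
          aux : ∀ {ws fs} (S : Seg q b ws fs) → vs₂ ≡ ws → {eq : es₂ ≡ fs} → Slot X q (slots fs)
          aux (pt _) _ {refl} = record
            { edge = B ; few = on≤2 u-T₃ (off′ (end∈ R)) bB
            ; classify = λ t∈ qe te e∈ → case class t∈ qe te e∈ of λ
                { (inj₁ (e≡B , _)) → e≡B ; (inj₂ (_ , ())) } }
          aux (step {e = e₀} _ _ S) refl {refl} = record
            { edge = e₀
            ; few = two-ends R₂ u₂ (off′ ∘ ∈-++⁺ʳ vs₁) (here refl)
            ; classify = λ t∈ qe te e∈ → case class t∈ qe te e∈ of λ
                { (inj₁ (_ , refl)) → ⊥-elim (head∉ u₂ (end∈ S))
                ; (inj₂ (_ , refl)) → refl } }

        -- By `insert`, free hyperedges from `p` and from `q` to outsiders must coincide. If both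
        -- vertices have one, a single hyperedge through `p` and `q` serves them, with one outsider
        -- on it. If one of them has none, the other contributes at most 3, which two units and its
        -- own slot cover.
        pair-bound : (X : Cut r b vs es) → W (Cut.p X) + W (Cut.q X) ≤ 2 + (slots (Cut.es₁ X) + slots (Cut.es₂ X))
        pair-bound X = go (count (Port? bs p) T₃) refl (count (Port? bs q) T₃) refl
          where
          open ≤-Reasoning
          module X = Cut X
          p = X.p
          q = X.q
          bs = busy X
          l = slots X.es₁
          k = slots X.es₂
          p∈ : p ∈ vs
          p∈ = subst (p ∈_) (sym X.vs≡) (∈-++⁺ˡ (end∈ X.left))
          q∈ : q ∈ vs
          q∈ = subst (q ∈_) (sym X.vs≡) (∈-++⁺ʳ X.vs₁ (start∈ X.right))
          p≢q : p ≢ q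
          p≢q = disjoint-++ X.vs₁ (subst Unique X.vs≡ uv) (end∈ X.left) (start∈ X.right)
          W-split : ∀ {c n} → Slot X c n → W c ≤ n + count (Port? bs c) T₃
          W-split {c} {n} s = begin
            W c                                                       ≤⟨ ∑-mono T₃ (λ {t} t∈ → 𝟙-mono⊎ (Adj? c t) (t ◂? edge) (Port? bs c t) (cls t∈)) ⟩
            ∑ (λ t → 𝟙 (t ◂? edge) + 𝟙 (Port? bs c t)) T₃             ≡⟨ ∑-+ (λ t → 𝟙 (t ◂? edge)) (λ t → 𝟙 (Port? bs c t)) T₃ ⟩
            on edge T₃ + count (Port? bs c) T₃                        ≤⟨ +-monoˡ-≤ _ few ⟩
            n + count (Port? bs c) T₃                                 ∎
            where
            open Slot s
            cls : ∀ {t} → t ∈ T₃ → Adj c t → t ◂ edge ⊎ Port bs c t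
            cls t∈ (c≢t , e , ce , te) with e ∈ᴱ? bs
            ... | yes e∈ = inj₁ (subst (_ ◂_) (classify t∈ ce te e∈) te)
            ... | no e∉ = inj₂ (c≢t , e , ce , te , e∉)
          Wp = W-split (left-slot X)
          Wq = W-split (right-slot X)
          same : ∀ {u v e f} → u ∈ T₃ → v ∈ T₃ → u ◂ e → p ◂ e → v ◂ f → q ◂ f → e ∉ bs → f ∉ bs → e ≡ f
          same {e = e} {f} u∈ v∈ ue pe vf qf e∉ f∉ with e ≟ᴱ f
          ... | yes eq = eq
          ... | no e≢f = ⊥-elim (insert X u∈ v∈ ue pe vf qf e≢f e∉ f∉)
          one : ∀ {c f} → p ◂ f → q ◂ f → (∀ {t} → t ∈ T₃ → Port bs c t → t ◂ f) → count (Port? bs c) T₃ ≤ 1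
          one {c} {f} pf qf sub = ≤-trans (∑-mono T₃ λ {t} t∈ → 𝟙-mono (Port? bs c t) (t ◂? f) (sub t∈))
                                    (on≤1 u-T₃ (off′ p∈) (off′ q∈) p≢q pf qf)
          reorder : ∀ x y → x + 1 + (y + 1) ≡ 2 + (x + y)
          reorder = solve-∀
          go : ∀ m → count (Port? bs p) T₃ ≡ m → ∀ n → count (Port? bs q) T₃ ≡ n → W p + W q ≤ 2 + (l + k)
          go zero eq n _ = begin
            W p + W q        ≤⟨ +-mono-≤ (≤-trans Wp (≤-reflexive (trans (cong (l +_) eq) (+-identityʳ l)))) (W≤3 q) ⟩
            l + 3            ≤⟨ +-monoʳ-≤ l (s≤s (s≤s (1≤slots X.es₂))) ⟩
            l + (2 + k)      ≡⟨ trans (sym (+-assoc l 2 k)) (trans (cong (_+ k) (+-comm l 2)) (+-assoc 2 l k)) ⟩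
            2 + (l + k)      ∎
          go (suc _) _ zero eq = begin
            W p + W q        ≤⟨ +-mono-≤ (W≤3 p) (≤-trans Wq (≤-reflexive (trans (cong (k +_) eq) (+-identityʳ k)))) ⟩
            3 + k            ≤⟨ +-monoˡ-≤ k (s≤s (s≤s (1≤slots X.es₁))) ⟩
            2 + l + k        ≡⟨ +-assoc 2 l k ⟩
            2 + (l + k)      ∎
          go (suc m) eqp (suc n) eqq
            with count-witness (Port? bs p) T₃ (≤-trans (s≤s z≤n) (≤-reflexive (sym eqp)))
               | count-witness (Port? bs q) T₃ (≤-trans (s≤s z≤n) (≤-reflexive (sym eqq)))
          ... | u , u∈ , _ , e , pe , ue , e∉ | v , v∈ , _ , f , qf , vf , f∉ with same u∈ v∈ ue pe vf qf e∉ f∉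
          ...   | refl = begin
            W p + W q        ≤⟨ +-mono-≤ (≤-trans Wp (+-monoʳ-≤ l (one pe qf λ t∈ (_ , e′ , pe′ , te′ , e′∉) →
                                  subst (_ ◂_) (same t∈ v∈ te′ pe′ vf qf e′∉ f∉) te′)))
                                (≤-trans Wq (+-monoʳ-≤ k (one pe qf λ t∈ (_ , f′ , qf′ , tf′ , f′∉) →
                                  subst (_ ◂_) (sym (same u∈ t∈ ue pe tf′ qf′ e∉ f′∉)) tf′))) ⟩
            l + 1 + (k + 1)  ≡⟨ reorder l k ⟩
            2 + (l + k)      ∎

      -- The outsiders and the path exhaust `U`, which thus has only ℓ + 2 vertices. Its edges can
      -- be counted outright: inside the two parts trivially, and between them by `pair-bound` along
      -- the path.
      no-triad : ∀ {z x y r r′ b ws fs A B γ} (R : Seg r r′ ws fs) → r′ ◂ γ → b ◂ γ → x ◂ γ →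
                 Good (z ∷ x ∷ y ∷ (ws ++ [ b ])) → length (z ∷ x ∷ y ∷ (ws ++ [ b ])) ≡ 2 + ℓ →
                 Unique (A ∷ B ∷ (fs ++ [ γ ])) → z ◂ A → r ◂ A → x ◂ A → z ◂ B → b ◂ B → y ◂ B →
                 ¬ Adj x y → U ↭ (z ∷ x ∷ y ∷ []) ++ (ws ++ [ b ]) → ⊥
      no-triad {z} {x} {y} (pt _) rγ _ xγ gd _ ue _ rA xA _ _ _ _ _ =
        head∉ ue (there (here (linear (disjoint-++ (z ∷ x ∷ y ∷ []) (proj₁ gd) (there (here refl)) (here refl)) xA rA xγ rγ)))
      no-triad {z} {x} {y} {r} {r′} {b} {_} {_} {A} {B} {γ} (step {b = r₂} {e = δ} {vs = ws} {es = fs} rδ r₂δ S)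
               r′γ bγ xγ gd ln ue zA rA xA zB bB yB x≁y full = contradiction
        where
        rs : List V
        rs = r ∷ (ws ++ [ b ])
        tail : Seg r₂ b (ws ++ [ b ]) (fs ++ [ γ ])
        tail = join S r′γ bγ (pt b)
        open Triad (step rδ r₂δ tail) gd ln ue zA rA xA zB bB yB

        f : ℕ
        f = length fs
        SM : ℕ
        SM = ∑ W ws
        S₀ : ℕ
        S₀ = W r + (SM + W b)

        slots-∷ʳ : ∀ {e} es → slots (es ++ [ e ]) ≡ 1
        slots-∷ʳ []      = refl
        slots-∷ʳ (_ ∷ _) = refl

        first-pair : W r + W r₂ ≤ 5
        first-pair = ≤-trans (pair-bound (cut (pt r) rδ r₂δ tail refl refl)) (≤-reflexive (cong (λ n → 2 + (2 + n)) (slots-∷ʳ fs)))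

        last-pair : W r′ + W b ≤ 5
        last-pair = pair-bound (cut (step rδ r₂δ S) r′γ bγ (pt b) refl refl)

        mid-pair : (X : Cut r₂ r′ ws fs) → W (Cut.q X) + W (Cut.p X) ≤ 4
        mid-pair X = ≤-trans (≤-reflexive (+-comm (W X.q) (W X.p))) (≤-trans
          (pair-bound (cut (step rδ r₂δ X.left) X.p◂ X.q◂ (join X.right r′γ bγ (pt b))
            (cong (r ∷_) (trans (cong (_++ [ b ]) X.vs≡) (++-assoc X.vs₁ X.vs₂ [ b ])))
            (cong (δ ∷_) (trans (cong (_++ [ γ ]) X.es≡) (++-assoc X.es₁ (X.g ∷ X.es₂) [ γ ])))))
          (≤-reflexive (cong (λ n → 2 + (1 + n)) (slots-∷ʳ X.es₂))))
          where module X = Cut X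

        twice : S₀ + S₀ ≤ W r + W b + (4 * f + 10)
        twice = begin
          S₀ + S₀                                               ≡⟨ lemma₁ (W r) SM (W b) ⟩
          W r + W b + (W r + W b) + (SM + SM)                   ≤⟨ +-monoʳ-≤ (W r + W b + (W r + W b)) (gap-sum W W 4 S mid-pair) ⟩
          W r + W b + (W r + W b) + (4 * f + (W r₂ + W r′))     ≡⟨ lemma₂ (W r) (W b) (W r₂) (W r′) (4 * f) ⟩
          W r + W b + (4 * f + ((W r + W r₂) + (W r′ + W b)))   ≤⟨ +-monoʳ-≤ (W r + W b) (+-monoʳ-≤ (4 * f) (+-mono-≤ first-pair last-pair)) ⟩
          W r + W b + (4 * f + 10)                              ∎
          where
          open ≤-Reasoning
          lemma₁ : ∀ p s q → p + (s + q) + (p + (s + q)) ≡ p + q + (p + q) + (s + s)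
          lemma₁ = solve-∀
          lemma₂ : ∀ p q p′ q′ n → p + q + (p + q) + (n + (p′ + q′)) ≡ p + q + (n + ((p + p′) + (q′ + q)))
          lemma₂ = solve-∀

        ∑W : D T₃ rs ≡ S₀
        ∑W = trans (D-sym T₃ rs) (cong (W r +_) (trans (∑-++ W ws) (cong (SM +_) (+-identityʳ (W b)))))

        len-rs : length rs ≡ 3 + f
        len-rs = cong suc (trans (length-++ ws) (trans (cong (_+ 1) (length-Seg S)) (+-comm (suc f) 1)))

        f+4≤K : 4 + f ≤ K
        f+4≤K = ≤-trans (≤-reflexive (suc-injective (suc-injective (trans (cong (3 +_) (sym len-rs)) ln)))) ℓ≤K

        T₃-bound : D T₃ T₃ ≤ 4
        T₃-bound rewrite ~-irrefl z | ~-irrefl x | ~-irrefl y | 𝟙-no (Adj? x y) x≁y | 𝟙-no (Adj? y x) (x≁y ∘ Adj-sym) =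
          ≤-trans (+-mono-≤ (+-mono-≤ (𝟙≤1 (Adj? z x)) (+-monoˡ-≤ 0 (𝟙≤1 (Adj? z y))))
                    (+-mono-≤ (+-monoˡ-≤ 0 (𝟙≤1 (Adj? x z))) (+-monoˡ-≤ 0 (+-monoˡ-≤ 0 (𝟙≤1 (Adj? y z)))))) ≤-refl

        -- There are f + 6 vertices, and f + 4 ≤ K. At most 4 pairs inside `T₃`, 4 f + 14 + c across
        -- and (f + 3) (f + 2) - c inside `rs` make f f + 9 f + 24, which is at most (f + 4) (f +
        -- 6). The parameter `c` lets an absent edge in `rs` offset an excess across.
        too-sparse : ∀ c → S₀ + S₀ ≤ 4 * f + 14 + c → D rs rs + length rs + c ≤ length rs * length rs → ⊥
        too-sparse c sum≤ vs≤ = <-irrefl refl (begin-strict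
          K * length U                               <⟨ dense ⟩
          D U U                                      ≡⟨ D-split T₃ rs full ⟩
          D T₃ T₃ + (D T₃ rs + D T₃ rs) + D rs rs    ≡⟨ cong (λ n → D T₃ T₃ + (n + n) + D rs rs) ∑W ⟩
          D T₃ T₃ + (S₀ + S₀) + D rs rs              ≤⟨ bound ⟩
          (4 + f) * (6 + f)                          ≤⟨ *-monoˡ-≤ (6 + f) f+4≤K ⟩
          K * (6 + f)                                ≡⟨ cong (K *_) (sym (trans (↭-length full) (cong (3 +_) len-rs))) ⟩
          K * length U                               ∎)
          where
          open ≤-Reasoning
          lemma₁ : ∀ t s v n c → t + s + v + (n + c) ≡ t + s + (v + n + c)
          lemma₁ = solve-∀
          lemma₂ : ∀ n c → 4 + (4 * n + 14 + c) + (3 + n) * (3 + n) ≡ n * n + 9 * n + 24 + (3 + n + c)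
          lemma₂ = solve-∀
          lemma₃ : ∀ n → (4 + n) * (6 + n) ≡ n * n + 9 * n + 24 + n
          lemma₃ = solve-∀
          bound : D T₃ T₃ + (S₀ + S₀) + D rs rs ≤ (4 + f) * (6 + f)
          bound = ≤-trans (+-cancelʳ-≤ (3 + f + c) _ (f * f + 9 * f + 24) (begin
            D T₃ T₃ + (S₀ + S₀) + D rs rs + (3 + f + c)   ≡⟨ lemma₁ (D T₃ T₃) (S₀ + S₀) (D rs rs) (3 + f) c ⟩
            D T₃ T₃ + (S₀ + S₀) + (D rs rs + (3 + f) + c) ≤⟨ +-mono-≤ (+-mono-≤ T₃-bound sum≤)
                (subst (λ n → D rs rs + n + c ≤ n * n) len-rs vs≤) ⟩
            4 + (4 * f + 14 + c) + (3 + f) * (3 + f)      ≡⟨ lemma₂ f c ⟩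
            f * f + 9 * f + 24 + (3 + f + c)              ∎))
            (≤-trans (m≤m+n _ f) (≤-reflexive (sym (lemma₃ f))))

        -- A doubled number is even, and 4 n + 15 is odd.
        half : ∀ n s → s + s ≤ 4 * n + 15 → s + s ≤ 4 * n + 14
        half n s le with suc (s + s) ≤? 4 * n + 15
        ... | yes lt = ≤-pred (≤-trans lt (≤-reflexive (+-suc (4 * n) 14)))
        ... | no nlt = ⊥-elim (odd (2 * n + 7) s (trans (lemma n) (≤-antisym (≮⇒≥ nlt) le)))
          where
          lemma : ∀ n → suc (2 * n + 7 + (2 * n + 7)) ≡ 4 * n + 15
          lemma = solve-∀
          odd : ∀ x y → suc (x + x) ≢ y + y
          odd zero (suc zero) ()
          odd zero (suc (suc y)) eq with trans eq (cong suc (+-suc (suc y) (suc y)))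
          ... | ()
          odd (suc x) zero ()
          odd (suc x) (suc y) eq = odd x y (suc-injective (suc-injective (trans (cong suc (cong suc (sym (+-suc x x)))) (trans eq (cong suc (+-suc y y))))))

        wsb : ∀ {c} → c ∈ ws → c ∈ rs
        wsb = there ∘ ∈-++⁺ˡ
        b∈ : b ∈ rs
        b∈ = there (∈-++⁺ʳ ws (here refl))
        r∉ : ∀ {c} → c ∈ ws ++ [ b ] → r ≢ c
        r∉ c∈ refl = head∉ uv c∈
        b∉ : ∀ {c} → c ∈ ws → b ≢ c
        b∉ c∈ refl = disjoint-++ ws (uniq ([ r ] ∷ ws ∷ [ b ] ∷ []) (`1 ⊕ `2) (`0 ⊕ `1 ⊕ `2) uv) c∈ (here refl) refl

        -- The third vertex of the first hyperedge of R can only be y; then a chord from r to b closes up a Hamiltonian path.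
        r-b : y ◂ δ → ¬ Adj r b
        r-b yδ (_ , p , rp , bp) with p ∈ᴱ? (A ∷ B ∷ δ ∷ (fs ++ [ γ ]))
        ... | no p∉ = too-long ([ z ] ∷ [ x ] ∷ [ y ] ∷ [ r ] ∷ ws ∷ [ b ] ∷ []) (`0 ⊕ `2 ⊕ `4 ⊕ `1 ⊕ `3 ⊕ `5) (`0 ⊕ `1 ⊕ `2 ⊕ `3 ⊕ `4 ⊕ `5) gd ln
          ([ A ] ∷ [ B ] ∷ [ δ ] ∷ fs ∷ [ γ ] ∷ [ p ] ∷ []) (`1 ⊕ `2 ⊕ `3 ⊕ `4 ⊕ `0 ⊕ `5) (`5 ⊕ `0 ⊕ `1 ⊕ `2 ⊕ `3 ⊕ `4) (uniq-∷ p∉ ue)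
          (step zB yB (step yδ r₂δ (join S r′γ xγ (step xA rA (step rp bp (pt b))))))
        ... | yes (here refl) = size≤3 zA xA rA bp z≢x (off tz (here refl)) (off tz b∈) (off tx (here refl)) (off tx b∈) (r∉ (∈-++⁺ʳ ws (here refl)))
        ... | yes (there (here refl)) = size≤3 zB yB bB rp z≢y (off tz b∈) (off tz (here refl)) (off ty b∈) (off ty (here refl)) (r∉ (∈-++⁺ʳ ws (here refl)) ∘ sym)
        ... | yes (there (there (here refl))) = size≤3 rδ r₂δ yδ bp (r∉ (∈-++⁺ˡ (start∈ S))) (off ty (here refl) ∘ sym) (r∉ (∈-++⁺ʳ ws (here refl)))
                (off ty (wsb (start∈ S)) ∘ sym) (b∉ (start∈ S) ∘ sym) (off ty b∈)
        ... | yes (there (there (there p∈))) with ∈-++⁻ fs p∈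
        ...   | inj₁ p∈fs = no-edge S (uniq ([ r ] ∷ ws ∷ [ b ] ∷ []) `1 (`0 ⊕ `1 ⊕ `2) uv) p∈fs (r∉ (∈-++⁺ʳ ws (here refl)))
                              (λ r∈ → r∉ (∈-++⁺ˡ r∈) refl) (λ b∈ → b∉ b∈ refl) rp bp
        ...   | inj₂ (here refl) = size≤3 r′γ bγ xγ rp (b∉ (end∈ S) ∘ sym) (off tx (wsb (end∈ S)) ∘ sym) (r∉ (∈-++⁺ˡ (end∈ S)) ∘ sym)
                              (off tx b∈ ∘ sym) (r∉ (∈-++⁺ʳ ws (here refl)) ∘ sym) (off tx (here refl))

        -- A free hyperedge would make y, r, ..., b, z, x a path with ℓ + 2 vertices that returns
        -- through `B` and `A`.
        r-y : Adj r y → y ◂ δ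
        r-y (_ , e , re , ye) with e ∈ᴱ? (A ∷ B ∷ δ ∷ (fs ++ [ γ ]))
        ... | no e∉ = ⊥-elim (too-long ([ z ] ∷ [ x ] ∷ [ y ] ∷ rs ∷ []) (`2 ⊕ `3 ⊕ `0 ⊕ `1) (`0 ⊕ `1 ⊕ `2 ⊕ `3) gd ln
          ([ A ] ∷ [ B ] ∷ (δ ∷ (fs ++ [ γ ])) ∷ [ e ] ∷ []) (`3 ⊕ `2 ⊕ `1 ⊕ `0) (`3 ⊕ `0 ⊕ `1 ⊕ `2) (uniq-∷ e∉ ue)
          (step ye re (join (step rδ r₂δ tail) bB zB (step zA xA (pt x)))))
        ... | yes (here refl) = ⊥-elim (size≤3 zA xA rA ye z≢x (off tz (here refl)) z≢y (off tx (here refl)) x≢y (off ty (here refl) ∘ sym))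
        ... | yes (there (here refl)) = ⊥-elim (size≤3 zB yB bB re z≢y (off tz b∈) (off tz (here refl)) (off ty b∈) (off ty (here refl)) (r∉ (∈-++⁺ʳ ws (here refl)) ∘ sym))
        ... | yes (there (there e∈)) with first-edge (step rδ r₂δ tail) uv e∈ re ye (λ y∈ → off ty y∈ refl)
        ...   | _ , _ , _ , _ , _ , _ , refl = ye

        contradiction : ⊥
        contradiction with Adj? r y
        -- Both ends may see all three outsiders, 2 more than the count can bear; the absent edge
        -- between r and b saves exactly 2.
        ... | yes r~y = too-sparse 2
          (≤-trans twice (≤-trans (+-monoˡ-≤ (4 * f + 10) (+-mono-≤ (W≤3 r) (W≤3 b))) (≤-reflexive (lemma f))))
          (D-bound-non-edge (ws ++ [ b ]) (∈-++⁺ʳ ws (here refl)) (𝟙-no (Adj? r b) (r-b (r-y r~y))))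
          where
          lemma : ∀ n → 3 + 3 + (4 * n + 10) ≡ 4 * n + 14 + 2
          lemma = solve-∀
        -- As `r` misses `y`, the excess is 1, and parity removes it.
        ... | no r≁y = too-sparse 0
          (≤-trans (half f S₀ (≤-trans twice (≤-trans (+-monoˡ-≤ (4 * f + 10) (+-mono-≤ Wr≤2 (W≤3 b))) (≤-reflexive (lemma f)))))
            (≤-reflexive (sym (+-identityʳ _))))
          (≤-trans (≤-reflexive (+-identityʳ _)) (D-bound rs))
          where
          lemma : ∀ n → 2 + 3 + (4 * n + 10) ≡ 4 * n + 15
          lemma = solve-∀
          Wr≤2 : W r ≤ 2
          Wr≤2 = ≤-trans (+-mono-≤ (𝟙≤1 (Adj? r z)) (+-mono-≤ (𝟙≤1 (Adj? r x)) (≤-reflexive (cong (_+ 0) (𝟙-no (Adj? r y) r≁y))))) ≤-refl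

      partition : ∀ {P : V → Set} (P? : ∀ v → Dec (P v)) xs → ∃₂ λ ys zs → xs ↭ ys ++ zs × All P ys × All (¬_ ∘ P) zs
      partition P? [] = [] , [] , ↭-refl , [] , []
      partition P? (x ∷ xs) with P? x | partition P? xs
      ... | yes p | ys , zs , eq , ps , ns = x ∷ ys , zs , prep x eq , p ∷ ps , ns
      ... | no ¬p | ys , zs , eq , ps , ns = ys , x ∷ zs , ↭-trans (prep x eq) (↭-sym (shift x ys zs)) , ps , ¬p ∷ ns

      two-elements : ∀ {x y : V} O → length O ≡ 2 → x ∈ O → y ∈ O → x ≢ y → O ↭ x ∷ y ∷ [] × (∀ {z} → z ∈ O → z ≢ y → z ≡ x)
      two-elements (_ ∷ _ ∷ []) refl (here refl) (here refl) x≢y = ⊥-elim (x≢y refl)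
      two-elements (_ ∷ _ ∷ []) refl (here refl) (there (here refl)) x≢y = ↭-refl ,
        λ { (here refl) _ → refl ; (there (here refl)) z≢y → ⊥-elim (z≢y refl) }
      two-elements (_ ∷ _ ∷ []) refl (there (here refl)) (here refl) x≢y = swap _ _ ↭-refl ,
        λ { (here refl) z≢y → ⊥-elim (z≢y refl) ; (there (here refl)) _ → refl }
      two-elements (_ ∷ _ ∷ []) refl (there (here refl)) (there (here refl)) x≢y = ⊥-elim (x≢y refl)

      a≢b : ∀ C → 2 ≤ length (vs C) → a C ≢ b C
      a≢b (cyc (pt _) _ _ _ _) (s≤s ())
      a≢b (cyc (step _ _ S) _ _ (u ∷ _ , _) _) _ refl = All.lookup u (end∈ S) refl

      -- Excluding cycles with ℓ vertices

      module Near (C : Cyc) (ln : length (vs C) ≡ ℓ) (O : List V) (p : U ↭ vs C ++ O) where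

        O-unique : Unique O
        O-unique = uniq (vs C ∷ O ∷ []) `1 (`0 ⊕ `1) (Unique-resp-↭ p U-unique)

        O⊆U : ∀ {x} → x ∈ O → x ∈ U
        O⊆U = ∈-complement p

        out : ∀ Z → C ≈ Z → ∀ {x} → x ∈ O → x ∉ vs Z
        out Z (q , _) x∈ x∈Z = ∉-complement p x∈ (∈-resp-↭ (↭-sym q) x∈Z)

        length-≈ : ∀ Z → C ≈ Z → length (vs Z) ≡ ℓ
        length-≈ Z (q , _) = trans (sym (↭-length q)) ln

        good₁ : ∀ Z → C ≈ Z → ∀ {x} → x ∈ O → Good (x ∷ vs Z)
        good₁ Z eq x∈ = Good-∷ (O⊆U x∈) (out Z eq x∈) (gd Z)

        good₂ : ∀ Z → C ≈ Z → ∀ {x y} → x ∈ O → y ∈ O → x ≢ y → Good (x ∷ y ∷ vs Z)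
        good₂ Z eq x∈ y∈ x≢y = Good-∷ (O⊆U x∈) (λ { (here x≡y) → x≢y x≡y ; (there x∈Z) → out Z eq x∈ x∈Z }) (good₁ Z eq y∈)

        ue-tail : ∀ Z → Unique (es Z)
        ue-tail Z with ue Z
        ... | _ ∷ u = u

        -- With two different hyperedges, y, x and then the whole cycle would form a path with ℓ + 2
        -- vertices.
        through : ∀ {x y c e f} → x ∈ O → y ∈ O → x ≢ y → c ∈ vs C → c ◂ e → x ◂ e → x ◂ f → y ◂ f → f ≡ e
        through {x} {y} {c} {e} {f} x∈ y∈ x≢y c∈ ce xe xf yf with f ≟ᴱ e
        ... | yes f≡e = f≡e
        ... | no f≢e with attach C c∈ ce
        ...   | Z , eq , ae , e∉ = ⊥-elim (too-long (vs Z ∷ [ x ] ∷ [ y ] ∷ []) (`2 ⊕ `1 ⊕ `0) (`1 ⊕ `2 ⊕ `0)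
            (good₂ Z eq x∈ y∈ x≢y) (cong (2 +_) (length-≈ Z eq))
            (es Z ∷ [ e ] ∷ [ f ] ∷ []) (`2 ⊕ `1 ⊕ `0) (`2 ⊕ `1 ⊕ `0)
            (uniq-∷ (λ { (here f≡e) → f≢e f≡e
                       ; (there f∈) → no-edge (seg Z) (proj₁ (gd Z)) f∈ x≢y (out Z eq x∈) (out Z eq y∈) xf yf })
                    (uniq-∷ e∉ (ue-tail Z)))
            (step yf xf (step xe ae (seg Z))))

        -- By `through`, all neighbours of `x` and of `y` would lie on the one hyperedge that joins
        -- them to the cycle, so both degrees would be at most 2.
        touching : ∀ {x y c} → x ∈ O → c ∈ vs C → Adj c x → y ∈ O → ¬ Adj x y
        touching {x} {y} {c} x∈ c∈ (c≢x , e , ce , xe) y∈ x~y@(x≢y , f , xf , yf) with through x∈ y∈ x≢y c∈ ce xe xf yf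
        ... | refl = low-edge (O⊆U x∈) (O⊆U y∈) x~y (deg≤2 xf (inside x∈ y∈ x≢y xf yf)) (deg≤2 yf (inside y∈ x∈ (x≢y ∘ sym) yf xf))
          where
          inside : ∀ {x y w} → x ∈ O → y ∈ O → x ≢ y → x ◂ f → y ◂ f → w ∈ U → Adj x w → w ◂ f
          inside x∈ y∈ x≢y xf yf w∈ (x≢w , g , xg , wg) with ∈-++⁻ (vs C) (∈-resp-↭ p w∈)
          ... | inj₁ w∈C = subst (_ ◂_) (sym (through x∈ y∈ x≢y w∈C wg xg xf yf)) wg
          ... | inj₂ w∈O = subst (_ ◂_) (through x∈ w∈O x≢w c∈ ce xf xg wg) wg

        -- An outsider without a neighbour on the cycle could not be reached at all: the outsiders
        -- that do touch the cycle have no neighbours outside it, so connectedness fails.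
        apart : ∀ {x y} → x ∈ O → y ∈ O → ¬ Adj x y
        apart {x} x∈ y∈ with find (λ c → Adj? c x) (vs C)
        ... | inj₁ (c , c∈ , c~x) = touching x∈ c∈ c~x y∈
        ... | inj₂ none = λ _ → isolated
          where
          touch? : ∀ w → Dec (∃ λ c → c ∈ vs C × Adj c w)
          touch? w with find (λ c → Adj? c w) (vs C)
          ... | inj₁ t = yes t
          ... | inj₂ none = no λ (c , c∈ , c~w) → none c∈ c~w
          isolated : ⊥
          isolated with partition touch? O
          ... | ys , zs , q , ts , ns = linked {vs C ++ ys} (↭-trans p (↭-trans (++⁺ˡ (vs C) q) (↭-reflexive (sym (++-assoc (vs C) ys zs)))))
                  (∈-++⁺ˡ (start∈ (seg C))) x∈zs sep
            where
            x∈zs : x ∈ zs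
            x∈zs with ∈-++⁻ ys (∈-resp-↭ q x∈)
            ... | inj₁ x∈ys = ⊥-elim (none (proj₁ (proj₂ (All.lookup ts x∈ys))) (proj₂ (proj₂ (All.lookup ts x∈ys))))
            ... | inj₂ x∈zs = x∈zs
            sep : ∀ {s z} → s ∈ vs C ++ ys → z ∈ zs → ¬ Adj s z
            sep {s} s∈ z∈ s~z with ∈-++⁻ (vs C) s∈
            ... | inj₁ s∈C = All.lookup ns z∈ (s , s∈C , s~z)
            ... | inj₂ s∈ys with All.lookup ts s∈ys
            ...   | c , c∈ , c~s = touching (∈-resp-↭ (↭-sym q) (∈-++⁺ˡ s∈ys)) c∈ c~s (∈-resp-↭ (↭-sym q) (∈-++⁺ʳ ys z∈)) s~z

        W : V → ℕ
        W c = ∑ (c ~_) O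

        o : ℕ
        o = length O

        ∣U∣ : length U ≡ ℓ + o
        ∣U∣ = trans (↭-length p) (trans (length-++ (vs C)) (cong (_+ o) ln))

        o≥2 : 2 ≤ o
        o≥2 = +-cancelˡ-≤ ℓ _ _ (≤-trans (≤-reflexive (+-comm ℓ 2)) (≤-trans (+-monoʳ-≤ 2 ℓ≤K) (≤-trans K+2≤∣U∣ (≤-reflexive ∣U∣))))

        W≤o : ∀ c → W c ≤ o
        W≤o c = ≤-trans (∑-mono O λ {x} _ → 𝟙≤1 (Adj? c x)) (≤-reflexive (trans (∑-const 1 O) (*-identityˡ o)))

        extend : ∀ Z → C ≈ Z → ∀ {x y e f} → x ∈ O → y ∈ O → x ◂ e → a Z ◂ e → e ∉ es Z → y ◂ f → b Z ◂ f → f ∉ es Z → e ≢ f → ⊥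
        extend Z eq {x} {y} {e} {f} x∈ y∈ xe ae e∉ yf bf f∉ e≢f with x ≟ⱽ y
        ... | yes refl = no-long-cycle
            (cyc (join (seg Z) bf yf (pt x)) ae xe (good (vs Z ∷ [ x ] ∷ []) (`0 ⊕ `1) (`1 ⊕ `0) (good₁ Z eq x∈))
              (uniq (es Z ∷ [ e ] ∷ [ f ] ∷ []) (`1 ⊕ `0 ⊕ `2) (`1 ⊕ `2 ⊕ `0) edges))
            (trans (len (vs Z ∷ [ x ] ∷ []) (`1 ⊕ `0) (`0 ⊕ `1)) (cong suc (length-≈ Z eq)))
          where
          edges : Unique (e ∷ f ∷ es Z)
          edges = uniq-∷ (λ { (here e≡f) → e≢f e≡f ; (there e∈) → e∉ e∈ }) (uniq-∷ f∉ (ue-tail Z))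
        ... | no x≢y = too-long (vs Z ∷ [ x ] ∷ [ y ] ∷ []) (`1 ⊕ `0 ⊕ `2) (`1 ⊕ `2 ⊕ `0)
            (good₂ Z eq x∈ y∈ x≢y) (cong (2 +_) (length-≈ Z eq))
            (es Z ∷ [ e ] ∷ [ f ] ∷ []) (`1 ⊕ `0 ⊕ `2) (`1 ⊕ `2 ⊕ `0)
            (uniq-∷ (λ { (here e≡f) → e≢f e≡f ; (there e∈) → e∉ e∈ }) (uniq-∷ f∉ (ue-tail Z)))
            (step xe ae (join (seg Z) bf yf (pt y)))

        a≢b′ : ∀ Z → C ≈ Z → a Z ≢ b Z
        a≢b′ Z eq = a≢b Z (≤-trans ℓ≥2 (≤-reflexive (sym (length-≈ Z eq))))

        -- Given a free way out at `a`, another one at `b` yields a cycle with ℓ + 1 vertices or a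
        -- path with ℓ + 2. So `b` meets outsiders only through the last hyperedge of the segment,
        -- which has room for one.
        port⇒W≤1 : ∀ Z → C ≈ Z → ∀ {x} → x ∈ O → Port (g Z ∷ es Z) (a Z) x → W (b Z) ≤ 1
        port⇒W≤1 Z eq {x} x∈ (_ , e , ae , xe , e∉) = count≤1 (Adj? (b Z)) O O-unique same
          where
          used : ∀ {y f} → y ∈ O → b Z ◂ f → y ◂ f → f ∈ es Z
          used {y} {f} y∈ bf yf with f ∈ᴱ? es Z
          ... | yes f∈ = f∈
          ... | no f∉ = ⊥-elim (extend Z eq x∈ y∈ xe ae (e∉ ∘ there) yf bf f∉ λ { refl → e∉ (here (linear (a≢b′ Z eq) ae bf (a◂ Z) (b◂ Z))) })
          same : ∀ {y z} → y ∈ O → z ∈ O → Adj (b Z) y → Adj (b Z) z → y ≡ z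
          same {y} {z} y∈ z∈ (b≢y , f , bf , yf) (b≢z , f′ , bf′ , zf′)
            with last-edge (seg Z) (proj₁ (gd Z)) (used y∈ bf yf) bf yf (out Z eq y∈)
               | last-edge (seg Z) (proj₁ (gd Z)) (used z∈ bf′ zf′) bf′ zf′ (out Z eq z∈)
          ... | v , ws , fs , S , vf , vs≡ , es≡ | _ , _ , fs′ , _ , _ , _ , es≡′ with y ≟ⱽ z
          ...   | yes y≡z = y≡z
          ...   | no y≢z with ∷ʳ-injectiveʳ fs fs′ (trans (sym es≡) es≡′)
          ...     | refl = ⊥-elim (size≤3 vf bf yf zf′
              (disjoint-++ ws (subst Unique vs≡ (proj₁ (gd Z))) (end∈ S) (here refl))
              (λ { refl → out Z eq y∈ v∈ }) (λ { refl → out Z eq z∈ v∈ }) b≢y b≢z y≢z)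
            where
            v∈ : v ∈ vs Z
            v∈ = subst (v ∈_) (sym vs≡) (∈-++⁺ˡ (end∈ S))

        -- Only the hyperedges `g`, `g₁` and `γ` at a and b can lead outside, each to one outsider,
        -- and `g` counts for both ends. A sum above 1 + o ≥ 3 forces o = 2 and all three to lead
        -- outside. By linearity `g` takes one outsider and `g₁`, `γ` the other, which is the
        -- situation of `no-triad`.
        three-edges : ∀ Z → C ≈ Z → (∀ {x} → x ∈ O → ¬ Port (g Z ∷ es Z) (a Z) x) → (∀ {x} → x ∈ O → ¬ Port (g Z ∷ es Z) (b Z) x) →
                      W (b Z) + W (a Z) ≤ 1 + o
        three-edges Z@(cyc (pt _) _ _ _ _) eq _ _ = ⊥-elim (a≢b′ Z eq refl)
        three-edges Z@(cyc {a} {b} {g} (step {b = a′} {e = g₁} ag₁ a′g₁ S) ag bg gdZ ueZ) eq noa nob with snoc? S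
        ... | inj₁ refl = ⊥-elim (head∉ ueZ (here (linear (a≢b′ Z eq) ag bg ag₁ a′g₁)))
        ... | inj₂ (snoc {r′} {γ} {ws} {fs} R r′γ bγ refl refl) with W b + W a ≤? 1 + o
        ...   | yes ok = ok
        ...   | no nok = ⊥-elim (finish (count-witness (_◂? g) O g≥1) (count-witness (_◂? γ) O γ≥1) (count-witness (_◂? g₁) O g₁≥1))
          where
          uZ : Unique (a ∷ ws ++ [ b ])
          uZ = proj₁ gdZ
          out′ : ∀ {x} → x ∈ O → x ∉ a ∷ ws ++ [ b ]
          out′ = out Z eq
          a∈ : a ∈ a ∷ ws ++ [ b ]
          a∈ = here refl
          a′∈ : a′ ∈ a ∷ ws ++ [ b ]
          a′∈ = there (∈-++⁺ˡ (start∈ R))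
          b∈ : b ∈ a ∷ ws ++ [ b ]
          b∈ = there (∈-++⁺ʳ ws (here refl))
          r′∈ : r′ ∈ a ∷ ws ++ [ b ]
          r′∈ = there (∈-++⁺ˡ (end∈ R))
          off : ∀ {c} → c ∈ a ∷ ws ++ [ b ] → c ∉ O
          off c∈ c∈O = out′ c∈O c∈
          a≢a′ : a ≢ a′
          a≢a′ refl = head∉ uZ (∈-++⁺ˡ (start∈ R))
          r′≢b : r′ ≢ b
          r′≢b = disjoint-++ (a ∷ ws) uZ (there (end∈ R)) (here refl)
          on-g≤1 : on g O ≤ 1
          on-g≤1 = on≤1 O-unique (off a∈) (off b∈) (a≢b′ Z eq) ag bg
          on-g₁≤1 : on g₁ O ≤ 1
          on-g₁≤1 = on≤1 O-unique (off a∈) (off a′∈) a≢a′ ag₁ a′g₁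
          on-γ≤1 : on γ O ≤ 1
          on-γ≤1 = on≤1 O-unique (off r′∈) (off b∈) r′≢b r′γ bγ
          Wa≤ : W a ≤ on g O + on g₁ O
          Wa≤ = ≤-trans (∑-mono O λ {x} x∈ → 𝟙-mono⊎ (Adj? a x) (x ◂? g) (x ◂? g₁) (via x∈)) (≤-reflexive (∑-+ (λ x → 𝟙 (x ◂? g)) (λ x → 𝟙 (x ◂? g₁)) O))
            where
            via : ∀ {x} → x ∈ O → Adj a x → x ◂ g ⊎ x ◂ g₁
            via x∈ (a≢x , e , ae , xe) with e ∈ᴱ? (g ∷ g₁ ∷ fs ++ [ γ ])
            ... | no e∉ = ⊥-elim (noa x∈ (a≢x , e , ae , xe , e∉))
            ... | yes (here refl) = inj₁ xe
            ... | yes (there e∈) with first-edge (step ag₁ a′g₁ (join R r′γ bγ (pt b))) uZ e∈ ae xe (out′ x∈)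
            ...   | _ , _ , _ , _ , _ , _ , refl = inj₂ xe
          Wb≤ : W b ≤ on g O + on γ O
          Wb≤ = ≤-trans (∑-mono O λ {x} x∈ → 𝟙-mono⊎ (Adj? b x) (x ◂? g) (x ◂? γ) (via x∈)) (≤-reflexive (∑-+ (λ x → 𝟙 (x ◂? g)) (λ x → 𝟙 (x ◂? γ)) O))
            where
            via : ∀ {x} → x ∈ O → Adj b x → x ◂ g ⊎ x ◂ γ
            via x∈ (b≢x , e , be , xe) with e ∈ᴱ? (g ∷ g₁ ∷ fs ++ [ γ ])
            ... | no e∉ = ⊥-elim (nob x∈ (b≢x , e , be , xe , e∉))
            ... | yes (here refl) = inj₁ xe
            ... | yes (there e∈) with last-edge (step ag₁ a′g₁ (join R r′γ bγ (pt b))) uZ e∈ be xe (out′ x∈)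
            ...   | _ , _ , fs′ , _ , _ , _ , es≡ = inj₂ (subst (_ ◂_) (sym (∷ʳ-injectiveʳ (g₁ ∷ fs) fs′ es≡)) xe)
          total : 2 + o ≤ (on g O + on γ O) + (on g O + on g₁ O)
          total = ≤-trans (≰⇒> nok) (+-mono-≤ Wb≤ Wa≤)
          four : ∀ {i j k} → 4 ≤ (i + j) + (i + k) → i ≤ 1 → j ≤ 1 → k ≤ 1 → 1 ≤ i × 1 ≤ j × 1 ≤ k
          four {zero} {j} {k} le i≤ j≤ k≤ with ≤-trans le (+-mono-≤ j≤ k≤)
          ... | s≤s (s≤s ())
          four {suc zero} {zero} {k} le i≤ j≤ k≤ with ≤-trans le (s≤s (s≤s k≤))
          ... | s≤s (s≤s (s≤s ()))
          four {suc zero} {suc zero} {zero} (s≤s (s≤s (s≤s ()))) i≤ j≤ k≤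
          four {suc zero} {suc zero} {suc k} le i≤ j≤ k≤ = s≤s z≤n , s≤s z≤n , s≤s z≤n
          four {suc zero} {suc (suc _)} le i≤ (s≤s ()) k≤
          four {suc (suc _)} le (s≤s ()) j≤ k≤
          all≥1 : 1 ≤ on g O × 1 ≤ on γ O × 1 ≤ on g₁ O
          all≥1 = four (≤-trans (+-monoʳ-≤ 2 o≥2) total) on-g≤1 on-γ≤1 on-g₁≤1
          g≥1 = proj₁ all≥1
          γ≥1 = proj₁ (proj₂ all≥1)
          g₁≥1 = proj₂ (proj₂ all≥1)
          o≡2 : o ≡ 2
          o≡2 = ≤-antisym (+-cancelˡ-≤ 2 _ _ (≤-trans total (+-mono-≤ (+-mono-≤ on-g≤1 on-γ≤1) (+-mono-≤ on-g≤1 on-g₁≤1)))) o≥2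
          finish : (∃ λ y → y ∈ O × y ◂ g) → (∃ λ x → x ∈ O × x ◂ γ) → (∃ λ x → x ∈ O × x ◂ g₁) → ⊥
          finish (y , y∈ , yg) (x′ , x′∈ , x′γ) (x , x∈ , xg₁)
            with two-elements O o≡2 x∈ y∈ (λ { refl → head∉ ueZ (here (linear (λ { refl → off a∈ x∈ }) ag yg ag₁ xg₁)) })
          ... | O↭ , only with only x′∈ (λ { refl → head∉ ueZ (there (∈-++⁺ʳ fs (here (linear (λ { refl → off b∈ x′∈ }) bg yg bγ x′γ)))) })
          -- The cycle vertex `a` acts as the third outsider: removing it leaves the path from `a′`
          -- to `b`, with `g₁` and `g` hanging at its ends.
          ...   | refl = no-triad {z = a} {x} {y} {A = g₁} {g} R r′γ bγ x′γ
                  (Good-↭ (perm ρ (`0 ⊕ `3 ⊕ `4 ⊕ `1 ⊕ `2) (`3 ⊕ `4 ⊕ `0 ⊕ `1 ⊕ `2)) (good₂ Z eq x∈ y∈ (λ { refl → head∉ ueZ (here (linear (λ { refl → off a∈ x∈ }) ag yg ag₁ xg₁)) })))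
                  (cong (2 +_) (length-≈ Z eq))
                  (uniq ([ g₁ ] ∷ [ g ] ∷ (fs ++ [ γ ]) ∷ []) (`0 ⊕ `1 ⊕ `2) (`1 ⊕ `0 ⊕ `2) ueZ)
                  ag₁ a′g₁ xg₁ ag bg yg (apart x∈ y∈)
                  (↭-trans p (↭-trans (++⁺ (proj₁ eq) O↭) (perm ρ (`0 ⊕ `3 ⊕ `4 ⊕ `1 ⊕ `2) ((`0 ⊕ `1 ⊕ `2) ⊕ `3 ⊕ `4))))
            where
            ρ : Vec (List V) 5
            ρ = [ a ] ∷ ws ∷ [ b ] ∷ [ x ] ∷ [ y ] ∷ []

        pair : ∀ Z → C ≈ Z → W (b Z) + W (a Z) ≤ 1 + o
        pair Z eq with find (Port? (g Z ∷ es Z) (a Z)) O | find (Port? (g Z ∷ es Z) (b Z)) O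
        ... | inj₁ (x , x∈ , port) | _ = +-mono-≤ (port⇒W≤1 Z eq x∈ port) (W≤o (a Z))
        ... | inj₂ _ | inj₁ (x , x∈ , b≢x , e , be , xe , e∉) with mirror Z
        ...   | Z′ , eq′ , refl , b≡ , _ = ≤-trans (≤-reflexive (+-comm (W (b Z)) (W (a Z))))
                  (+-mono-≤ (subst (λ v → W v ≤ 1) b≡ (port⇒W≤1 Z′ (≈-trans {C} {Z} {Z′} eq eq′) x∈
                               (b≢x , e , be , xe , λ e∈ → e∉ (∈-resp-↭ (↭-sym (proj₂ eq′)) e∈))))
                            (W≤o (b Z)))
        pair Z eq | inj₂ noa | inj₂ nob = three-edges Z eq noa nob

        absurd : ⊥
        absurd = <-irrefl refl (begin-strict
          K * length U                                                    <⟨ dense ⟩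
          D U U                                                           ≤⟨ +-cancelʳ-≤ ℓ _ _ bound ⟩
          ℓ * (ℓ + o)                                                     ≤⟨ *-monoˡ-≤ (ℓ + o) ℓ≤K ⟩
          K * (ℓ + o)                                                     ≡⟨ cong (K *_) (sym ∣U∣) ⟩
          K * length U                                                    ∎)
          where
          open ≤-Reasoning
          X = vs C
          lemma₁ : ∀ v w l → v + w + 0 + l ≡ v + l + w
          lemma₁ = solve-∀
          lemma₂ : ∀ l o → l * l + (1 + o) * l ≡ l * (l + o) + l
          lemma₂ = solve-∀
          cross : D X O + D X O ≤ (1 + o) * ℓ
          cross = begin
            ∑ W X + ∑ W X                      ≡⟨ cong (∑ W X +_) (sym (trans (cong (∑ W X +_) (∑-zero X (λ _ → refl))) (+-identityʳ _))) ⟩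
            ∑ W X + (∑ W X + ∑ (λ _ → 0) X)    ≤⟨ cyclic-sum W W (λ _ → 0) (1 + o) C (λ Z eq → ≤-trans (≤-reflexive (cong (W (b Z) +_) (+-identityʳ _))) (pair Z eq)) ⟩
            (1 + o) * length X                 ≡⟨ cong ((1 + o) *_) ln ⟩
            (1 + o) * ℓ                        ∎
          -- The diagonal missing from `D X X` pays for the 1 in (1 + o) * ℓ.
          bound : D U U + ℓ ≤ ℓ * (ℓ + o) + ℓ
          bound = begin
            D U U + ℓ                                      ≡⟨ cong (_+ ℓ) (D-split X O p) ⟩
            D X X + (D X O + D X O) + D O O + ℓ            ≡⟨ cong (λ n → D X X + (D X O + D X O) + n + ℓ) (∑-zero O λ {x} x∈ → ∑-zero O λ {y} y∈ → 𝟙-no (Adj? x y) (apart x∈ y∈)) ⟩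
            D X X + (D X O + D X O) + 0 + ℓ                ≡⟨ lemma₁ (D X X) (D X O + D X O) ℓ ⟩
            D X X + ℓ + (D X O + D X O)                    ≤⟨ +-mono-≤ (subst (λ n → D X X + n ≤ n * n) ln (D-bound X)) cross ⟩
            ℓ * ℓ + (1 + o) * ℓ                            ≡⟨ lemma₂ ℓ o ⟩
            ℓ * (ℓ + o) + ℓ                                ∎

      no-near-cycle : (C : Cyc) → length (vs C) ≢ ℓ
      no-near-cycle C ln with complement (vs C) (gd C)
      ... | O , p = Near.absurd C ln O p

      tail-unique : ∀ {A : Set} {x : A} {xs} → Unique (x ∷ xs) → Unique xs
      tail-unique (_ ∷ u) = u

      -- Cycles with ℓ - 1 vertices and a hyperedge through two outsiders

      module Pendant (C : Cyc) (ln : suc (length (vs C)) ≡ ℓ) (two : 2 ≤ length (vs C)) {h : E} (h∉ : h ∉ g C ∷ es C) where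

        Out : V → Set
        Out u = u ∈ U × u ∉ vs C × u ◂ h

        Entry : V → Set
        Entry u = ∃₂ λ c e → c ∈ vs C × c ◂ e × u ◂ e × e ≢ h

        outZ : ∀ Z → C ≈ Z → ∀ {u} → Out u → u ∉ vs Z
        outZ Z (p , _) (_ , u∉ , _) u∈ = u∉ (∈-resp-↭ (↭-sym p) u∈)

        h∉Z : ∀ Z → C ≈ Z → h ∉ g Z ∷ es Z
        h∉Z Z (_ , q) h∈ = h∉ (∈-resp-↭ (↭-sym q) h∈)

        lnZ : ∀ Z → C ≈ Z → suc (length (vs Z)) ≡ ℓ
        lnZ Z (p , _) = trans (cong suc (sym (↭-length p))) ln

        a≢bZ : ∀ Z → C ≈ Z → a Z ≢ b Z
        a≢bZ Z (p , _) = a≢b Z (≤-trans two (≤-reflexive (↭-length p)))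

        apart-edges : ∀ {u v e f} → u ≢ v → Out u → Out v → u ◂ e → v ◂ f → e ≢ h → e ≢ f
        apart-edges u≢v (_ , _ , uh) (_ , _ , vh) ue vf e≢h refl = e≢h (linear u≢v ue vf uh vh)

        -- The detour v, h, u adds two vertices. The whole opened cycle then yields ℓ + 1 of them,
        -- and the cycle with one vertex dropped yields ℓ; both lengths are already excluded.
        bridge : ∀ {c d ws fs u v e f} → Seg c d ws fs → Good ws → Unique fs → h ∉ fs → u ≢ v → Out u → Out v → u ∉ ws → v ∉ ws →
                 u ◂ e → c ◂ e → e ∉ fs → e ≢ h → v ◂ f → d ◂ f → f ∉ fs → f ≢ h →
                 Σ Cyc λ Z → vs Z ≡ ws ++ v ∷ u ∷ [] × _≡_ {A = List E} (g Z ∷ es Z) (e ∷ fs ++ f ∷ h ∷ [])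
        bridge {ws = ws} {fs} {u} {v} {e} {f} S gdw uf h∉fs u≢v ou@(u∈ , _ , uh) ov@(v∈ , _ , vh) u∉ v∉ ue ce e∉ e≢h vf df f∉ f≢h =
          cyc (join S df vf (step vh uh (pt u))) ce ue
            (good (ws ∷ [ u ] ∷ [ v ] ∷ []) (`0 ⊕ `2 ⊕ `1) (`1 ⊕ `2 ⊕ `0)
              (Good-∷ u∈ (λ { (here u≡v) → u≢v u≡v ; (there u∈ws) → u∉ u∈ws }) (Good-∷ v∈ v∉ gdw)))
            (uniq (fs ∷ [ e ] ∷ [ f ] ∷ [ h ] ∷ []) (`1 ⊕ `0 ⊕ `2 ⊕ `3) (`1 ⊕ `2 ⊕ `3 ⊕ `0)
              (uniq-∷ (λ { (here e≡f) → apart-edges u≢v ou ov ue vf e≢h e≡f ; (there (here e≡h)) → e≢h e≡h ; (there (there e∈)) → e∉ e∈ })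
                (uniq-∷ (λ { (here f≡h) → f≢h f≡h ; (there f∈) → f∉ f∈ }) (uniq-∷ h∉fs uf)))) ,
          refl , refl

        length-bridge : ∀ {u v : V} ws → length (ws ++ v ∷ u ∷ []) ≡ 2 + length ws
        length-bridge {u} {v} ws = len ((v ∷ [ u ]) ∷ ws ∷ []) (`0 ⊕ `1) (`1 ⊕ `0)

        no-bridge : ∀ {u v e f} Z → C ≈ Z → u ≢ v → Out u → Out v → u ◂ e → a Z ◂ e → e ∉ es Z → e ≢ h →
                    v ◂ f → b Z ◂ f → f ∉ es Z → f ≢ h → ⊥
        no-bridge Z eq u≢v ou ov ue ae e∉ e≢h vf bf f∉ f≢h
          with bridge (seg Z) (gd Z) (tail-unique (ue′)) (h∉Z Z eq ∘ there) u≢v ou ov (outZ Z eq ou) (outZ Z eq ov) ue ae e∉ e≢h vf bf f∉ f≢h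
          where ue′ = Cyc.ue Z
        ... | Y , refl , _ = no-long-cycle Y (trans (length-bridge (vs Z)) (cong suc (lnZ Z eq)))

        no-short-bridge : ∀ {c d ws fs u v e f} → Seg c d ws fs → Good ws → Unique fs → h ∉ fs → u ≢ v → Out u → Out v → u ∉ ws → v ∉ ws →
                          u ◂ e → c ◂ e → e ∉ fs → e ≢ h → v ◂ f → d ◂ f → f ∉ fs → f ≢ h → 2 + length ws ≡ ℓ → ⊥
        no-short-bridge {ws = ws} S gdw uf h∉fs u≢v ou ov u∉ v∉ ue ce e∉ e≢h vf df f∉ f≢h lw
          with bridge S gdw uf h∉fs u≢v ou ov u∉ v∉ ue ce e∉ e≢h vf df f∉ f≢h
        ... | Y , refl , _ = no-near-cycle Y (trans (length-bridge ws) lw)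

        no-insert : ∀ {u e f} Z → C ≈ Z → Out u → u ◂ e → a Z ◂ e → e ∉ es Z → u ◂ f → b Z ◂ f → f ∉ es Z → e ≢ f → ⊥
        no-insert {u} {e} {f} Z eq ou@(u∈ , _) ue ae e∉ uf bf f∉ e≢f = no-near-cycle
          (cyc (join (seg Z) bf uf (pt u)) ae ue
            (good (vs Z ∷ [ u ] ∷ []) (`0 ⊕ `1) (`1 ⊕ `0) (Good-∷ u∈ (outZ Z eq ou) (gd Z)))
            (uniq (es Z ∷ [ e ] ∷ [ f ] ∷ []) (`1 ⊕ `0 ⊕ `2) (`1 ⊕ `2 ⊕ `0)
              (uniq-∷ (λ { (here e≡f) → e≢f e≡f ; (there e∈) → e∉ e∈ }) (uniq-∷ f∉ (tail-unique (Cyc.ue Z))))))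
          (trans (len (vs Z ∷ [ u ] ∷ []) (`1 ⊕ `0) (`0 ⊕ `1)) (lnZ Z eq))

        -- If both hyperedges are free, a bridge across the opening gives ℓ + 1 vertices. If only
        -- one is used, say `e`, it also contains the vertex after `a`; bridging from there drops
        -- `a` and gives ℓ.
        adjacent : ∀ {u v e f} Z → C ≈ Z → u ≢ v → Out u → Out v → u ◂ e → a Z ◂ e → e ≢ h → v ◂ f → b Z ◂ f → f ≢ h →
                   e ∈ es Z × f ∈ es Z
        adjacent {u} {v} {e} {f} Z eq u≢v ou ov ue ae e≢h vf bf f≢h with e ∈ᴱ? es Z | f ∈ᴱ? es Z
        ... | yes e∈ | yes f∈ = e∈ , f∈
        ... | no e∉ | no f∉ = ⊥-elim (no-bridge Z eq u≢v ou ov ue ae e∉ e≢h vf bf f∉ f≢h)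
        ... | yes e∈ | no f∉ with first-edge (seg Z) (proj₁ (gd Z)) e∈ ae ue (outZ Z eq ou)
        ...   | a′ , ws , fs , a′e , S , vs≡ , es≡ = ⊥-elim (no-short-bridge S
                  (good ([ a Z ] ∷ ws ∷ []) `1 (`0 ⊕ `1) (subst Good vs≡ (gd Z)))
                  (tail-unique u-es) (λ h∈ → h∉Z Z eq (there (subst (h ∈_) (sym es≡) (there h∈)))) u≢v ou ov
                  (λ u∈ → outZ Z eq ou (subst (u ∈_) (sym vs≡) (there u∈))) (λ v∈ → outZ Z eq ov (subst (v ∈_) (sym vs≡) (there v∈)))
                  ue a′e (head∉ u-es) e≢h vf bf (λ f∈ → f∉ (subst (f ∈_) (sym es≡) (there f∈))) f≢h
                  (trans (cong (suc ∘ length) (sym vs≡)) (lnZ Z eq)))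
          where
          u-es : Unique (e ∷ fs)
          u-es = subst Unique es≡ (tail-unique (Cyc.ue Z))
        adjacent {u} {v} {e} {f} Z eq u≢v ou ov ue ae e≢h vf bf f≢h | no e∉ | yes f∈
          with last-edge (seg Z) (proj₁ (gd Z)) f∈ bf vf (outZ Z eq ov)
        ...   | b′ , ws , fs , S , b′f , vs≡ , es≡ = ⊥-elim (no-short-bridge S
                  (good (ws ∷ [ b Z ] ∷ []) `0 (`0 ⊕ `1) (subst Good vs≡ (gd Z)))
                  (Unique-++ˡ fs u-es) (λ h∈ → h∉Z Z eq (there (subst (h ∈_) (sym es≡) (∈-++⁺ˡ h∈)))) u≢v ou ov
                  (λ u∈ → outZ Z eq ou (subst (u ∈_) (sym vs≡) (∈-++⁺ˡ u∈))) (λ v∈ → outZ Z eq ov (subst (v ∈_) (sym vs≡) (∈-++⁺ˡ v∈)))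
                  ue ae (λ e∈ → e∉ (subst (e ∈_) (sym es≡) (∈-++⁺ˡ e∈))) e≢h vf b′f (λ f∈ → disjoint-++ fs u-es f∈ (here refl) refl) f≢h
                  (trans (cong suc (trans (len (ws ∷ [ b Z ] ∷ []) (`0 ⊕ `1) (`1 ⊕ `0)) (cong length (sym vs≡)))) (lnZ Z eq)))
          where
          u-es : Unique (fs ++ [ f ])
          u-es = subst Unique es≡ (tail-unique (Cyc.ue Z))

        ∉[] : ∀ {e : E} → e ∉ [ h ] → e ≢ h
        ∉[] e∉ e≡h = e∉ (here e≡h)

        -- Otherwise w, u, v and then the cycle would form a path with ℓ + 2 vertices, through `e`,
        -- `h` and the entry of `v`.
        leave : ∀ {u v w} → u ≢ v → Out u → Out v → Entry v → w ∈ U → w ∉ vs C → Adj u w → w ◂ h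
        leave {u} {v} {w} u≢v ou@(u∈ , _ , uh) ov@(v∈ , _ , vh) (c , f , c∈ , cf , vf , f≢h) w∈ w∉ (u≢w , e , ue , we) with e ≟ᴱ h
        ... | yes refl = we
        ... | no e≢h with attach C c∈ cf
        ...   | Z , eq , af , f∉ = ⊥-elim (too-long ρ (`1 ⊕ `2 ⊕ `3 ⊕ `0) (`1 ⊕ `2 ⊕ `3 ⊕ `0)
                (Good-∷ w∈ (λ { (here w≡u) → u≢w (sym w≡u)
                              ; (there (here refl)) → e≢h (linear u≢v ue we uh vh)
                              ; (there (there w∈Z)) → w∉Z w∈Z })
                  (Good-∷ u∈ (λ { (here u≡v) → u≢v u≡v ; (there u∈Z) → outZ Z eq ou u∈Z }) (Good-∷ v∈ (outZ Z eq ov) (gd Z))))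
                (cong (2 +_) (lnZ Z eq))
                σ (`1 ⊕ `2 ⊕ `3 ⊕ `0) (`1 ⊕ `2 ⊕ `3 ⊕ `0)
                (uniq-∷ (λ { (here e≡h) → e≢h e≡h
                           ; (there (here e≡f)) → apart-edges u≢v ou ov ue vf e≢h e≡f
                           ; (there (there e∈)) → no-edge (seg Z) (proj₁ (gd Z)) e∈ u≢w (outZ Z eq ou) w∉Z ue we })
                  (uniq-∷ (λ { (here h≡f) → f≢h (sym h≡f) ; (there h∈) → h∉Z Z eq (there h∈) }) (uniq-∷ f∉ (tail-unique (Cyc.ue Z)))))
                (step we ue (step uh vh (step vf af (seg Z)))))
          where
          w∉Z : w ∉ vs Z
          w∉Z w∈Z = w∉ (∈-resp-↭ (↭-sym (proj₁ eq)) w∈Z)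
          ρ : Vec (List V) 4
          ρ = vs Z ∷ [ w ] ∷ [ u ] ∷ [ v ] ∷ []
          σ : Vec (List E) 4
          σ = es Z ∷ [ e ] ∷ [ h ] ∷ [ f ] ∷ []

        N : V → ℕ
        N u = ∑ (λ c → 𝟙 (Port? [ h ] c u)) (vs C)

        deg≤N : ∀ {u v} → u ≢ v → Out u → Out v → Entry v → deg u ≤ N u + mates h u
        deg≤N {u} {v} u≢v ou ov entry with complement (vs C) (gd C)
        ... | O , p = begin
          ∑ (u ~_) U                                        ≡⟨ ∑-↭ (u ~_) p ⟩
          ∑ (u ~_) (vs C ++ O)                              ≡⟨ ∑-++ (u ~_) (vs C) ⟩
          ∑ (u ~_) (vs C) + ∑ (u ~_) O                      ≤⟨ +-mono-≤ inner outer ⟩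
          N u + ∑ mate (vs C) + ∑ mate O                    ≡⟨ +-assoc (N u) _ _ ⟩
          N u + (∑ mate (vs C) + ∑ mate O)                  ≡⟨ cong (N u +_) (sym (trans (∑-↭ mate p) (∑-++ mate (vs C)))) ⟩
          N u + mates h u                                   ∎
          where
          open ≤-Reasoning
          mate? : ∀ w → Dec (w ◂ h × w ≢ u)
          mate? w = (w ◂? h) ×-dec ¬? (w ≟ⱽ u)
          mate : V → ℕ
          mate w = 𝟙 (mate? w)
          inner : ∑ (u ~_) (vs C) ≤ N u + ∑ mate (vs C)
          inner = ≤-trans (∑-mono (vs C) λ {c} c∈ → 𝟙-mono⊎ (Adj? u c) (Port? [ h ] c u) (mate? c) split) (≤-reflexive (∑-+ (λ c → 𝟙 (Port? [ h ] c u)) mate (vs C)))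
            where
            split : ∀ {c} → Adj u c → Port [ h ] c u ⊎ (c ◂ h × c ≢ u)
            split (u≢c , e , ue , ce) with e ≟ᴱ h
            ... | yes refl = inj₂ (ce , u≢c ∘ sym)
            ... | no e≢h = inj₁ (u≢c ∘ sym , e , ce , ue , λ { (here e≡h) → e≢h e≡h })
          outer : ∑ (u ~_) O ≤ ∑ mate O
          outer = ∑-mono O λ {w} w∈ → 𝟙-mono (Adj? u w) (mate? w) λ u~w →
            leave u≢v ou ov entry (∈-complement p w∈) (∉-complement p w∈) u~w , proj₁ u~w ∘ sym

        same-last : ∀ {u v f f′} Z → C ≈ Z → u ≢ v → Out u → Out v → f ∈ es Z → f′ ∈ es Z →
                    u ◂ f → b Z ◂ f → v ◂ f′ → b Z ◂ f′ → ⊥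
        same-last {u} {v} {f} Z eq u≢v ou ov f∈ f′∈ uf bf vf′ bf′
          with last-edge (seg Z) (proj₁ (gd Z)) f∈ bf uf (outZ Z eq ou)
             | last-edge (seg Z) (proj₁ (gd Z)) f′∈ bf′ vf′ (outZ Z eq ov)
        ... | x , ws , fs , S , xf , vs≡ , es≡ | _ , _ , fs′ , _ , _ , _ , es≡′ with ∷ʳ-injectiveʳ fs fs′ (trans (sym es≡) es≡′)
        ...   | refl = size≤3 xf bf uf vf′ (disjoint-++ ws (subst Unique vs≡ (proj₁ (gd Z))) (end∈ S) (here refl))
                         (λ { refl → outZ Z eq ou x∈ }) (λ { refl → outZ Z eq ov x∈ })
                         (λ { refl → outZ Z eq ou (end∈ (seg Z)) }) (λ { refl → outZ Z eq ov (end∈ (seg Z)) }) u≢v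
          where
          x∈ : x ∈ vs Z
          x∈ = subst (x ∈_) (sym vs≡) (∈-++⁺ˡ (end∈ S))

        -- By `adjacent`, the hyperedge from b to v is the last one of the segment. Reopening the
        -- cycle at it puts `u` at b and `v` at the predecessor of b, where `adjacent` again wants
        -- it inside the segment.
        mixed : ∀ {u v} Z → C ≈ Z → u ≢ v → Out u → Out v → Port [ h ] (a Z) u → Port [ h ] (b Z) v → Port [ h ] (b Z) u → ⊥
        mixed {u} {v} Z eq u≢v ou ov (_ , e , ae , ue , e∉) (_ , f , bf , vf , f∉) (_ , f′ , bf′ , uf′ , f′∉)
          with last-edge (seg Z) (proj₁ (gd Z)) (proj₂ (adjacent Z eq u≢v ou ov ue ae (∉[] e∉) vf bf (∉[] f∉))) bf vf (outZ Z eq ov)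
        ... | b′ , ws , fs , S , b′f , vs≡ , es≡ with rotate Z (cut S b′f bf (pt (b Z)) vs≡ es≡)
        ...   | Z′ , eq′ , refl , refl , refl = g∉es Z′ (proj₂ (adjacent Z′ (≈-trans {C} {Z} {Z′} eq eq′) u≢v ou ov uf′ bf′ (∉[] f′∉) vf b′f (∉[] f∉)))

        -- Used with the two vertices x, y off the cycle and, if the third vertex of `h` is off the
        -- cycle too, with all three.
        module Family (F : List V) (uF : Unique F) (outF : ∀ {u} → u ∈ F → Out u) where

          w : V → ℕ
          w c = count (Port? [ h ] c) F

          ∑w : ∑ w (vs C) ≡ ∑ N F
          ∑w = ∑-swap (λ c u → 𝟙 (Port? [ h ] c u)) (vs C) F

          -- If the outsider seen from `a` is one of the two seen from `b`, `mixed` applies. If not,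
          -- `adjacent` makes both ports of `b` use the last hyperedge, which would then have four
          -- vertices.
          rule-i : ∀ Z → C ≈ Z → 1 ≤ w (a Z) → 2 ≤ w (b Z) → ⊥
          rule-i Z eq wa wb with count-witness (Port? [ h ] (a Z)) F wa | count-two (Port? [ h ] (b Z)) F uF wb
          ... | u , u∈ , pu@(_ , e , ae , ue , e∉) | v , v′ , v∈ , v′∈ , v≢v′ , pv@(_ , f , bf , vf , f∉) , pv′@(_ , f′ , bf′ , v′f′ , f′∉)
            with u ≟ⱽ v | u ≟ⱽ v′
          ... | yes refl | _ = mixed Z eq v≢v′ (outF u∈) (outF v′∈) pu pv′ pv
          ... | no u≢v | yes refl = mixed Z eq u≢v (outF u∈) (outF v∈) pu pv pv′
          ... | no u≢v | no u≢v′ = same-last Z eq v≢v′ (outF v∈) (outF v′∈)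
            (proj₂ (adjacent Z eq u≢v (outF u∈) (outF v∈) ue ae (∉[] e∉) vf bf (∉[] f∉)))
            (proj₂ (adjacent Z eq u≢v′ (outF u∈) (outF v′∈) ue ae (∉[] e∉) v′f′ bf′ (∉[] f′∉))) vf bf v′f′ bf′

          rule-i′ : ∀ Z → C ≈ Z → 2 ≤ w (a Z) → 1 ≤ w (b Z) → ⊥
          rule-i′ Z eq wa wb with mirror Z
          ... | Z′ , eq′ , a≡ , b≡ , _ = rule-i Z′ (≈-trans {C} {Z} {Z′} eq eq′) (subst (λ c → 1 ≤ w c) (sym a≡) wb) (subst (λ c → 2 ≤ w c) (sym b≡) wa)

          w≥1 : ∀ {c u e} → u ∈ F → c ◂ e → u ◂ e → e ≢ h → c ≢ u → 1 ≤ w c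
          w≥1 {c} {u} u∈ ce ue e≢h c≢u = ≤-trans (≤-reflexive (sym (𝟙-yes (Port? [ h ] c u) (c≢u , _ , ce , ue , λ { (here e≡h) → e≢h e≡h }))))
            (term≤∑ (𝟙 ∘ Port? [ h ] c) u∈)

          -- Dropping the vertex in between and bridging gives a cycle with ℓ vertices, unless one
          -- of the two hyperedges runs on along the cycle. The vertex it leads to then has a port
          -- as well, and `rule-i` applies.
          rule-ii : ∀ Z → C ≈ Z → 2 ≤ w (b Z) → 2 ≤ w (a (next Z)) → ⊥
          rule-ii Z@(cyc (pt _) _ _ _ _) eq _ _ = a≢bZ Z eq refl
          rule-ii Z@(cyc {b = b} (step {a} {a′} {e = g₁} {vs = ws} {es = fs} ag a′g S) _ _ gdZ ueZ) eq wb wa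
            with count-two (Port? [ h ] b) F uF wb | count-two (Port? [ h ] a′) F uF wa
          ... | v , _ , v∈ , _ , _ , pv , _ | u₁ , u₂ , u₁∈ , u₂∈ , u₁≢u₂ , pu₁ , pu₂ = choose (u₁ ≟ⱽ v)
            where
            gd-S : Good ws
            gd-S = good ([ a ] ∷ ws ∷ []) `1 (`0 ⊕ `1) gdZ
            off : ∀ {u} → u ∈ F → u ∉ ws
            off u∈ u∈ws = outZ Z eq (outF u∈) (there u∈ws)
            finish : ∀ {u v} → u ∈ F → v ∈ F → u ≢ v → Port [ h ] a′ u → Port [ h ] b v → ⊥
            finish {u} {v} u∈ v∈ u≢v (_ , e , a′e , ue , e∉h) (_ , f , bf , vf , f∉h) with e ∈ᴱ? fs | f ∈ᴱ? fs
            ... | no e∉ | no f∉ = no-short-bridge S gd-S (tail-unique (tail-unique ueZ)) (λ h∈ → h∉Z Z eq (there (there h∈))) u≢v (outF u∈) (outF v∈)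
                    (off u∈) (off v∈) ue a′e e∉ (∉[] e∉h) vf bf f∉ (∉[] f∉h) (lnZ Z eq)
            ... | yes e∈ | _ with first-edge S (proj₁ gd-S) e∈ a′e ue (off u∈)
            ...   | a″ , ws′ , _ , a″e , S″ , vs≡ , es≡ with rotate Z (cut (step ag a′g (pt a′)) a′e a″e S″ (cong (a ∷_) vs≡) (cong (g₁ ∷_) es≡))
            ...     | Z′ , eq′ , refl , refl , refl = rule-i Z′ (≈-trans {C} {Z} {Z′} eq eq′)
                        (w≥1 u∈ a″e ue (∉[] e∉h) λ { refl → off u∈ (subst (a″ ∈_) (sym vs≡) (there (start∈ S″))) }) wa
            finish {u} {v} u∈ v∈ u≢v (_ , e , a′e , ue , e∉h) (_ , f , bf , vf , f∉h) | no _ | yes f∈ with last-edge S (proj₁ gd-S) f∈ bf vf (off v∈)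
            ...   | x , ws′ , _ , S′ , xf , vs≡ , es≡ with rotate Z (cut (step ag a′g S′) xf bf (pt b) (cong (a ∷_) vs≡) (cong (g₁ ∷_) es≡))
            ...     | Z′ , eq′ , refl , refl , refl = rule-i′ Z′ (≈-trans {C} {Z} {Z′} eq eq′) wb
                        (w≥1 v∈ xf vf (∉[] f∉h) λ { refl → off v∈ (subst (x ∈_) (sym vs≡) (∈-++⁺ˡ (end∈ S′))) })
            choose : Dec (u₁ ≡ v) → ⊥
            choose (no u₁≢v) = finish u₁∈ v∈ u₁≢v pu₁ pv
            choose (yes refl) = finish u₂∈ v∈ (u₁≢u₂ ∘ sym) pu₂ pv

          Some Many : V → ℕ
          Some c = 𝟙 (1 ≤? w c)
          Many c = 𝟙 (2 ≤? w c)

          -- A vertex with two ports blocks both of its neighbours on the cycle.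
          charge : (extra : V → ℕ) →
                   (∀ Z → C ≈ Z → extra (a Z) ≡ 0 ⊎ extra (a Z) ≡ 1 × w (a Z) < 1 × w (b Z) < 2 × w (a (next Z)) < 2) →
                   ∑ Many (vs C) + (∑ (λ c → Some c + extra c) (vs C) + ∑ Many (vs C)) ≤ length (vs C)
          charge extra hyp = ≤-trans (cyclic-sum Many (λ c → Some c + extra c) Many 1 C each) (≤-reflexive (*-identityˡ _))
            where
            each : ∀ Z → C ≈ Z → Many (b Z) + (Some (a Z) + extra (a Z) + Many (a (next Z))) ≤ 1
            each Z eq with hyp Z eq
            ... | inj₂ (ex≡ , wa , wb , wn) rewrite ex≡ | 𝟙-no (1 ≤? w (a Z)) (<⇒≱ wa) | 𝟙-no (2 ≤? w (b Z)) (<⇒≱ wb) | 𝟙-no (2 ≤? w (a (next Z))) (<⇒≱ wn) = ≤-refl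
            ... | inj₁ ex≡ rewrite ex≡ with 2 ≤? w (b Z) | 1 ≤? w (a Z) | 2 ≤? w (a (next Z))
            ...   | yes wb | yes wa | _ = ⊥-elim (rule-i Z eq wa wb)
            ...   | yes wb | no _ | yes wn = ⊥-elim (rule-ii Z eq wb wn)
            ...   | yes _ | no _ | no _ = ≤-refl
            ...   | no _ | yes wa | yes wn = ⊥-elim (rule-i′ (next Z) (≈-trans {C} {Z} {next Z} eq (next-≈ Z)) wn (subst (λ c → 1 ≤ w c) (sym (b-next Z)) wa))
            ...   | no _ | yes _ | no _ = ≤-refl
            ...   | no _ | no _ | yes _ = ≤-refl
            ...   | no _ | no _ | no _ = z≤n

          w≤Some+2Many : length F ≤ 3 → ∀ c → w c ≤ Many c + (Some c + Many c)
          w≤Some+2Many le c = go (w c) (≤-trans (∑-mono F λ {u} _ → 𝟙≤1 (Port? [ h ] c u)) (≤-trans (≤-reflexive (trans (∑-const 1 F) (*-identityˡ _))) le))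
            where
            go : ∀ n → n ≤ 3 → n ≤ 𝟙 (2 ≤? n) + (𝟙 (1 ≤? n) + 𝟙 (2 ≤? n))
            go 0 _ = z≤n
            go 1 _ = s≤s z≤n
            go 2 _ = s≤s (s≤s z≤n)
            go 3 _ = ≤-refl
            go (suc (suc (suc (suc _)))) (s≤s (s≤s (s≤s ())))

          w≤Some+Many : length F ≤ 2 → ∀ c → w c ≤ Some c + Many c
          w≤Some+Many le c = go (w c) (≤-trans (∑-mono F λ {u} _ → 𝟙≤1 (Port? [ h ] c u)) (≤-trans (≤-reflexive (trans (∑-const 1 F) (*-identityˡ _))) le))
            where
            go : ∀ n → n ≤ 2 → n ≤ 𝟙 (1 ≤? n) + 𝟙 (2 ≤? n)
            go 0 _ = z≤n
            go 1 _ = s≤s z≤n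
            go 2 _ = ≤-refl
            go (suc (suc (suc _))) (s≤s (s≤s ()))

          ∑N≤ : length F ≤ 3 → ∑ N F ≤ length (vs C)
          ∑N≤ le = begin
            ∑ N F                                                               ≡⟨ sym ∑w ⟩
            ∑ w (vs C)                                                          ≤⟨ ∑-mono (vs C) (λ {c} _ → w≤Some+2Many le c) ⟩
            ∑ (λ c → Many c + (Some c + Many c)) (vs C)                         ≡⟨ ∑-+ Many _ (vs C) ⟩
            ∑ Many (vs C) + ∑ (λ c → Some c + Many c) (vs C)                    ≡⟨ cong (∑ Many (vs C) +_) (∑-+ Some Many (vs C)) ⟩
            ∑ Many (vs C) + (∑ Some (vs C) + ∑ Many (vs C))                     ≤⟨ +-monoʳ-≤ (∑ Many (vs C)) (+-monoˡ-≤ _ (∑-mono (vs C) λ {c} _ → m≤m+n (Some c) 0)) ⟩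
            ∑ Many (vs C) + (∑ (λ c → Some c + 0) (vs C) + ∑ Many (vs C))       ≤⟨ charge (λ _ → 0) (λ _ _ → inj₁ refl) ⟩
            length (vs C)                                                       ∎
            where open ≤-Reasoning

          w-on-h : ∀ {c} → c ◂ h → w c ≡ 0
          w-on-h {c} ch = ∑-zero F λ {u} u∈ → 𝟙-no (Port? [ h ] c u) λ (c≢u , e , ce , ue , e∉) →
            ∉[] e∉ (linear c≢u ce ue ch (proj₂ (proj₂ (outF u∈))))

          -- `h` leads from `z` to every member of the family, so a free hyperedge at `b` would
          -- allow inserting its outsider, for ℓ vertices in all. Two ports of `b` would thus share
          -- the last hyperedge.
          z-rule : ∀ {z} Z → C ≈ Z → z ◂ h → z ≡ a Z → w (b Z) < 2
          z-rule Z eq zh refl = ≰⇒> λ wb → case count-two (Port? [ h ] (b Z)) F uF wb of λ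
            { (v , v′ , v∈ , v′∈ , v≢v′ , (_ , f , bf , vf , f∉) , (_ , f′ , bf′ , v′f′ , f′∉)) →
              same-last Z eq v≢v′ (outF v∈) (outF v′∈) (used v∈ bf vf (∉[] f∉)) (used v′∈ bf′ v′f′ (∉[] f′∉)) vf bf v′f′ bf′ }
            where
            used : ∀ {v f} → v ∈ F → b Z ◂ f → v ◂ f → f ≢ h → f ∈ es Z
            used {v} {f} v∈ bf vf f≢h with f ∈ᴱ? es Z
            ... | yes f∈ = f∈
            ... | no f∉ = ⊥-elim (no-insert Z eq (outF v∈) (proj₂ (proj₂ (outF v∈))) zh (h∉Z Z eq ∘ there) vf bf f∉ (f≢h ∘ sym))

          -- By linearity a vertex on `h` has no port, and neither of its neighbours on the cycle
          -- has two. So `z` leaves its unit of the charge unspent, and the indicator claims it.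
          ∑N<  : ∀ {z} → z ∈ vs C → z ◂ h → ∑ Many (vs C) + (∑ (λ c → Some c + 𝟙 (c ≟ⱽ z)) (vs C) + ∑ Many (vs C)) ≤ length (vs C)
          ∑N< {z} z∈ zh = charge (λ c → 𝟙 (c ≟ⱽ z)) hyp
            where
            hyp : ∀ Z → C ≈ Z → 𝟙 (a Z ≟ⱽ z) ≡ 0 ⊎ 𝟙 (a Z ≟ⱽ z) ≡ 1 × w (a Z) < 1 × w (b Z) < 2 × w (a (next Z)) < 2
            hyp Z eq with a Z ≟ⱽ z
            ... | no _ = inj₁ refl
            ... | yes refl = inj₂ (refl , wz , z-rule Z eq zh refl , wn)
              where
              wz : w (a Z) < 1
              wz = s≤s (≤-reflexive (w-on-h zh))
              wn : w (a (next Z)) < 2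
              wn with mirror (next Z)
              ... | Z′ , eq′ , a≡ , b≡ , _ = subst (λ c → w c < 2) b≡
                      (z-rule Z′ (≈-trans {C} {Z} {Z′} eq (≈-trans {Z} {next Z} {Z′} (next-≈ Z) eq′)) zh (sym (trans a≡ (b-next Z))))

      -- Two vertices would be joined by two different hyperedges.
      3≤cycle : ∀ C → 2 ≤ length (vs C) → 3 ≤ length (vs C)
      3≤cycle (cyc (pt _) _ _ _ _) (s≤s ())
      3≤cycle C@(cyc (step ag a′g (pt _)) ag′ bg′ _ ueC) two = ⊥-elim (head∉ ueC (here (linear (a≢b C two) ag′ bg′ ag a′g)))
      3≤cycle (cyc (step _ _ (step _ _ S)) _ _ _ _) _ = s≤s (s≤s (∈-length (start∈ S)))

      module _ (C : Cyc) (ln : suc (length (vs C)) ≡ ℓ) (two : 2 ≤ length (vs C)) {h : E} (h∉ : h ∉ g C ∷ es C) where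
        open Pendant C ln two h∉

        private
          m : ℕ
          m = length (vs C)

          m<K : m < K
          m<K = ≤-trans (≤-reflexive ln) ℓ≤K

        -- With m vertices on the cycle, a family has at most m ports, or m - 1 if `h` meets the
        -- cycle, and `h` adds at most 2 to each degree. Without a third vertex in `U` the sum
        -- violates the bound for an edge; with one off the cycle it violates that for a triangle,
        -- where m ≥ 3 is used.
        pair-degree : ∀ {x y} → x ≢ y → Out x → Out y → Entry x → Entry y →
                      ∃ λ z → z ∈ vs C × z ◂ h × deg x + deg y ≤ 2 + K
        pair-degree {x} {y} x≢y ox@(x∈ , x∉ , xh) oy@(y∈ , y∉ , yh) ex ey
          with find (λ w → (w ◂? h) ×-dec (¬? (w ≟ⱽ x) ×-dec ¬? (w ≟ⱽ y))) U
        ... | inj₂ none = ⊥-elim (<-irrefl refl (begin-strict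
          m                                                <⟨ m<K ⟩
          K                                                ≤⟨ +-cancelˡ-≤ 2 _ _ (begin
            2 + K                                            ≤⟨ deg-edge x∈ y∈ (x≢y , h , xh , yh) ⟩
            deg x + deg y                                    ≤⟨ +-mono-≤ (deg≤N x≢y ox oy ey) (deg≤N (x≢y ∘ sym) oy ox ex) ⟩
            N x + mates h x + (N y + mates h y)              ≤⟨ +-mono-≤ (+-monoʳ-≤ (N x) (one x y λ w∈ wh w≢x → only w∈ wh w≢x)) (+-monoʳ-≤ (N y) (one y x λ w∈ wh w≢y → only′ w∈ wh w≢y)) ⟩
            N x + 1 + (N y + 1)                              ≡⟨ lemma (N x) (N y) ⟩
            2 + ∑ N (x ∷ [ y ])                              ≤⟨ +-monoʳ-≤ 2 (Family.∑N≤ (x ∷ [ y ]) (uniq-∷ (λ { (here x≡y) → x≢y x≡y }) ([] ∷ [])) (λ { (here refl) → ox ; (there (here refl)) → oy }) (s≤s (s≤s z≤n))) ⟩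
            2 + m                                            ∎) ⟩
          m                                                ∎))
          where
          open ≤-Reasoning
          lemma : ∀ p q → p + 1 + (q + 1) ≡ 2 + (p + (q + 0))
          lemma = solve-∀
          only : ∀ {w} → w ∈ U → w ◂ h → w ≢ x → w ≡ y
          only {w} w∈ wh w≢x with w ≟ⱽ y
          ... | yes w≡y = w≡y
          ... | no w≢y = ⊥-elim (none w∈ (wh , w≢x , w≢y))
          only′ : ∀ {w} → w ∈ U → w ◂ h → w ≢ y → w ≡ x
          only′ {w} w∈ wh w≢y with w ≟ⱽ x
          ... | yes w≡x = w≡x
          ... | no w≢x = ⊥-elim (none w∈ (wh , w≢x , w≢y))
          one : ∀ u v → (∀ {w} → w ∈ U → w ◂ h → w ≢ u → w ≡ v) → mates h u ≤ 1
          one u v single = count≤1 (λ w → (w ◂? h) ×-dec ¬? (w ≟ⱽ u)) U U-unique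
            λ w∈ w′∈ (wh , w≢u) (w′h , w′≢u) → trans (single w∈ wh w≢u) (sym (single w′∈ w′h w′≢u))
        ... | inj₁ (z , z∈ , zh , z≢x , z≢y) with z ∈ⱽ? vs C
        ...   | yes z∈C = z , z∈C , zh , (begin
          deg x + deg y                                    ≤⟨ +-mono-≤ (deg≤N x≢y ox oy ey) (deg≤N (x≢y ∘ sym) oy ox ex) ⟩
          N x + mates h x + (N y + mates h y)              ≤⟨ +-mono-≤ (+-monoʳ-≤ (N x) (mates≤2 xh)) (+-monoʳ-≤ (N y) (mates≤2 yh)) ⟩
          N x + 2 + (N y + 2)                              ≡⟨ lemma (N x) (N y) ⟩
          3 + (∑ N (x ∷ [ y ]) + 1)                        ≤⟨ +-monoʳ-≤ 3 below ⟩
          3 + m                                            ≤⟨ +-monoʳ-≤ 2 m<K ⟩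
          2 + K                                            ∎)
          where
          open ≤-Reasoning
          xy-unique : Unique (x ∷ [ y ])
          xy-unique = (x≢y ∷ []) ∷ [] ∷ []
          xy-out : ∀ {u} → u ∈ x ∷ [ y ] → Out u
          xy-out (here refl)         = ox
          xy-out (there (here refl)) = oy
          open Family (x ∷ [ y ]) xy-unique xy-out
          lemma : ∀ p q → p + 2 + (q + 2) ≡ 3 + (p + (q + 0) + 1)
          lemma = solve-∀
          lemma₂ : ∀ s z n → s + n + z ≤ n + (s + z + n)
          lemma₂ s z n = ≤-trans (m≤n+m _ n) (≤-reflexive (lemma₃ s z n))
            where
            lemma₃ : ∀ s z n → n + (s + n + z) ≡ n + (s + z + n)
            lemma₃ = solve-∀
          below : ∑ N (x ∷ [ y ]) + 1 ≤ m
          below = begin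
            ∑ N (x ∷ [ y ]) + 1                                       ≡⟨ cong (_+ 1) (sym ∑w) ⟩
            ∑ w (vs C) + 1                                            ≤⟨ +-mono-≤ (≤-trans (∑-mono (vs C) λ {c} _ → w≤Some+Many ≤-refl c) (≤-reflexive (∑-+ Some Many (vs C))))
                                                                           (≤-trans (≤-reflexive (sym (𝟙-yes (z ≟ⱽ z) refl))) (term≤∑ (λ c → 𝟙 (c ≟ⱽ z)) z∈C)) ⟩
            ∑ Some (vs C) + ∑ Many (vs C) + ∑ (λ c → 𝟙 (c ≟ⱽ z)) (vs C) ≤⟨ lemma₂ (∑ Some (vs C)) _ (∑ Many (vs C)) ⟩
            ∑ Many (vs C) + (∑ Some (vs C) + ∑ (λ c → 𝟙 (c ≟ⱽ z)) (vs C) + ∑ Many (vs C))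
                                                                      ≡⟨ cong (λ n → ∑ Many (vs C) + (n + ∑ Many (vs C))) (sym (∑-+ Some (λ c → 𝟙 (c ≟ⱽ z)) (vs C))) ⟩
            ∑ Many (vs C) + (∑ (λ c → Some c + 𝟙 (c ≟ⱽ z)) (vs C) + ∑ Many (vs C)) ≤⟨ ∑N< z∈C zh ⟩
            m                                                         ∎
        ...   | no z∉C = ⊥-elim (<-irrefl refl (begin-strict
          3 * K + 6                                        <⟨ deg-triangle x∈ y∈ z∈ (x≢y , h , xh , yh) (z≢x ∘ sym , h , xh , zh) (z≢y ∘ sym , h , yh , zh) ⟩
          2 * (deg x + deg y + deg z)                      ≤⟨ *-monoʳ-≤ 2 (+-mono-≤ (+-mono-≤ (deg≤N x≢y ox oy ey) (deg≤N (x≢y ∘ sym) oy ox ex)) (deg≤N z≢x oz ox ex)) ⟩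
          2 * (N x + mates h x + (N y + mates h y) + (N z + mates h z)) ≤⟨ *-monoʳ-≤ 2 (+-mono-≤ (+-mono-≤ (+-monoʳ-≤ (N x) (mates≤2 xh)) (+-monoʳ-≤ (N y) (mates≤2 yh))) (+-monoʳ-≤ (N z) (mates≤2 zh))) ⟩
          2 * (N x + 2 + (N y + 2) + (N z + 2))            ≡⟨ lemma (N x) (N y) (N z) ⟩
          2 * ∑ N F + 12                                   ≤⟨ +-monoˡ-≤ 12 (*-monoʳ-≤ 2 ∑N₃) ⟩
          2 * m + 12                                       ≡⟨ lemma₂ m ⟩
          3 + (2 * m) + 9                                  ≤⟨ +-monoˡ-≤ 9 (+-monoˡ-≤ (2 * m) (3≤cycle C two)) ⟩
          3 * m + 9                                        ≡⟨ lemma₃ m ⟩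
          3 * suc m + 6                                    ≤⟨ +-monoˡ-≤ 6 (*-monoʳ-≤ 3 m<K) ⟩
          3 * K + 6                                        ∎))
          where
          open ≤-Reasoning
          oz : Out z
          oz = z∈ , z∉C , zh
          F : List V
          F = x ∷ y ∷ [ z ]
          ∑N₃ : ∑ N F ≤ m
          ∑N₃ = Family.∑N≤ F (((x≢y) ∷ (z≢x ∘ sym) ∷ []) ∷ ((z≢y ∘ sym) ∷ []) ∷ [] ∷ [])
                  (λ { (here refl) → ox ; (there (here refl)) → oy ; (there (there (here refl))) → oz }) ≤-refl
          lemma : ∀ p q r → 2 * (p + 2 + (q + 2) + (r + 2)) ≡ 2 * (p + (q + (r + 0))) + 12
          lemma = solve-∀
          lemma₂ : ∀ n → 2 * n + 12 ≡ 3 + (2 * n) + 9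
          lemma₂ = solve-∀
          lemma₃ : ∀ n → 3 * n + 9 ≡ 3 * suc n + 6
          lemma₃ = solve-∀

      module _ (C : Cyc) (ln : suc (length (vs C)) ≡ ℓ) (two : 2 ≤ length (vs C)) {h : E} (h∉ : h ∉ g C ∷ es C) where
        open Pendant C ln two h∉

        -- Exchanging u, v for their neighbours a, b on the cycle gives a 4-cycle u a b v of vertices of small degree.
        separated : ∀ {u v e f} Z → C ≈ Z → u ≢ v → Out u → Out v → Entry u → Entry v →
                    u ◂ e → a Z ◂ e → e ≢ h → v ◂ f → b Z ◂ f → f ≢ h → ⊥
        separated {u} {v} {e} {f} Z eq u≢v ou@(u∈ , _ , uh) ov@(v∈ , _ , vh) eu ev ue ae e≢h vf bf f≢h
          with adjacent Z eq u≢v ou ov ue ae e≢h vf bf f≢h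
        ... | e∈ , f∈ with first-edge (seg Z) (proj₁ (gd Z)) e∈ ae ue (outZ Z eq ou)
        ...   | a′ , ws′ , fs′ , a′e , S′ , vs≡ , es≡ with last-edge S′ (tail-unique (subst Unique vs≡ (proj₁ (gd Z)))) f∈fs′ bf vf v∉ws′
          where
          f∈fs′ : f ∈ fs′
          f∈fs′ with subst (f ∈_) es≡ f∈
          ... | here f≡e = ⊥-elim (apart-edges u≢v ou ov ue vf e≢h (sym f≡e))
          ... | there f∈ = f∈
          v∉ws′ : v ∉ ws′
          v∉ws′ v∈ = outZ Z eq ov (subst (v ∈_) (sym vs≡) (there v∈))
        ...     | b′ , ws , fs , S , b′f , refl , refl with bridge S
                    (good ([ a Z ] ∷ ws ∷ [ b Z ] ∷ []) `1 (`0 ⊕ `1 ⊕ `2) gdZ) (uniq ([ g Z ] ∷ [ e ] ∷ fs ∷ [ f ] ∷ []) `2 (`0 ⊕ `1 ⊕ `2 ⊕ `3) ueZ)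
                    (λ h∈ → h∉Z Z eq (there (subst (h ∈_) (sym es≡) (there (∈-++⁺ˡ h∈))))) u≢v ou ov
                    (λ u∈ws → outZ Z eq ou (subst (u ∈_) (sym vs≡) (there (∈-++⁺ˡ u∈ws))))
                    (λ v∈ws → outZ Z eq ov (subst (v ∈_) (sym vs≡) (there (∈-++⁺ˡ v∈ws))))
                    ue a′e (λ e∈fs → disjoint-++ [ e ] (tail-unique ueZ) (here refl) (∈-++⁺ˡ e∈fs) refl) e≢h
                    vf b′f (λ f∈fs → disjoint-++ fs (tail-unique (tail-unique ueZ)) f∈fs (here refl) refl) f≢h
          where
          gdZ : Good (a Z ∷ ws ++ [ b Z ])
          gdZ = subst Good vs≡ (gd Z)
          ueZ : Unique (g Z ∷ e ∷ fs ++ [ f ])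
          ueZ = subst (λ es → Unique (g Z ∷ es)) es≡ (Cyc.ue Z)
        ...       | Y , vsY , esY = <-irrefl refl (begin-strict
          2 * K + 4                                   <⟨ deg-4-cycle u∈ (∈U (gd Z) (start∈ (seg Z))) (∈U (gd Z) (end∈ (seg Z))) v∈
                                                           u≢bZ a≢v
                                                           ((λ { refl → outZ Z eq ou (start∈ (seg Z)) }) , e , ue , ae)
                                                           (a≢bZ Z eq , g Z , a◂ Z , b◂ Z)
                                                           ((λ { refl → outZ Z eq ov (end∈ (seg Z)) }) , f , bf , vf)
                                                           (u≢v ∘ sym , h , vh , uh) ⟩
          deg u + deg (a Z) + (deg (b Z) + deg v)     ≡⟨ lemma (deg u) (deg (a Z)) (deg (b Z)) (deg v) ⟩
          (deg u + deg v) + (deg (a Z) + deg (b Z))   ≤⟨ +-mono-≤ (proj₂ (proj₂ (proj₂ (pair-degree C ln two h∉ u≢v ou ov eu ev))))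
                                                           -- For the new cycle `Y` the roles are
                                                           -- exchanged: the old opening hyperedge
                                                           -- `g Z` joins the two vertices off the
                                                           -- cycle, and `e`, `f` are their entries.
                                                           (proj₂ (proj₂ (proj₂ (pair-degree Y lnY twoY gZ∉Y (a≢bZ Z eq)
                                                             (∈U (gd Z) (start∈ (seg Z)) , a∉Y , a◂ Z) (∈U (gd Z) (end∈ (seg Z)) , b∉Y , b◂ Z)
                                                             (u , e , u∈Y , ue , ae , λ { refl → g∉es Z e∈ })
                                                             (v , f , v∈Y , vf , bf , λ { refl → g∉es Z f∈ }))))) ⟩
          (2 + K) + (2 + K)                           ≡⟨ lemma₂ K ⟩
          2 * K + 4                                   ∎)
          where
          open ≤-Reasoning
          lemma : ∀ p q r s → p + q + (r + s) ≡ (p + s) + (q + r)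
          lemma = solve-∀
          lemma₂ : ∀ n → (2 + n) + (2 + n) ≡ 2 * n + 4
          lemma₂ = solve-∀
          u≢bZ : u ≢ b Z
          u≢bZ refl = outZ Z eq ou (end∈ (seg Z))
          a≢v : a Z ≢ v
          a≢v refl = outZ Z eq ov (start∈ (seg Z))
          uZ : Unique (a Z ∷ ws ++ [ b Z ])
          uZ = subst Unique vs≡ (proj₁ (gd Z))
          lengths : length (vs Z) ≡ length (vs Y)
          lengths = trans (cong length vs≡) (trans (cong suc (len (ws ∷ [ b Z ] ∷ []) (`1 ⊕ `0) (`0 ⊕ `1))) (trans (sym (length-bridge ws)) (cong length (sym vsY))))
          lnY : suc (length (vs Y)) ≡ ℓ
          lnY = trans (cong suc (sym lengths)) (lnZ Z eq)
          twoY : 2 ≤ length (vs Y)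
          twoY = ≤-trans two (≤-reflexive (trans (↭-length (proj₁ eq)) lengths))
          gZ∉Y : g Z ∉ g Y ∷ es Y
          gZ∉Y g∈ with subst (g Z ∈_) esY g∈
          ... | here refl = g∉es Z e∈
          ... | there g∈′ with ∈-++⁻ fs g∈′
          ...   | inj₁ g∈fs = g∉es Z (subst (g Z ∈_) (sym es≡) (there (∈-++⁺ˡ g∈fs)))
          ...   | inj₂ (here refl) = g∉es Z f∈
          ...   | inj₂ (there (here refl)) = h∉Z Z eq (here refl)
          a∉Y : a Z ∉ vs Y
          a∉Y a∈ with ∈-++⁻ ws (subst (a Z ∈_) vsY a∈)
          ... | inj₁ a∈ws = head∉ uZ (∈-++⁺ˡ a∈ws)
          ... | inj₂ (here a≡v) = a≢v a≡v
          ... | inj₂ (there (here refl)) = outZ Z eq ou (start∈ (seg Z))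
          b∉Y : b Z ∉ vs Y
          b∉Y b∈ with ∈-++⁻ ws (subst (b Z ∈_) vsY b∈)
          ... | inj₁ b∈ws = disjoint-++ (a Z ∷ ws) uZ (there b∈ws) (here refl) refl
          ... | inj₂ (here refl) = outZ Z eq ov (end∈ (seg Z))
          ... | inj₂ (there (here b≡u)) = u≢bZ (sym b≡u)
          u∈Y : u ∈ vs Y
          u∈Y = subst (u ∈_) (sym vsY) (∈-++⁺ʳ ws (there (here refl)))
          v∈Y : v ∈ vs Y
          v∈Y = subst (v ∈_) (sym vsY) (∈-++⁺ʳ ws (here refl))

        -- The lower bound K + 2 for an edge meets the upper bound of `pair-degree`, so the charging
        -- is tight: every cycle vertex except `z` has exactly one port. By `separated`,
        -- neighbouring ports belong to the same outsider, hence all of them do. The other outsider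
        -- then has degree at most 2, too little for `deg-min`.
        no-pendant : ∀ {x y} → x ≢ y → Out x → Out y → Entry x → Entry y → ⊥
        no-pendant {x} {y} x≢y ox@(x∈ , _ , xh) oy@(y∈ , _ , yh) ex ey with pair-degree C ln two h∉ x≢y ox oy ex ey
        ... | z , z∈ , zh , _ with toHead
          where
          toHead : Σ Cyc λ Z → C ≈ Z × a Z ≡ z
          toHead with cutV (seg C) z∈
          ... | inj₁ refl = C , ≈-refl {C} , refl
          ... | inj₂ (X , refl) with rotate C X
          ...   | Z , eq , a≡ , _ = Z , eq , a≡
        ...   | cyc (pt _) _ _ _ _ , (p , _) , _ = ⊥-elim (<-irrefl refl (≤-trans two (≤-reflexive (↭-length p))))
        ...   | cyc (step _ _ (pt _)) _ _ _ _ , (p , _) , _ = ⊥-elim (<-irrefl refl (≤-trans (3≤cycle C two) (≤-reflexive (↭-length p))))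
        ...   | Z@(cyc {b = b} (step {b = c₁} {vs = ws} {es = fs} zg c₁g S@(step s₁ s₂ S′)) az bz gdZ ueZ) , eq , refl =
          conclude (count-witness (Port? [ h ] c₁) F (some (here refl)))
          where
          F : List V
          F = x ∷ [ y ]
          F-unique : Unique F
          F-unique = (x≢y ∷ []) ∷ [] ∷ []
          F-out : ∀ {u} → u ∈ F → Out u
          F-out (here refl)         = ox
          F-out (there (here refl)) = oy
          open Family F F-unique F-out
          open ≤-Reasoning
          m = length (vs C)
          M₁ = ∑ Many (vs C)
          S₁ = ∑ (λ c → Some c + 𝟙 (c ≟ⱽ z)) (vs C)
          m<K : m < K
          m<K = ≤-trans (≤-reflexive ln) ℓ≤K
          lemma : ∀ p q → p + 2 + (q + 2) ≡ 4 + (p + (q + 0))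
          lemma = solve-∀
          lower : m ≤ 1 + ∑ w (vs C)
          lower = +-cancelˡ-≤ 3 _ _ (begin
            3 + m                                 ≤⟨ +-monoʳ-≤ 2 m<K ⟩
            2 + K                                 ≤⟨ deg-edge x∈ y∈ (x≢y , h , xh , yh) ⟩
            deg x + deg y                         ≤⟨ +-mono-≤ (deg≤N x≢y ox oy ey) (deg≤N (x≢y ∘ sym) oy ox ex) ⟩
            N x + mates h x + (N y + mates h y)   ≤⟨ +-mono-≤ (+-monoʳ-≤ (N x) (mates≤2 xh)) (+-monoʳ-≤ (N y) (mates≤2 yh)) ⟩
            N x + 2 + (N y + 2)                   ≡⟨ lemma (N x) (N y) ⟩
            4 + ∑ N F                             ≡⟨ cong (4 +_) (sym ∑w) ⟩
            4 + ∑ w (vs C)                        ∎)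
          upper : 1 + ∑ w (vs C) ≤ S₁ + M₁
          upper = begin
            1 + ∑ w (vs C)                                                   ≤⟨ +-mono-≤ (≤-trans (≤-reflexive (sym (𝟙-yes (z ≟ⱽ z) refl))) (term≤∑ (λ c → 𝟙 (c ≟ⱽ z)) z∈))
                                                                                  (≤-trans (∑-mono (vs C) λ {c} _ → w≤Some+Many ≤-refl c) (≤-reflexive (∑-+ Some Many (vs C)))) ⟩
            ∑ (λ c → 𝟙 (c ≟ⱽ z)) (vs C) + (∑ Some (vs C) + M₁)               ≡⟨ sym (+-assoc (∑ (λ c → 𝟙 (c ≟ⱽ z)) (vs C)) _ _) ⟩
            ∑ (λ c → 𝟙 (c ≟ⱽ z)) (vs C) + ∑ Some (vs C) + M₁                 ≡⟨ cong (_+ M₁) (trans (+-comm (∑ (λ c → 𝟙 (c ≟ⱽ z)) (vs C)) _) (sym (∑-+ Some (λ c → 𝟙 (c ≟ⱽ z)) (vs C)))) ⟩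
            S₁ + M₁                                                          ∎
          -- `∑N<` charges `M₁` twice, while `lower` and `upper` account for it only once.
          M₁≡0 : M₁ ≡ 0
          M₁≡0 = n≤0⇒n≡0 (+-cancelʳ-≤ (S₁ + M₁) M₁ 0 (≤-trans (∑N< z∈ zh) (≤-trans lower upper)))
          full : m ≤ S₁
          full = ≤-trans lower (≤-trans upper (≤-reflexive (trans (cong (S₁ +_) M₁≡0) (+-identityʳ S₁))))
          at-most : ∀ {c} → c ∈ vs C → Some c + 𝟙 (c ≟ⱽ z) ≤ 1
          at-most {c} _ with c ≟ⱽ z
          ... | yes refl rewrite 𝟙-no (1 ≤? w z) (<⇒≱ (s≤s (≤-reflexive (w-on-h zh)))) = ≤-refl
          ... | no _ = ≤-trans (≤-reflexive (+-identityʳ _)) (𝟙≤1 (1 ≤? w c))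
          some : ∀ {c} → c ∈ ws → 1 ≤ w c
          some {c} c∈ with 1 ≤? w c
          ... | yes le = le
          ... | no nle = ⊥-elim (<-irrefl refl (≤-trans (∑-deficit (λ c → Some c + 𝟙 (c ≟ⱽ z)) (vs C) at-most
                  (∈-resp-↭ (↭-sym (proj₁ eq)) (there c∈)) (cong₂ _+_ (𝟙-no (1 ≤? w c) nle) (𝟙-no (c ≟ⱽ z) λ { refl → head∉ (proj₁ gdZ) c∈ }))) full))
          apart : ∀ {u v} (X : Cut c₁ b ws fs) → u ≢ v → Out u → Out v → Entry u → Entry v → Port [ h ] (Cut.q X) u → Port [ h ] (Cut.p X) v → ⊥
          apart X u≢v ou ov eu ev (_ , e , qe , ue , e∉) (_ , f , pf , vf , f∉) with rotate Z (stepCut zg c₁g X)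
          ... | Z′ , eq′ , refl , refl , _ = separated Z′ (≈-trans {C} {Z} {Z′} eq eq′) u≢v ou ov eu ev ue qe (∉[] e∉) vf pf (∉[] f∉)
          run : ∀ {u v} → u ≢ v → Out u → Out v → Entry u → Entry v → (∀ {c} → c ∈ ws → Port [ h ] c u ⊎ Port [ h ] c v) → Port [ h ] c₁ u → ⊥
          run {u} {v} u≢v ou ov@(v∈ , _ , vh) eu ev either start = <-irrefl refl (begin-strict
            K                      <⟨ deg-min v∈ ⟩
            2 * deg v              ≤⟨ *-monoʳ-≤ 2 (deg≤N (u≢v ∘ sym) ov ou eu) ⟩
            2 * (N v + mates h v)  ≤⟨ *-monoʳ-≤ 2 (+-mono-≤ (≤-reflexive (∑-zero (vs C) λ {c} c∈ → 𝟙-no (Port? [ h ] c v) (none (∈-resp-↭ (proj₁ eq) c∈)))) (mates≤2 vh)) ⟩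
            4                      ≤⟨ s≤s (3≤cycle C two) ⟩
            suc m                  ≤⟨ m<K ⟩
            K                      ∎)
            where
            q∈ws : ∀ (X : Cut c₁ b ws fs) → Cut.q X ∈ ws
            q∈ws X = subst (Cut.q X ∈_) (sym (Cut.vs≡ X)) (∈-++⁺ʳ (Cut.vs₁ X) (start∈ (Cut.right X)))
            p∈ws : ∀ (X : Cut c₁ b ws fs) → Cut.p X ∈ ws
            p∈ws X = subst (Cut.p X ∈_) (sym (Cut.vs≡ X)) (∈-++⁺ˡ (end∈ (Cut.left X)))
            all-u : ∀ {c} → c ∈ ws → Port [ h ] c u
            all-u = propagate {P = λ c → Port [ h ] c u} S onward start
              where
              onward : ∀ (X : Cut c₁ b ws fs) → Port [ h ] (Cut.p X) u → Port [ h ] (Cut.q X) u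
              onward X pu with either (q∈ws X)
              ... | inj₁ qu = qu
              ... | inj₂ qv = ⊥-elim (apart X (u≢v ∘ sym) ov ou ev eu qv pu)
            none : ∀ {c} → c ∈ z ∷ ws → ¬ Port [ h ] c v
            none (here refl) (z≢v , e , ze , ve , e∉) = ∉[] e∉ (linear z≢v ze ve zh vh)
            none (there c∈) cv with cutV S c∈
            ... | inj₁ refl = apart (cut (pt _) s₁ s₂ S′ refl refl) u≢v ou ov eu ev (all-u (there (start∈ S′))) cv
            ... | inj₂ (X , refl) = apart X (u≢v ∘ sym) ov ou ev eu cv (all-u (p∈ws X))
          either : ∀ {c} → c ∈ ws → Port [ h ] c x ⊎ Port [ h ] c y
          either {c} c∈ with count-witness (Port? [ h ] c) F (some c∈)
          ... | _ , here refl , port = inj₁ port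
          ... | _ , there (here refl) , port = inj₂ port
          flip : ∀ {A B : Set} → A ⊎ B → B ⊎ A
          flip (inj₁ a) = inj₂ a
          flip (inj₂ b) = inj₁ b
          conclude : (∃ λ u → u ∈ F × Port [ h ] c₁ u) → ⊥
          conclude (_ , here refl , port) = run x≢y ox oy ex ey either port
          conclude (_ , there (here refl) , port) = run (x≢y ∘ sym) oy ox ey ex (flip ∘ either) port

      -- Crossing chords of a longest path

      lastStep : V → E → List V → List E → V × E
      lastStep x f (v ∷ vs) (e ∷ es) = lastStep v e vs es
      lastStep x f _        _        = x , f

      lastStep-join : ∀ {a b x f e vs es ws fs} → Seg a b vs es → lastStep x f (vs ++ ws) (es ++ e ∷ fs) ≡ lastStep b e ws fs
      lastStep-join (pt _)       = refl
      lastStep-join (step _ _ S) = lastStep-join S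

      record LastView (vh : V × E) (b c : V) (vs : List V) (es : List E) : Set where
        constructor lastView
        field
          {ws} : List V
          {fs} : List E
          init : Seg b (proj₁ vh) ws fs
          v◂   : proj₁ vh ◂ proj₂ vh
          c◂   : c ◂ proj₂ vh
          vs≡  : vs ≡ ws ++ [ c ]
          es≡  : es ≡ fs ++ [ proj₂ vh ]

      opaque
        step-view : ∀ {a b c e vs es} x f → a ◂ e → b ◂ e → Seg b c vs es →
                    LastView (lastStep x f (a ∷ vs) (e ∷ es)) a c (a ∷ vs) (e ∷ es)
        step-view x f a◂ b◂ (pt _) = lastView (pt _) a◂ b◂ refl refl
        step-view {a} {e = e} x f a◂ b◂ (step x◂ y◂ S) with step-view a e x◂ y◂ S
        ... | lastView S′ v◂ c◂ vs≡ es≡ = lastView (step a◂ b◂ S′) v◂ c◂ (cong (a ∷_) vs≡) (cong (e ∷_) es≡)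

        last-view : ∀ {b c vs es} x f → Seg b c vs es → (b ≡ c × vs ≡ [ c ] × es ≡ [] × lastStep x f vs es ≡ (x , f)) ⊎ LastView (lastStep x f vs es) b c vs es
        last-view x f (pt _) = inj₁ (refl , refl , refl , refl)
        last-view x f (step a◂ b◂ S) = inj₂ (step-view x f a◂ b◂ S)

      -- A neighbour of s, not counting the third vertex of the hyperedge h through which the path leaves s towards v.
      Star : V → V × E → V → Set
      Star s (v , h) w = s ≢ w × ∃ λ e → s ◂ e × w ◂ e × (e ≡ h → w ≡ v)

      opaque
        Star? : ∀ s vh w → Dec (Star s vh w)
        Star? s (v , h) w with s ≟ⱽ w | link? s w
        ... | yes s≡w | _ = no λ (s≢w , _) → s≢w s≡w
        ... | no s≢w | no ¬l = no λ (_ , e , s◂ , w◂ , _) → ¬l (e , s◂ , w◂)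
        ... | no s≢w | yes (e , s◂ , w◂) with e ≟ᴱ h | w ≟ⱽ v
        ...   | no e≢h | _ = yes (s≢w , e , s◂ , w◂ , λ e≡h → ⊥-elim (e≢h e≡h))
        ...   | yes _ | yes w≡v = yes (s≢w , e , s◂ , w◂ , λ _ → w≡v)
        ...   | yes e≡h | no w≢v = no λ (_ , e′ , s◂′ , w◂′ , imp) → w≢v (imp (trans (linear s≢w s◂′ w◂′ s◂ w◂) e≡h))

      Star⇒Adj : ∀ {s vh w} → Star s vh w → Adj s w
      Star⇒Adj (s≢w , e , s◂ , w◂ , _) = s≢w , e , s◂ , w◂

      -- A longest path from s to t seen from one of its gaps: L runs backwards from p to s, and R forwards from q to t.
      record Zip (s t : V) : Set where
        constructor zip
        field
          {p q}     : V
          {gap}     : E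
          {vsL vsR} : List V
          {esL esR} : List E
          L         : Seg p s vsL esL
          p◂        : p ◂ gap
          q◂        : q ◂ gap
          R         : Seg q t vsR esR
          gdZ       : Good (vsL ++ vsR)
          ueZ       : Unique (gap ∷ esL ++ esR)
          lnZ       : length (vsL ++ vsR) ≡ suc ℓ

        -- The defaults cover the extreme gaps: if `L` is just `s`, the path leaves `s` for `q`
        -- through the gap.
        first last : V × E
        first = lastStep q gap vsL esL
        last  = lastStep p gap vsR esR

        N₀ N₁ : Set
        N₀ = Star s first q
        N₁ = Star t last p

      flip : ∀ {s t} → Zip s t → Zip t s
      flip (zip {gap = g} {vsL} {vsR} {esL} {esR} L p◂ q◂ R gdZ ueZ lnZ) =
        zip R q◂ p◂ L (good (vsL ∷ vsR ∷ []) (`1 ⊕ `0) (`0 ⊕ `1) gdZ) (uniq ([ g ] ∷ esL ∷ esR ∷ []) (`0 ⊕ `2 ⊕ `1) (`0 ⊕ `1 ⊕ `2) ueZ)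
          (trans (len (vsL ∷ vsR ∷ []) (`0 ⊕ `1) (`1 ⊕ `0)) lnZ)

      record LP (s t : V) : Set where
        constructor lp
        field
          {v₁} : V
          {h₁} : E
          {ws} : List V
          {fs} : List E
          s◂   : s ◂ h₁
          v₁◂  : v₁ ◂ h₁
          tl   : Seg v₁ t ws fs
          gdP  : Good (s ∷ ws)
          ueP  : Unique (h₁ ∷ fs)
          lnP  : length ws ≡ ℓ

        end : V × E
        end = lastStep s h₁ ws fs

      opaque
        mkLP : ∀ {s t vs es} → Seg s t vs es → Good vs → Unique es → length vs ≡ suc ℓ → LP s t
        mkLP (pt _) _ _ ln = ⊥-elim (<-irrefl refl (≤-trans ℓ≥1 (≤-reflexive (sym (suc-injective ln)))))
          where
          ℓ≥1 : 1 ≤ ℓ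
          ℓ≥1 = ≤-trans (s≤s z≤n) ℓ≥2
        mkLP (step s◂ v₁◂ S) gd ue ln = lp s◂ v₁◂ S gd ue (suc-injective ln)

        close : ∀ {p s q t e f vsL esL vsR esR} → Seg p s vsL esL → Seg q t vsR esR → Good (vsL ++ vsR) → Unique (esL ++ esR) →
                s ◂ e → q ◂ e → e ∉ esL ++ esR → t ◂ f → p ◂ f → f ∉ esL ++ esR → e ≢ f →
                Σ Cyc λ C → vs C ≡ vsL ++ vsR × _≡_ {A = List E} (g C ∷ es C) (f ∷ esL ++ e ∷ esR)
        close {e = e} {f} {esL = esL} {esR = esR} L R gd ue se qe e∉ tf pf f∉ e≢f =
          cyc (join L se qe R) pf tf gd (uniq ([ f ] ∷ [ e ] ∷ esL ∷ esR ∷ []) (`0 ⊕ `2 ⊕ `1 ⊕ `3) (`0 ⊕ `1 ⊕ `2 ⊕ `3)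
            (uniq-∷ (λ { (here f≡e) → e≢f (sym f≡e) ; (there f∈) → f∉ f∈ }) (uniq-∷ e∉ ue))) , refl , refl

        -- A free hyperedge closes a cycle with ℓ + 1 vertices. A used one must be the first or the
        -- last of the path with the opposite end as third vertex; dropping an end then leaves a
        -- cycle with ℓ.
        no-closing : ∀ {s t} → LP s t → ¬ Adj s t
        no-closing {s} {t} (lp {h₁ = h₁} {ws} {fs} s◂ v₁◂ S gd ue ln) (s≢t , e , se , te) with e ∈ᴱ? (h₁ ∷ fs)
        ... | no e∉ = no-long-cycle (cyc (step s◂ v₁◂ S) se te gd (uniq-∷ e∉ ue)) (cong suc ln)
        ... | yes (here refl) = no-near-cycle (cyc S v₁◂ te (good ([ s ] ∷ ws ∷ []) `1 (`0 ⊕ `1) gd) ue) ln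
        ... | yes (there e∈) with last-edge S (tail-unique (proj₁ gd)) e∈ te se (head∉ (proj₁ gd))
        ...   | x , ws′ , fs′ , S′ , xe , refl , refl = no-near-cycle
                (cyc (step s◂ v₁◂ S′) se xe (good ([ s ] ∷ ws′ ∷ [ t ] ∷ []) (`0 ⊕ `1) (`0 ⊕ `1 ⊕ `2) gd)
                  (uniq ([ h₁ ] ∷ fs′ ∷ [ e ] ∷ []) (`2 ⊕ `0 ⊕ `1) (`0 ⊕ `1 ⊕ `2) ue))
                (trans (len (ws′ ∷ [ t ] ∷ []) (`0 ⊕ `1) (`1 ⊕ `0)) ln)

        unzip : ∀ {s t} → Zip s t → LP s t
        unzip (zip {gap = g} {vsL} {vsR} {esL} {esR} L p◂ q◂ R gd ue ln) = mkLP (join (rev L) p◂ q◂ R)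
          (Good-↭ (++⁺ʳ vsR (rv-↭ vsL)) gd)
          (Unique-resp-↭ (↭-trans (↭-sym (shift g esL esR)) (++⁺ʳ (g ∷ esR) (rv-↭ esL))) ue)
          (trans (sym (↭-length (++⁺ʳ vsR (rv-↭ vsL)))) ln)

        open-ends : ∀ {s t} → Zip s t → ¬ Adj s t
        open-ends = no-closing ∘ unzip

      record Next {s t} (Z : Zip s t) (e : E) : Set where
        constructor nxt
        open Zip Z
        field
          {q′}  : V
          {ws}  : List V
          {fs}  : List E
          q′◂   : q′ ◂ e
          rest  : Seg q′ t ws fs
          vsR≡  : vsR ≡ q ∷ ws
          esR≡  : esR ≡ e ∷ fs

      opaque
        -- A used hyperedge through `s` and `q` is either the one by which the path leaves `q` or
        -- the one at `s`. In the latter case `Star` would make `q` the second vertex, on the wrong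
        -- side of the gap. The hyperedge of the gap counts as free.
        via : ∀ {s t} (Z : Zip s t) → Zip.N₀ Z →
              ∃ λ e → s ◂ e × Zip.q Z ◂ e × (e ∉ Zip.esL Z ++ Zip.esR Z ⊎ Next Z e)
        via {s} Z@(zip {q = q} {g} {vsL} {vsR} {esL} {esR} L p◂ q◂ R gd ue ln) (s≢q , e , se , qe , imp) with e ∈ᴱ? (esL ++ esR)
        ... | no e∉ = e , se , qe , inj₁ e∉
        ... | yes e∈ with ∈-++⁻ esL e∈
        ...   | inj₂ e∈R with first-edge R (uniq (vsL ∷ vsR ∷ []) `1 (`0 ⊕ `1) (proj₁ gd)) e∈R qe se (λ s∈ → disjoint-++ vsL (proj₁ gd) (end∈ L) s∈ refl)
        ...     | q′ , ws , fs , q′e , S , vs≡ , es≡ = e , se , qe , inj₂ (nxt q′e S vs≡ es≡)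
        via {s} Z@(zip {q = q} {g} {vsL} {vsR} {esL} {esR} L p◂ q◂ R gd ue ln) (s≢q , e , se , qe , imp) | yes e∈ | inj₁ e∈L
          with last-edge L (Unique-++ˡ vsL (proj₁ gd)) e∈L se qe q∉ | last-view q g L
          where
          q∉ : q ∉ vsL
          q∉ q∈ = disjoint-++ vsL (proj₁ gd) q∈ (start∈ R) refl
        ...   | _ , _ , fs , _ , _ , _ , es≡ | inj₁ (_ , _ , es≡[] , _) = ⊥-elim ([]≢∷ʳ fs (trans (sym es≡[]) es≡))
        ...   | _ , _ , fs , _ , _ , _ , es≡ | inj₂ (lastView {ws} {fs′} S _ _ vs≡ es≡′) = ⊥-elim
          (disjoint-++ vsL (proj₁ gd) (subst (_ ∈_) (sym vs≡) (∈-++⁺ˡ (end∈ S))) (start∈ R) (sym (imp (∷ʳ-injectiveʳ fs fs′ (trans (sym es≡) es≡′)))))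

        distinct-edges : ∀ {s t e f} → ¬ Adj s t → s ≢ t → s ◂ e → t ◂ f → e ≢ f
        distinct-edges s≁t s≢t se tf refl = s≁t (s≢t , _ , se , tf)

        ends-differ : ∀ {s t} (Z : Zip s t) → s ≢ t
        ends-differ (zip {vsL = vsL} L _ _ R gd _ _) = disjoint-++ vsL (proj₁ gd) (end∈ L) (end∈ R)

        ∉-++ : ∀ {e} (es : List E) {fs} → e ∉ es → e ∉ fs → e ∉ es ++ fs
        ∉-++ es e∉ e∉′ e∈ with ∈-++⁻ es e∈
        ... | inj₁ e∈es = e∉ e∈es
        ... | inj₂ e∈fs = e∉′ e∈fs

        -- The crossing closes up a cycle which misses at most the two vertices next to the gap.
        cross : ∀ {s t} (Z : Zip s t) → Zip.N₀ Z → Zip.N₁ Z → ⊥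
        cross {s} {t} Z@(zip {p} {q} {g} {vsL} {vsR} {esL} {esR} L p◂ q◂ R gd ue ln) n₀ n₁ with via Z n₀ | via (flip Z) n₁
        ... | e , se , qe , inj₁ e∉ | f , tf , pf , inj₁ f∉
          with close L R gd (tail-unique ue) se qe e∉ tf pf (∉-++ esL (f∉ ∘ ∈-++⁺ʳ esR) (f∉ ∘ ∈-++⁺ˡ)) (distinct-edges (open-ends Z) (ends-differ Z) se tf)
        ...   | C , refl , _ = no-long-cycle C ln
        cross {s} {t} Z@(zip {p} {q} {g} {vsL} {vsR} {esL} {esR} L p◂ q◂ R gd ue ln) n₀ n₁
            | e , se , qe , inj₂ (nxt {q′} {ws} {fs} q′e R′ refl refl) | f , tf , pf , inj₁ f∉
          with close L R′ (good (vsL ∷ [ q ] ∷ ws ∷ []) (`0 ⊕ `2) (`0 ⊕ `1 ⊕ `2) gd) (uniq ([ g ] ∷ esL ∷ [ e ] ∷ fs ∷ []) (`1 ⊕ `3) (`0 ⊕ `1 ⊕ `2 ⊕ `3) ue)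
                 se q′e (head∉ (uniq ([ g ] ∷ esL ∷ [ e ] ∷ fs ∷ []) (`2 ⊕ `1 ⊕ `3) (`0 ⊕ `1 ⊕ `2 ⊕ `3) ue))
                 tf pf (∉-++ esL (f∉ ∘ ∈-++⁺ʳ (e ∷ fs)) (f∉ ∘ there ∘ ∈-++⁺ˡ)) (distinct-edges (open-ends Z) (ends-differ Z) se tf)
        ...   | C , refl , _ = no-near-cycle C (suc-injective (trans (len (vsL ∷ [ q ] ∷ ws ∷ []) (`0 ⊕ `1 ⊕ `2) (`1 ⊕ `0 ⊕ `2)) ln))
        cross {s} {t} Z@(zip {p} {q} {g} {vsL} {vsR} {esL} {esR} L p◂ q◂ R gd ue ln) n₀ n₁
            | e , se , qe , inj₁ e∉ | f , tf , pf , inj₂ (nxt {p′} {ws} {fs} p′f L′ refl refl)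
          with close L′ R (good ([ p ] ∷ ws ∷ vsR ∷ []) (`1 ⊕ `2) (`0 ⊕ `1 ⊕ `2) gd) (uniq ([ g ] ∷ [ f ] ∷ fs ∷ esR ∷ []) (`2 ⊕ `3) (`0 ⊕ `1 ⊕ `2 ⊕ `3) ue)
                 se qe (e∉ ∘ there) tf p′f (head∉ (tail-unique ue)) (distinct-edges (open-ends Z) (ends-differ Z) se tf)
        ...   | C , refl , _ = no-near-cycle C (suc-injective ln)
        cross {s} {t} Z@(zip {p} {q} {g} L p◂ q◂ R gd ue ln) n₀ n₁
            | e , se , qe , inj₂ (nxt {q′} {ws′} {fs′} q′e R′ refl refl) | f , tf , pf , inj₂ (nxt {p′} {ws} {fs} p′f L′ refl refl)
          with close L′ R′ (good ρ (`1 ⊕ `3) (`0 ⊕ `1 ⊕ `2 ⊕ `3) gd) (uniq σ (`2 ⊕ `4) (`0 ⊕ `1 ⊕ `2 ⊕ `3 ⊕ `4) ue)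
                 se q′e (head∉ (uniq σ (`3 ⊕ `2 ⊕ `4) (`0 ⊕ `1 ⊕ `2 ⊕ `3 ⊕ `4) ue))
                 tf p′f (head∉ (uniq σ (`1 ⊕ `2 ⊕ `4) (`0 ⊕ `1 ⊕ `2 ⊕ `3 ⊕ `4) ue)) (distinct-edges (open-ends Z) (ends-differ Z) se tf)
          where
          ρ : Vec (List V) 4
          ρ = [ p ] ∷ ws ∷ [ q ] ∷ ws′ ∷ []
          σ : Vec (List E) 5
          σ = [ g ] ∷ [ f ] ∷ fs ∷ [ e ] ∷ fs′ ∷ []
        -- Both chords are used hyperedges, so p and q are both skipped; the gap is the pendant
        -- hyperedge, and `f`, `e` are the entries.
        ...   | C , refl , edges = no-pendant C
                (suc-injective (trans (len ρ (`0 ⊕ `1 ⊕ `2 ⊕ `3) (`0 ⊕ `2 ⊕ `1 ⊕ `3)) ln))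
                (≤-trans (+-mono-≤ (∈-length (end∈ L′)) (∈-length (start∈ R′))) (≤-reflexive (sym (length-++ ws))))
                {g} (λ g∈ → head∉ ue (subst (g ∈_) edges g∈))
                (disjoint-++ (p ∷ ws) (proj₁ gd) (here refl) (here refl))
                (∈U gd (here refl) , head∉ (uniq ρ (`0 ⊕ `1 ⊕ `3) (`0 ⊕ `1 ⊕ `2 ⊕ `3) (proj₁ gd)) , p◂)
                (∈U gd (∈-++⁺ʳ (p ∷ ws) (here refl)) , head∉ (uniq ρ (`2 ⊕ `1 ⊕ `3) (`0 ⊕ `1 ⊕ `2 ⊕ `3) (proj₁ gd)) , q◂)
                (p′ , f , ∈-++⁺ˡ (start∈ L′) , p′f , pf , λ { refl → head∉ ue (here refl) })
                (q′ , e , ∈-++⁺ʳ ws (start∈ R′) , q′e , qe , λ { refl → head∉ ue (there (∈-++⁺ʳ fs (here refl))) })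
          where
          ρ : Vec (List V) 4
          ρ = [ p ] ∷ ws ∷ [ q ] ∷ ws′ ∷ []

      shiftZ : ∀ {s t p q r g g′ vsL vsR esL esR} → Seg p s vsL esL → p ◂ g → q ◂ g → q ◂ g′ → r ◂ g′ → Seg r t vsR esR →
               Good (vsL ++ q ∷ vsR) → Unique (g ∷ esL ++ g′ ∷ esR) → length (vsL ++ q ∷ vsR) ≡ suc ℓ → Zip s t
      shiftZ {q = q} {g = g} {g′} {vsL} {vsR} {esL} {esR} L p◂ q◂ q◂′ r◂ R gd ue ln =
        zip (step q◂ p◂ L) q◂′ r◂ R (good ρ (`1 ⊕ `0 ⊕ `2) (`0 ⊕ `1 ⊕ `2) gd)
          (uniq ([ g ] ∷ esL ∷ [ g′ ] ∷ esR ∷ []) (`2 ⊕ `0 ⊕ `1 ⊕ `3) (`0 ⊕ `1 ⊕ `2 ⊕ `3) ue)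
          (trans (len ρ (`0 ⊕ `1 ⊕ `2) (`1 ⊕ `0 ⊕ `2)) ln)
        where
        ρ : Vec (List V) 3
        ρ = vsL ∷ [ q ] ∷ vsR ∷ []

      opaque
        -- With a free chord from s to r, the chords close a cycle without q, or without p and q if
        -- the chord from t is a used hyperedge: ℓ vertices, or ℓ - 1 and the pendant hyperedge `g`.
        -- So the chord to r must be the hyperedge by which the path leaves r.
        consecutive : ∀ {s t p q r g g′ vsL vsR esL esR} (L : Seg p s vsL esL) (p◂ : p ◂ g) (q◂ : q ◂ g) (q◂′ : q ◂ g′) (r◂ : r ◂ g′)
                      (R : Seg r t vsR esR) (gd : Good (vsL ++ q ∷ vsR)) (ue : Unique (g ∷ esL ++ g′ ∷ esR)) (ln : length (vsL ++ q ∷ vsR) ≡ suc ℓ) →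
                      Zip.N₁ (zip L p◂ q◂ (step q◂′ r◂ R) gd ue ln) → Zip.N₀ (shiftZ L p◂ q◂ q◂′ r◂ R gd ue ln) →
                      ∃ λ e → s ◂ e × r ◂ e × Next (shiftZ L p◂ q◂ q◂′ r◂ R gd ue ln) e
        consecutive {s} {t} {p} {q} {r} {g} {g′} {vsL} {vsR} {esL} {esR} L p◂ q◂ q◂′ r◂ R gd ue ln n₁ n₀
          with via (shiftZ L p◂ q◂ q◂′ r◂ R gd ue ln) n₀ | via (flip (zip L p◂ q◂ (step q◂′ r◂ R) gd ue ln)) n₁
        ... | e , se , re , inj₂ next | _ = e , se , re , next
        ... | e , se , re , inj₁ e∉ | f , tf , pf , inj₁ f∉
          with close L R (good (vsL ∷ [ q ] ∷ vsR ∷ []) (`0 ⊕ `2) (`0 ⊕ `1 ⊕ `2) gd) (uniq ([ g ] ∷ esL ∷ [ g′ ] ∷ esR ∷ []) (`1 ⊕ `3) (`0 ⊕ `1 ⊕ `2 ⊕ `3) ue)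
                 se re (e∉ ∘ there) tf pf (∉-++ esL (f∉ ∘ ∈-++⁺ʳ (g′ ∷ esR)) (f∉ ∘ there ∘ ∈-++⁺ˡ))
                 (distinct-edges (open-ends Z) (ends-differ Z) se tf)
          where
          Z : Zip s t
          Z = zip L p◂ q◂ (step q◂′ r◂ R) gd ue ln
        ...   | C , refl , _ = ⊥-elim (no-near-cycle C (suc-injective (trans (len (vsL ∷ [ q ] ∷ vsR ∷ []) (`0 ⊕ `1 ⊕ `2) (`1 ⊕ `0 ⊕ `2)) ln)))
        consecutive {s} {t} {p} {q} {r} {g} {g′} {vsL} {vsR} {esL} {esR} L p◂ q◂ q◂′ r◂ R gd ue ln n₁ n₀
            | e , se , re , inj₁ e∉ | f , tf , pf , inj₂ (nxt {p′} {ws} {fs} p′f L′ refl refl)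
          with close L′ R (good ρ (`1 ⊕ `3) (`0 ⊕ `1 ⊕ `2 ⊕ `3) gd) (uniq σ (`2 ⊕ `4) (`0 ⊕ `1 ⊕ `2 ⊕ `3 ⊕ `4) ue)
                 se re (e∉ ∘ there ∘ there) tf p′f (head∉ (uniq σ (`1 ⊕ `2 ⊕ `4) (`0 ⊕ `1 ⊕ `2 ⊕ `3 ⊕ `4) ue))
                 (distinct-edges (open-ends Z) (ends-differ Z) se tf)
          where
          Z : Zip s t
          Z = zip L p◂ q◂ (step q◂′ r◂ R) gd ue ln
          ρ : Vec (List V) 4
          ρ = [ p ] ∷ ws ∷ [ q ] ∷ vsR ∷ []
          σ : Vec (List E) 5
          σ = [ g ] ∷ [ f ] ∷ fs ∷ [ g′ ] ∷ esR ∷ []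
        ...   | C , refl , edges = ⊥-elim (no-pendant C
                (suc-injective (trans (len ρ (`0 ⊕ `1 ⊕ `2 ⊕ `3) (`0 ⊕ `2 ⊕ `1 ⊕ `3)) ln))
                (≤-trans (+-mono-≤ (∈-length (end∈ L′)) (∈-length (start∈ R))) (≤-reflexive (sym (length-++ ws))))
                {g} (λ g∈ → fresh (subst (g ∈_) edges g∈))
                (disjoint-++ (p ∷ ws) (proj₁ gd) (here refl) (here refl))
                (∈U gd (here refl) , head∉ (uniq ρ (`0 ⊕ `1 ⊕ `3) (`0 ⊕ `1 ⊕ `2 ⊕ `3) (proj₁ gd)) , p◂)
                (∈U gd (∈-++⁺ʳ (p ∷ ws) (here refl)) , head∉ (uniq ρ (`2 ⊕ `1 ⊕ `3) (`0 ⊕ `1 ⊕ `2 ⊕ `3) (proj₁ gd)) , q◂)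
                (p′ , f , ∈-++⁺ˡ (start∈ L′) , p′f , pf , λ { refl → head∉ ue (here refl) })
                (r , g′ , ∈-++⁺ʳ ws (start∈ R) , r◂ , q◂′ , λ { refl → head∉ ue (there (∈-++⁺ʳ fs (here refl))) }))
          where
          ρ : Vec (List V) 4
          ρ = [ p ] ∷ ws ∷ [ q ] ∷ vsR ∷ []
          fresh : g ∉ f ∷ fs ++ e ∷ esR
          fresh (here refl) = head∉ ue (here refl)
          fresh (there g∈) with ∈-++⁻ fs g∈
          ... | inj₁ g∈fs = head∉ ue (there (∈-++⁺ˡ g∈fs))
          ... | inj₂ (here refl) = e∉ (here refl)
          ... | inj₂ (there g∈R) = head∉ ue (there (∈-++⁺ʳ fs (there g∈R)))

        -- `q` is the third vertex of the hyperedge at `s`, which can therefore join the second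
        -- vertex to `q` directly. A free chord from t to p would then close a cycle missing only
        -- `s`.
        special : ∀ {s t} (Z : Zip s t) → Zip.q Z ◂ proj₂ (Zip.first Z) → Zip.q Z ≢ proj₁ (Zip.first Z) →
                  ¬ Zip.N₀ Z × (Zip.N₁ Z → ∃ λ f → t ◂ f × Zip.p Z ◂ f × Next (flip Z) f)
        special {s} {t} Z@(zip {p} {q} {g} {vsL} {vsR} {esL} {esR} L p◂ q◂ R gd ue ln) qh q≢v with last-view q g L
        ... | inj₁ (_ , _ , _ , eq) = ⊥-elim (q≢v (sym (cong proj₁ eq)))
        ... | inj₂ (lastView {ws} {fs} L₁ v◂ s◂ refl es≡) = not₀ , only
          where
          h : E
          h = proj₂ (lastStep q g (ws ++ [ s ]) esL)
          not₀ : ¬ Zip.N₀ Z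
          not₀ (s≢q , e , se , qe , imp) = q≢v (imp (linear s≢q se qe s◂ qh))
          only : Zip.N₁ Z → ∃ λ f → t ◂ f × p ◂ f × Next (flip Z) f
          only n₁ with via (flip Z) n₁
          ... | f , tf , pf , inj₂ next = f , tf , pf , next
          ... | f , tf , pf , inj₁ f∉ with close L₁ R (good (ws ∷ [ s ] ∷ vsR ∷ []) (`0 ⊕ `2) ((`0 ⊕ `1) ⊕ `2) gd)
                    (uniq σ (`1 ⊕ `3) (`0 ⊕ (`1 ⊕ `2) ⊕ `3) ue′)
                    v◂ qh (head∉ (uniq σ (`2 ⊕ `1 ⊕ `3) (`0 ⊕ (`1 ⊕ `2) ⊕ `3) ue′)) tf pf
                    (∉-++ fs (λ f∈ → f∉ (∈-++⁺ʳ esR (subst (f ∈_) (sym es≡) (∈-++⁺ˡ f∈)))) (f∉ ∘ ∈-++⁺ˡ))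
                    (λ h≡f → f∉ (∈-++⁺ʳ esR (subst (f ∈_) (sym es≡) (∈-++⁺ʳ fs (here (sym h≡f))))))
            where
            σ : Vec (List E) 4
            σ = [ g ] ∷ fs ∷ [ h ] ∷ esR ∷ []
            ue′ : Unique (g ∷ (fs ++ [ h ]) ++ esR)
            ue′ = subst (λ es → Unique (g ∷ es ++ esR)) es≡ ue
          ...   | C , refl , _ = ⊥-elim (no-near-cycle C (suc-injective (trans (len (ws ∷ [ s ] ∷ vsR ∷ []) ((`0 ⊕ `1) ⊕ `2) (`1 ⊕ `0 ⊕ `2)) ln)))

        start-off : ∀ {s t e} (Z : Zip s t) → s ◂ e → Zip.q Z ◂ e → e ∉ Zip.esL Z ++ Zip.esR Z → LP (Zip.p Z) t
        start-off {e = e} (zip {esL = esL} {esR} L p◂ q◂ R gd ue ln) se qe e∉ =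
          mkLP (join L se qe R) gd (uniq ([ e ] ∷ esL ∷ esR ∷ []) (`1 ⊕ `0 ⊕ `2) (`0 ⊕ `1 ⊕ `2) (uniq-∷ e∉ (tail-unique ue))) ln

        -- The hyperedge after `q` carries the path from s past q to q′, while q moves in front of p
        -- through the gap.
        start-next : ∀ {s t e} (Z : Zip s t) → s ◂ e → Next Z e → LP (Zip.q Z) t
        start-next {e = e} (zip {p} {q} {g} {vsL} {esL = esL} L p◂ q◂ _ gd ue ln) se (nxt {ws = ws} {fs} q′e R′ refl refl) =
          lp q◂ p◂ (join L se q′e R′) (good ρ (`1 ⊕ `0 ⊕ `2) (`0 ⊕ `1 ⊕ `2) gd) ue
            (suc-injective (trans (len ρ (`0 ⊕ `1 ⊕ `2) (`1 ⊕ `0 ⊕ `2)) ln))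
          where
          ρ : Vec (List V) 3
          ρ = vsL ∷ [ q ] ∷ ws ∷ []

      open LP public

      leftCut : ∀ {a b vs es} (X : Cut a b vs es) → Cut a (Cut.p X) (Cut.vs₁ X) (Cut.es₁ X) → Cut a b vs es
      leftCut (cut {vs₂ = ws} {es₂ = fs} L p◂ q◂ R v≡ e≡) (cut {g = f} {vs₁} {vs₂} {es₁} {es₂} A x◂ y◂ B v≡′ e≡′) =
        cut A x◂ y◂ (join B p◂ q◂ R) (trans v≡ (trans (cong (_++ ws) v≡′) (++-assoc vs₁ vs₂ ws)))
          (trans e≡ (trans (cong (_++ _ ∷ fs) e≡′) (++-assoc es₁ (f ∷ es₂) _)))

      rightCut : ∀ {a b vs es} (X : Cut a b vs es) → Cut (Cut.q X) b (Cut.vs₂ X) (Cut.es₂ X) → Cut a b vs es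
      rightCut (cut {g = g} {vs₁ = ws} {es₁ = fs} L p◂ q◂ R v≡ e≡) (cut {vs₁ = vs₁} {vs₂} {es₁} {es₂} A x◂ y◂ B v≡′ e≡′) =
        cut (join L p◂ q◂ A) x◂ y◂ B (trans v≡ (trans (cong (ws ++_) v≡′) (sym (++-assoc ws vs₁ vs₂))))
          (trans e≡ (trans (cong (λ es → fs ++ g ∷ es) e≡′) (sym (++-assoc fs (g ∷ es₁) _))))

      opaque
        -- `gap-sum` on either side of the empty gap, which itself saves a unit.
        deficit : ∀ (f h : V → ℕ) {a b vs es} → (∀ (X : Cut a b vs es) → f (Cut.q X) + h (Cut.p X) ≤ 1) →
                  (X : Cut a b vs es) → f (Cut.q X) + h (Cut.p X) ≡ 0 → suc (∑ f vs + ∑ h vs) ≤ length es + (f a + h b)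
        deficit f h {a} {b} bound X@(cut {p} {q} {g} {vs₁} {vs₂} {es₁} {es₂} L p◂ q◂ R refl refl) zero! = begin
          suc (∑ f (vs₁ ++ vs₂) + ∑ h (vs₁ ++ vs₂))                       ≡⟨ cong suc (cong₂ _+_ (∑-++ f vs₁) (∑-++ h vs₁)) ⟩
          suc (∑ f vs₁ + ∑ f vs₂ + (∑ h vs₁ + ∑ h vs₂))                   ≡⟨ lemma₁ (∑ f vs₁) (∑ f vs₂) (∑ h vs₁) (∑ h vs₂) ⟩
          suc (∑ f vs₁ + ∑ h vs₁ + (∑ f vs₂ + ∑ h vs₂))                   ≤⟨ s≤s (+-mono-≤ (gap-sum f h 1 L (λ Y → bound (leftCut X Y))) (gap-sum f h 1 R (λ Y → bound (rightCut X Y)))) ⟩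
          suc (1 * length es₁ + (f a + h p) + (1 * length es₂ + (f q + h b))) ≡⟨ lemma₂ (length es₁) (length es₂) (f a) (h p) (f q) (h b) ⟩
          length es₁ + suc (length es₂) + (f a + h b) + (f q + h p)       ≡⟨ trans (cong (length es₁ + suc (length es₂) + (f a + h b) +_) zero!) (+-identityʳ _) ⟩
          length es₁ + suc (length es₂) + (f a + h b)                     ≡⟨ cong (_+ (f a + h b)) (sym (length-++ es₁)) ⟩
          length (es₁ ++ g ∷ es₂) + (f a + h b)                           ∎
          where
          open ≤-Reasoning
          lemma₁ : ∀ x y z w → 1 + (x + y + (z + w)) ≡ 1 + (x + z + (y + w))
          lemma₁ = solve-∀
          lemma₂ : ∀ i j x y z w → 1 + (1 * i + (x + y) + (1 * j + (z + w))) ≡ i + (1 + j) + (x + w) + (z + y)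
          lemma₂ = solve-∀

      -- Degrees of the ends and rotations

      F H : ∀ {s t} → LP s t → V → Set
      F {s} P = Star s (v₁ P , h₁ P)
      H {t = t} P = Star t (end P)

      F? : ∀ {s t} (P : LP s t) w → Dec (F P w)
      F? {s} P = Star? s (v₁ P , h₁ P)

      H? : ∀ {s t} (P : LP s t) w → Dec (H P w)
      H? {t = t} P = Star? t (end P)

      α β : ∀ {s t} → LP s t → ℕ
      α P = count (F? P) (ws P)
      β P = count (H? P) (ws P)

      opaque
        F≁t : ∀ {s t} (P : LP s t) → ¬ F P t
        F≁t P = no-closing P ∘ Star⇒Adj

        H≁s : ∀ {s t} (P : LP s t) → ¬ H P s
        H≁s P = no-closing P ∘ Adj-sym ∘ Star⇒Adj

        H≁t : ∀ {s t} (P : LP s t) → ¬ H P t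
        H≁t P (t≢t , _) = t≢t refl

      PCut : ∀ {s t} → LP s t → Set
      PCut {t = t} P = Cut (v₁ P) t (ws P) (fs P)

      opaque
        zipAt : ∀ {s t} (P : LP s t) (X : PCut P) → Σ (Zip s t) λ Z → Zip.p Z ≡ Cut.p X × Zip.q Z ≡ Cut.q X ×
                Zip.first Z ≡ (v₁ P , h₁ P) × Zip.last Z ≡ end P × Zip.vsR Z ≡ Cut.vs₂ X × Zip.esR Z ≡ Cut.es₂ X
        zipAt {s} (lp {v} {h} s◂ v◂ _ gd ue ln) (cut {p} {q} {g} {vs₁} {vs₂} {es₁} {es₂} A p◂ q◂ B refl refl) =
          zip (join (rev A) v◂ s◂ (pt s)) p◂ q◂ B (Good-↭ moveV gd) (Unique-resp-↭ moveE ue) (trans (sym (↭-length moveV)) (cong suc ln)) ,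
          refl , refl , lastStep-join (rev A) , sym (lastStep-join A) , refl , refl
          where
          moveV : s ∷ vs₁ ++ vs₂ ↭ (rv vs₁ ++ [ s ]) ++ vs₂
          moveV = ++⁺ʳ vs₂ (↭-trans (++-comm [ s ] vs₁) (++⁺ʳ [ s ] (rv-↭ vs₁)))
          moveE : h ∷ es₁ ++ g ∷ es₂ ↭ g ∷ (rv es₁ ++ [ h ]) ++ es₂
          moveE = ↭-trans (perm σ (`3 ⊕ (`1 ⊕ `0) ⊕ `2) (`0 ⊕ `1 ⊕ `3 ⊕ `2)) (prep g (++⁺ʳ es₂ (++⁺ʳ [ h ] (rv-↭ es₁))))
            where
            σ : Vec (List E) 4
            σ = [ h ] ∷ es₁ ∷ es₂ ∷ [ g ] ∷ []

        crossing : ∀ {s t} (P : LP s t) (X : PCut P) → F P (Cut.q X) → H P (Cut.p X) → ⊥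
        crossing P X fq hp with zipAt P X
        ... | Z , refl , refl , first≡ , last≡ , _ = cross Z (subst (λ vh → Star _ vh _) (sym first≡) fq) (subst (λ vh → Star _ vh _) (sym last≡) hp)

        each≤1 : ∀ {s t} (P : LP s t) (X : PCut P) → 𝟙 (F? P (Cut.q X)) + 𝟙 (H? P (Cut.p X)) ≤ 1
        each≤1 P X with F? P (Cut.q X) | H? P (Cut.p X)
        ... | yes fq | yes hp = ⊥-elim (crossing P X fq hp)
        ... | yes _ | no _ = ≤-refl
        ... | no _ | yes _ = ≤-refl
        ... | no _ | no _ = z≤n

        ∣fs∣ : ∀ {s t} (P : LP s t) → suc (length (fs P)) ≡ ℓ
        ∣fs∣ P = trans (sym (length-Seg (tl P))) (lnP P)

        end-terms : ∀ {s t} (P : LP s t) → 𝟙 (F? P (v₁ P)) + 𝟙 (H? P t) ≤ 1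
        end-terms {t = t} P = +-mono-≤ (𝟙≤1 (F? P (v₁ P))) (≤-reflexive (𝟙-no (H? P t) (H≁t P)))

        -- The ℓ - 1 gaps after v₁ carry at most one each, and v₁ itself may add one; `t` is not its
        -- own neighbour.
        α+β≤ℓ : ∀ {s t} (P : LP s t) → α P + β P ≤ ℓ
        α+β≤ℓ P = ≤-trans (gap-sum _ _ 1 (tl P) (each≤1 P)) (≤-trans (+-mono-≤ (≤-reflexive (*-identityˡ (length (fs P)))) (end-terms P))
                    (≤-reflexive (trans (+-comm _ 1) (∣fs∣ P))))

        tight : ∀ {s t} (P : LP s t) → ℓ ≤ α P + β P → (X : PCut P) → F P (Cut.q X) ⊎ H P (Cut.p X)
        tight P le X = go (F? P (Cut.q X)) (H? P (Cut.p X))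
          where
          go : Dec (F P (Cut.q X)) → Dec (H P (Cut.p X)) → F P (Cut.q X) ⊎ H P (Cut.p X)
          go (yes fq) _ = inj₁ fq
          go (no _) (yes hp) = inj₂ hp
          go (no ¬fq) (no ¬hp) = ⊥-elim (<-irrefl refl (≤-trans (s≤s le) (≤-trans
            (deficit _ _ (each≤1 P) X (cong₂ _+_ (𝟙-no (F? P (Cut.q X)) ¬fq) (𝟙-no (H? P (Cut.p X)) ¬hp)))
            (≤-trans (+-monoʳ-≤ (length (fs P)) (end-terms P)) (≤-reflexive (trans (+-comm _ 1) (∣fs∣ P)))))))

        third? : ∀ {s t} (P : LP s t) w → Dec (w ◂ h₁ P × w ≢ s × w ≢ v₁ P)
        third? {s} P w = (w ◂? h₁ P) ×-dec (¬? (w ≟ⱽ s) ×-dec ¬? (w ≟ⱽ v₁ P))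

      σ : ∀ {s t} → LP s t → ℕ
      σ P = count (third? P) U

      opaque
        s≢v₁ : ∀ {s t} (P : LP s t) → s ≢ v₁ P
        s≢v₁ P refl = head∉ (proj₁ (gdP P)) (start∈ (tl P))

        σ≤1 : ∀ {s t} (P : LP s t) → σ P ≤ 1
        σ≤1 P = count≤1 (third? P) U U-unique λ _ _ (xh , x≢s , x≢v) (yh , y≢s , y≢v) →
          sym (fourth (s≢v₁ P) (x≢s ∘ sym) (x≢v ∘ sym) (s◂ P) (v₁◂ P) xh yh y≢s y≢v)

        -- The star count omits just the third vertex of the first hyperedge. Any other neighbour
        -- lies on the path, because a free hyperedge leading off it would prolong the path.
        deg≤α+σ : ∀ {s t} (P : LP s t) → deg s ≤ α P + σ P
        deg≤α+σ {s} P with complement (s ∷ ws P) (gdP P)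
        ... | O , p = begin
          ∑ (s ~_) U                                            ≡⟨ ∑-↭ (s ~_) p ⟩
          s ~ s + ∑ (s ~_) (ws P ++ O)                          ≡⟨ cong₂ _+_ (~-irrefl s) (∑-++ (s ~_) (ws P)) ⟩
          ∑ (s ~_) (ws P) + ∑ (s ~_) O                          ≤⟨ +-mono-≤ inner outer ⟩
          α P + third (ws P) + third O                          ≡⟨ +-assoc (α P) _ _ ⟩
          α P + (third (ws P) + third O)                        ≤⟨ +-monoʳ-≤ (α P) (m≤n+m _ (𝟙 (third? P s))) ⟩
          α P + (𝟙 (third? P s) + (third (ws P) + third O))     ≡⟨ cong (α P +_) (sym (trans (∑-↭ (𝟙 ∘ third? P) p) (cong (𝟙 (third? P s) +_) (∑-++ (𝟙 ∘ third? P) (ws P))))) ⟩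
          α P + σ P                                             ∎
          where
          open ≤-Reasoning
          third : List V → ℕ
          third = count (third? P)
          inner : ∑ (s ~_) (ws P) ≤ α P + third (ws P)
          inner = ≤-trans (∑-mono (ws P) λ {w} _ → 𝟙-mono⊎ (Adj? s w) (F? P w) (third? P w) split) (≤-reflexive (∑-+ (𝟙 ∘ F? P) (𝟙 ∘ third? P) (ws P)))
            where
            split : ∀ {w} → Adj s w → F P w ⊎ (w ◂ h₁ P × w ≢ s × w ≢ v₁ P)
            split {w} (s≢w , e , se , we) with e ≟ᴱ h₁ P | w ≟ⱽ v₁ P
            ... | no e≢h | _ = inj₁ (s≢w , e , se , we , λ e≡h → ⊥-elim (e≢h e≡h))
            ... | yes _ | yes w≡v = inj₁ (s≢w , e , se , we , λ _ → w≡v)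
            ... | yes refl | no w≢v = inj₂ (we , s≢w ∘ sym , w≢v)
          outer : ∑ (s ~_) O ≤ third O
          outer = ∑-mono O λ {w} w∈ → 𝟙-mono (Adj? s w) (third? P w) (only-third (∈-complement p w∈) (∉-complement p w∈))
            where
            only-third : ∀ {w} → w ∈ U → w ∉ s ∷ ws P → Adj s w → w ◂ h₁ P × w ≢ s × w ≢ v₁ P
            only-third {w} w∈ w∉ (s≢w , e , se , we) with e ∈ᴱ? (h₁ P ∷ fs P)
            ... | no e∉ = ⊥-elim (too-long ((s ∷ ws P) ∷ [ w ] ∷ []) (`1 ⊕ `0) (`1 ⊕ `0) (Good-∷ w∈ w∉ (gdP P)) (cong (2 +_) (lnP P))
                  ((h₁ P ∷ fs P) ∷ [ e ] ∷ []) (`1 ⊕ `0) (`1 ⊕ `0) (uniq-∷ e∉ (ueP P)) (step we se (step (s◂ P) (v₁◂ P) (tl P))))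
            ... | yes e∈ with first-edge (step (s◂ P) (v₁◂ P) (tl P)) (proj₁ (gdP P)) e∈ se we w∉
            ...   | _ , _ , _ , _ , _ , _ , refl = we , s≢w ∘ sym , λ { refl → w∉ (there (start∈ (tl P))) }

      record Reversal {s t} (P : LP s t) : Set where
        field
          back  : LP t s
          head≡ : (v₁ back , h₁ back) ≡ end P
          end≡  : end back ≡ (v₁ P , h₁ P)
          α≡    : α back ≡ β P
          β≡    : β back ≡ α P
          inner : ∀ {u} → u ∈ ws back → u ∈ s ∷ ws P

      opaque
        head-Seg : ∀ {a b vs es} → Seg a b vs es → ∃ λ ws → vs ≡ a ∷ ws
        head-Seg (pt _)       = _ , refl
        head-Seg (step _ _ _) = _ , refl

        reversal : ∀ {s t} (P : LP s t) → Reversal P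
        reversal {s} {t} P@(lp {v} {h} {ws} {fs} s◂ v◂ R gd ue ln) with step-view s h s◂ v◂ R
        ... | lastView S v′◂ t◂ vs≡ es≡ = go S refl v′◂ t◂ vs≡ es≡
          where
          go : ∀ {v′ h′ ws₀ fs₀} → Seg s v′ ws₀ fs₀ → end P ≡ (v′ , h′) → v′ ◂ h′ → t ◂ h′ →
               s ∷ ws ≡ ws₀ ++ [ t ] → h ∷ fs ≡ fs₀ ++ [ h′ ] → Reversal P
          go (pt _) _ _ _ vs≡ es≡ = ⊥-elim (<-irrefl refl (≤-trans ℓ≥2 (≤-reflexive (suc-injective (trans (cong suc (sym ln)) (cong length vs≡))))))
          go {v′} {h′} {ws₀} {fs₀} S@(step {b = x} {e = e} {vs = ws₁} {fs₁} a◂ x◂ S₁) end≡ v′◂ t◂ vs≡ es≡ = record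
            { back = back ; head≡ = sym end≡ ; end≡ = end-back
            ; inner = λ {u} u∈ → subst (u ∈_) (sym vs≡) (∈-++⁺ˡ (∈-resp-↭ (↭-sym (rv-↭ ws₀)) u∈))
            ; α≡ = trans (cong (λ vh → ∑ (λ w → 𝟙 (Star? t vh w)) (rv ws₀)) (sym end≡)) $ trans (sym (∑-↭ hh (rv-↭ ws₀))) (sym (swap-ends hh (𝟙-no (H? P s) (H≁s P)) (𝟙-no (H? P t) (H≁t P))))
            ; β≡ = trans (cong (λ vh → ∑ (λ w → 𝟙 (Star? s vh w)) (rv ws₀)) end-back)
                     (trans (sym (∑-↭ ff (rv-↭ ws₀))) (sym (swap-ends ff (𝟙-no (F? P s) (λ (s≢s , _) → s≢s refl)) (𝟙-no (F? P t) (F≁t P))))) }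
            where
            hh ff : V → ℕ
            hh = λ w → 𝟙 (H? P w)
            ff = λ w → 𝟙 (F? P w)
            gd′ : Good (t ∷ rv ws₀)
            gd′ = Good-↭ (↭-trans (↭-reflexive vs≡) (↭-trans (++-comm ws₀ [ t ]) (prep t (rv-↭ ws₀)))) gd
            ue′ : Unique (h′ ∷ rv fs₀)
            ue′ = Unique-resp-↭ (↭-trans (↭-reflexive es≡) (↭-trans (++-comm fs₀ [ h′ ]) (prep h′ (rv-↭ fs₀)))) ue
            back : LP t s
            back = lp t◂ v′◂ (rev S) gd′ ue′ (trans (sym (↭-length (rv-↭ ws₀)))
                     (trans (suc-injective (trans (sym (trans (length-++ ws₀) (+-comm (length ws₀) 1))) (cong length (sym vs≡)))) ln))
            swap-ends : ∀ (k : V → ℕ) → k s ≡ 0 → k t ≡ 0 → ∑ k ws ≡ ∑ k ws₀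
            swap-ends k ks kt = begin
              ∑ k ws              ≡⟨ cong (_+ ∑ k ws) (sym ks) ⟩
              ∑ k (s ∷ ws)        ≡⟨ cong (∑ k) vs≡ ⟩
              ∑ k (ws₀ ++ [ t ])  ≡⟨ ∑-++ k ws₀ ⟩
              ∑ k ws₀ + (k t + 0) ≡⟨ cong (∑ k ws₀ +_) (trans (+-identityʳ _) kt) ⟩
              ∑ k ws₀ + 0         ≡⟨ +-identityʳ _ ⟩
              ∑ k ws₀             ∎
              where open ≡-Reasoning
            x≡v : x ≡ v
            x≡v with head-Seg R | head-Seg S₁
            ... | _ , refl | _ , refl = sym (proj₁ (∷-injective (proj₂ (∷-injective vs≡))))
            e≡h : e ≡ h
            e≡h = sym (proj₁ (∷-injective es≡))
            end-back : end back ≡ (v , h)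
            end-back = trans (lastStep-join (rev S₁)) (cong₂ _,_ x≡v e≡h)

      opaque
        next-start : ∀ {s t} (P : LP s t) {p q r g g′ vs₁ es₁ ws′ fs′} → Seg (v₁ P) p vs₁ es₁ → p ◂ g → q ◂ g → q ◂ g′ → r ◂ g′ → Seg r t ws′ fs′ →
                     ws P ≡ vs₁ ++ q ∷ ws′ → fs P ≡ es₁ ++ g ∷ g′ ∷ fs′ → H P p → F P r → LP r t × Adj s r
        next-start {s} {t} (lp {v} {h} s◂ v◂ _ gd ue ln) {p} {q} {r} {g} {g′} {vs₁} {es₁} {ws′} {fs′} A p◂ q◂ q◂′ r◂ B refl refl hp fr
          with consecutive (join (rev A) v◂ s◂ (pt s)) p◂ q◂ q◂′ r◂ B gd′ ue′ ln′
                 (subst (λ vh → Star t vh p) (lastStep-join A) hp)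
                 (subst (λ vh → Star s vh r) (sym (lastStep-join (rev A))) fr)
          where
          moveV : s ∷ vs₁ ++ q ∷ ws′ ↭ (rv vs₁ ++ [ s ]) ++ q ∷ ws′
          moveV = ++⁺ʳ (q ∷ ws′) (↭-trans (++-comm [ s ] vs₁) (++⁺ʳ [ s ] (rv-↭ vs₁)))
          σ′ : Vec (List E) 4
          σ′ = [ h ] ∷ es₁ ∷ (g′ ∷ fs′) ∷ [ g ] ∷ []
          gd′ : Good ((rv vs₁ ++ [ s ]) ++ q ∷ ws′)
          gd′ = Good-↭ moveV gd
          ue′ : Unique (g ∷ (rv es₁ ++ [ h ]) ++ g′ ∷ fs′)
          ue′ = Unique-resp-↭ (↭-trans (perm σ′ (`3 ⊕ (`1 ⊕ `0) ⊕ `2) (`0 ⊕ `1 ⊕ `3 ⊕ `2)) (prep g (++⁺ʳ (g′ ∷ fs′) (++⁺ʳ [ h ] (rv-↭ es₁))))) ue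
          ln′ : length ((rv vs₁ ++ [ s ]) ++ q ∷ ws′) ≡ suc ℓ
          ln′ = trans (sym (↭-length moveV)) (cong suc ln)
        ... | e , se , re , next = start-next _ se next , Star⇒Adj fr

        second-start : ∀ {s t} (P : LP s t) {r g ws′ fs′} (v◂ : v₁ P ◂ g) (r◂ : r ◂ g) (B : Seg r t ws′ fs′) →
                       ws P ≡ v₁ P ∷ ws′ → fs P ≡ g ∷ fs′ → F P r → LP (v₁ P) t ⊎ (LP r t × Adj s r)
        second-start P {r} v◂ r◂ B vs≡ es≡ fr with zipAt P (cut (pt _) v◂ r◂ B vs≡ es≡)
        ... | Z , refl , refl , first≡ , _ with via Z (subst (λ vh → Star _ vh r) (sym first≡) fr)
        ...   | e , se , re , inj₁ e∉ = inj₁ (start-off Z se re e∉)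
        ...   | e , se , re , inj₂ next = inj₂ (start-next Z se next , Star⇒Adj fr)

        tl-unique : ∀ {s t} (P : LP s t) → Unique (ws P)
        tl-unique P = tail-unique (proj₁ (gdP P))

        p≢t : ∀ {s t} (P : LP s t) (X : PCut P) → Cut.p X ≢ t
        p≢t P X = disjoint-++ (Cut.vs₁ X) (subst Unique (Cut.vs≡ X) (tl-unique P)) (end∈ (Cut.left X)) (end∈ (Cut.right X))

        -- If no gap after the first yields a new start, then t has a neighbour before every gap, so s has only one on the path.
        walk : ∀ {s t} (P : LP s t) → ((X : PCut P) → F P (Cut.q X) ⊎ H P (Cut.p X)) → (LP (v₁ P) t → ⊥) →
               ((X : PCut P) → F P (Cut.q X) → LP (Cut.q X) t → Adj s (Cut.q X) → ⊥) → α P ≤ 1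
        walk {s} {t} P@(lp {v} {h} s◂ v◂ R gd ue ln) cover noV noR = go R refl refl
          where
          go : ∀ {ws′ fs′} → Seg v t ws′ fs′ → LP.ws P ≡ ws′ → LP.fs P ≡ fs′ → α P ≤ 1
          go (pt _) refl refl = +-monoˡ-≤ 0 (𝟙≤1 (F? P v))
          go (step {vs = ws″} v◂g r◂g B) refl refl = +-mono-≤ (𝟙≤1 (F? P v)) (≤-reflexive (∑-zero ws″ λ {c} c∈ → 𝟙-no (F? P c) (none c∈)))
            where
            -- `t` has no gap after it, so the invariant admits it separately.
            C : V → Set
            C c = c ≡ t ⊎ H P c
            startC : C v
            startC with cover (cut (pt v) v◂g r◂g B refl refl)
            ... | inj₂ hv = inj₂ hv
            ... | inj₁ fr with second-start P v◂g r◂g B refl refl fr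
            ...   | inj₁ lpv = ⊥-elim (noV lpv)
            ...   | inj₂ (lpr , s~r) = ⊥-elim (noR (cut (pt v) v◂g r◂g B refl refl) fr lpr s~r)
            H-before : (X : PCut P) → C (Cut.p X) → H P (Cut.p X)
            H-before X (inj₁ p≡t) = ⊥-elim (p≢t P X p≡t)
            H-before X (inj₂ hp) = hp
            onward : (X : PCut P) → C (Cut.p X) → C (Cut.q X)
            onward (cut A p◂ q◂ (pt _) vs≡ es≡) cp = inj₁ refl
            onward X@(cut {g = g} {vs₁} {es₁ = es₁} A p◂ q◂ (step {a = q} {e = g′} {vs = ws‴} {fs‴} q◂′ r◂ B′) vs≡ es≡) cp with cover X′
              where
              X′ : PCut P
              X′ = cut (join A p◂ q◂ (pt q)) q◂′ r◂ B′ (trans vs≡ (sym (++-assoc vs₁ [ q ] ws‴))) (trans es≡ (sym (++-assoc es₁ [ g ] (g′ ∷ fs‴))))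
            ... | inj₂ hq = inj₂ hq
            ... | inj₁ fr with next-start P A p◂ q◂ q◂′ r◂ B′ vs≡ es≡ (H-before X cp) fr
            ...   | lpr , s~r = ⊥-elim (noR (cut (join A p◂ q◂ (pt q)) q◂′ r◂ B′ (trans vs≡ (sym (++-assoc vs₁ [ q ] ws‴))) (trans es≡ (sym (++-assoc es₁ [ g ] (g′ ∷ fs‴))))) fr lpr s~r)
            allC : ∀ {c} → c ∈ LP.ws P → C c
            allC = propagate {P = C} R onward startC
            none : ∀ {c} → c ∈ ws″ → ¬ F P c
            none {c} c∈ fc with cutV R (there c∈)
            ... | inj₁ refl = head∉ (tl-unique P) c∈
            ... | inj₂ (X , refl) = crossing P X fc (H-before X (allC (subst (Cut.p X ∈_) (sym (Cut.vs≡ X)) (∈-++⁺ˡ (end∈ (Cut.left X))))))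

        third : ∀ {s t} (P : LP s t) → α P < deg s → ∃ λ u → u ∈ U × u ◂ h₁ P × u ≢ s × u ≢ v₁ P
        third P lt = count-witness (third? P) U (+-cancelˡ-≤ (α P) 1 _ (≤-trans (≤-reflexive (+-comm (α P) 1)) (≤-trans lt (deg≤α+σ P))))

      swap-start : ∀ {s t} (P : LP s t) {u} → u ∈ U → u ◂ h₁ P → u ∉ ws P → LP u t
      swap-start P u∈ u◂ u∉ = lp u◂ (v₁◂ P) (tl P) (Good-∷ u∈ u∉ (good ([ _ ] ∷ ws P ∷ []) `1 (`0 ⊕ `1) (gdP P))) (ueP P) (lnP P)

      -- The way degree bounds stop rotations: ends of longest paths will have too small a degree to
      -- be adjacent.
      Blocked : V → V → Set
      Blocked s t = ∀ {s′} → LP s′ t → Adj s s′ → ⊥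

      opaque
        blocked-third : ∀ {s t} (P : LP s t) → Blocked s t → α P < deg s → ∃ λ u → u ∈ ws P × u ◂ h₁ P × u ≢ v₁ P
        blocked-third P blocked lt with third P lt
        ... | u , u∈U , uh , u≢s , u≢v with u ∈ⱽ? ws P
        ...   | yes u∈ = u , u∈ , uh , u≢v
        ...   | no u∉ = ⊥-elim (blocked (swap-start P u∈U uh u∉) (u≢s ∘ sym , _ , s◂ P , uh))

        -- `no-closing` keeps the third vertex of the first hyperedge away from `t`, and linearity
        -- keeps it from being the vertex after v₁.
        far-third : ∀ {s t} (P : LP s t) {u} → u ∈ ws P → u ◂ h₁ P → u ≢ v₁ P → u ≢ t × ∃₂ λ r g → ∃₂ λ ws′ fs′ →
                    v₁ P ◂ g × r ◂ g × Seg r t ws′ fs′ × ws P ≡ v₁ P ∷ ws′ × fs P ≡ g ∷ fs′ × u ∈ ws′ × r ≢ u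
        far-third {s} {t} P@(lp {v} {h} s◂ v◂ R gd ue ln) {u} u∈ uh u≢v = u≢t , go R refl refl u∈
          where
          u≢t : u ≢ t
          u≢t refl = no-closing P ((λ { refl → head∉ (proj₁ gd) u∈ }) , h , s◂ , uh)
          go : ∀ {ws₁ fs₁} → Seg v t ws₁ fs₁ → ws P ≡ ws₁ → fs P ≡ fs₁ → u ∈ ws₁ → ∃₂ λ r g → ∃₂ λ ws′ fs′ →
               v ◂ g × r ◂ g × Seg r t ws′ fs′ × ws P ≡ v ∷ ws′ × fs P ≡ g ∷ fs′ × u ∈ ws′ × r ≢ u
          go (pt _) _ _ (here u≡v) = ⊥-elim (u≢v u≡v)
          go (step _ _ _) _ _ (here u≡v) = ⊥-elim (u≢v u≡v)
          go (step v◂g r◂g B) refl refl (there u∈′) = _ , _ , _ , _ , v◂g , r◂g , B , refl , refl , u∈′ ,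
            λ { refl → head∉ ue (here (linear (u≢v ∘ sym) v◂ uh v◂g r◂g)) }

        -- Since α ≥ κ - 1, no gap is empty. If α < κ, the third vertex of the first hyperedge lies
        -- on the path, and `walk` gives α ≤ 1. Then κ ≤ 2 and K ≤ 3, but the position of that third
        -- vertex requires ℓ ≥ 4.
        one-sided : ∀ {s t κ} → 1 + K ≡ 2 * κ → (P : LP s t) → κ ≤ β P → κ ≤ deg s → Blocked s t → ⊥
        one-sided {s} {t} {κ} K≡ P β≥ d≥ blocked with κ ≤? α P
        ... | yes α≥ = <-irrefl refl (begin-strict
            ℓ          ≤⟨ ℓ≤K ⟩
            K          <⟨ ≤-refl ⟩
            1 + K      ≡⟨ trans K≡ (cong (κ +_) (+-identityʳ κ)) ⟩
            κ + κ      ≤⟨ +-mono-≤ α≥ β≥ ⟩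
            α P + β P  ≤⟨ α+β≤ℓ P ⟩
            ℓ          ∎)
            where open ≤-Reasoning
        ... | no α≱ with blocked-third P blocked (<-≤-trans (≰⇒> α≱) d≥)
        ...   | u , u∈ , uh , u≢v with far-third P u∈ uh u≢v
        ...     | u≢t , r , g , ws′ , fs′ , v◂g , r◂g , B , vs≡ , _ , u∈′ , r≢u = <-irrefl refl (begin-strict
            ℓ              ≤⟨ ℓ≤K ⟩
            K              <⟨ s≤s ≤-refl ⟩
            1 + K          ≡⟨ trans K≡ (cong (κ +_) (+-identityʳ κ)) ⟩
            κ + κ          ≤⟨ +-mono-≤ κ≤2 κ≤2 ⟩
            4              ≤⟨ s≤s (three B u∈′) ⟩
            suc (length ws′) ≡⟨ cong length (sym vs≡) ⟩
            length (ws P)  ≡⟨ lnP P ⟩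
            ℓ              ∎)
            where
            open ≤-Reasoning
            s≁v : Adj s (v₁ P)
            s≁v = s≢v₁ P , _ , s◂ P , v₁◂ P
            K≤ : 1 + K ≤ suc (α P + β P)
            K≤ = begin
              1 + K            ≡⟨ trans K≡ (cong (κ +_) (+-identityʳ κ)) ⟩
              κ + κ            ≤⟨ +-mono-≤ κ≤1+α β≥ ⟩
              suc (α P) + β P  ∎
              where
              κ≤1+α : κ ≤ suc (α P)
              κ≤1+α = ≤-trans d≥ (≤-trans (deg≤α+σ P) (≤-trans (+-monoʳ-≤ (α P) (σ≤1 P)) (≤-reflexive (+-comm (α P) 1))))
            α≤1 : α P ≤ 1
            α≤1 = walk P (tight P (≤-trans ℓ≤K (≤-pred K≤))) (λ lpv → blocked lpv s≁v) (λ _ _ lpq s~q → blocked lpq s~q)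
            κ≤2 : κ ≤ 2
            κ≤2 = ≤-trans d≥ (≤-trans (deg≤α+σ P) (+-mono-≤ α≤1 (σ≤1 P)))
            three : ∀ {ws₁ fs₁} → Seg r t ws₁ fs₁ → u ∈ ws₁ → 3 ≤ length ws₁
            three (pt _) (here refl) = ⊥-elim (r≢u refl)
            three (step _ _ _) (here refl) = ⊥-elim (r≢u refl)
            three (step _ _ (pt _)) (there (here refl)) = ⊥-elim (u≢t refl)
            three (step _ _ (step _ _ S)) (there _) with head-Seg S
            ... | _ , refl = s≤s (s≤s (s≤s z≤n))

        lastStep-edge : ∀ x f vs es → proj₂ (lastStep x f vs es) ∈ f ∷ es
        lastStep-edge x f [] es = here refl
        lastStep-edge x f (v ∷ vs) [] = here refl
        lastStep-edge x f (v ∷ vs) (e ∷ es) = there (lastStep-edge v e vs es)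

        -- Both counts may be κ - 1, which only gives α + β ≥ K - 1. But two gaps are empty, the one
        -- after v₁ and the one before the third vertex of the first hyperedge, so α + β ≤ ℓ - 2.
        two-sided : ∀ {s t κ} → 1 + K ≡ 2 * κ → (P : LP s t) → κ ≤ deg s → α P < κ → κ ≤ 1 + β P → Blocked s t → Blocked t s → ⊥
        two-sided {s} {t} {κ} K≡ P@(lp {v} {h} s◂ v◂ R gd ue ln) d≥ α< β≥ blocked blocked′
          with blocked-third P blocked (<-≤-trans α< d≥)
        ... | u , u∈ , uh , u≢v with far-third P u∈ uh u≢v
        ...   | u≢t , r , g , ws′ , fs′ , v◂g , r◂g , B , refl , refl , u∈′ , r≢u with cutV B u∈′
        ...     | inj₁ r≡u = r≢u r≡u
        ...     | inj₂ (Y , refl) = <-irrefl refl (begin-strict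
            ℓ                                              ≤⟨ ℓ≤K ⟩
            K                                              <⟨ ≤-refl ⟩
            1 + K                                          ≡⟨ trans K≡ (cong (κ +_) (+-identityʳ κ)) ⟩
            κ + κ                                          ≤⟨ +-mono-≤ κ≤1+α β≥ ⟩
            suc (ff v + Fs) + suc (hh v + Hs)              ≡⟨ lemma (ff v) (hh v) Fs Hs ⟩
            suc (ff v) + hh v + suc (Fs + Hs)              ≤⟨ +-mono-≤ (+-mono-≤ (s≤s (𝟙≤1 (F? P v))) (≤-reflexive (𝟙-no (H? P v) ¬hv)))
                                                                (deficit ff hh (λ X → each≤1 P (stepCut v◂g r◂g X)) Y (cong₂ _+_ (𝟙-no (F? P (Cut.q Y)) ¬fu) (𝟙-no (H? P (Cut.p Y)) ¬hp))) ⟩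
            2 + 0 + (length fs′ + (ff r + hh t))           ≡⟨ cong₂ (λ i j → 2 + 0 + (length fs′ + (i + j))) (𝟙-no (F? P r) ¬fr) (𝟙-no (H? P t) (H≁t P)) ⟩
            2 + 0 + (length fs′ + 0)                       ≡⟨ cong (2 +_) (+-identityʳ _) ⟩
            2 + length fs′                                 ≡⟨ ∣fs∣ P ⟩
            ℓ                                              ∎)
            where
            open ≤-Reasoning
            ff hh : V → ℕ
            ff w = 𝟙 (F? P w)
            hh w = 𝟙 (H? P w)
            Fs Hs : ℕ
            Fs = ∑ ff ws′
            Hs = ∑ hh ws′
            lemma : ∀ x y z w → 1 + (x + z) + (1 + (y + w)) ≡ 1 + x + y + (1 + (z + w))
            lemma = solve-∀
            κ≤1+α : κ ≤ suc (α P)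
            κ≤1+α = ≤-trans d≥ (≤-trans (deg≤α+σ P) (≤-trans (+-monoʳ-≤ (α P) (σ≤1 P)) (≤-reflexive (+-comm (α P) 1))))
            s~v : Adj s v
            s~v = s≢v₁ P , h , s◂ , v◂
            gap-u : ¬ F P (Cut.q Y) × ¬ H P (Cut.p Y)
            gap-u with zipAt P (stepCut v◂g r◂g Y)
            ... | Z , refl , refl , first≡ , last≡ , _ with special Z (subst (λ vh → Zip.q Z ◂ proj₂ vh) (sym first≡) uh) (u≢v ∘ λ eq → trans eq (cong proj₁ first≡))
            ...   | ¬n₀ , onlyNext = (λ fu → ¬n₀ (subst (λ vh → Star s vh (Zip.q Z)) (sym first≡) fu)) ,
                      λ hp → case onlyNext (subst (λ vh → Star t vh (Zip.p Z)) (sym last≡) hp) of λ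
                        { (f , tf , pf , next) → blocked′ (start-next (flip Z) tf next) (Star⇒Adj hp) }
            ¬fu : ¬ F P (Cut.q Y)
            ¬fu = proj₁ gap-u
            ¬hp : ¬ H P (Cut.p Y)
            ¬hp = proj₂ gap-u
            ¬fr : ¬ F P r
            ¬fr fr with second-start P v◂g r◂g B refl refl fr
            ... | inj₁ lpv = blocked lpv s~v
            ... | inj₂ (lpr , s~r) = blocked lpr s~r
            -- If `t` were on `g`, it would see `r` as well. As the path uses `g` just before `r`,
            -- rotating from the side of `t` would produce a longest path starting at `r`, a
            -- neighbour of `t`.
            r-mid : ∀ {ws₁ fs₁} → Seg r t ws₁ fs₁ → ws′ ≡ ws₁ → fs′ ≡ fs₁ → t ◂ g → ⊥
            r-mid (pt _) refl refl _ = case u∈′ of λ { (here refl) → r≢u refl ; (there ()) }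
            r-mid (step {e = g₃} {vs = ws₃} {fs₃} r◂₃ r₃◂ B₃) refl refl tg = case via (flip Z) t*r of λ
                { (f , tf , rf , inj₂ next) → blocked′ (start-next (flip Z) tf next) (Star⇒Adj t*r)
                ; (f , tf , rf , inj₁ f∉) → f∉ (∈-++⁺ʳ fs₃ (here (linear r≢t rf tf r◂g tg))) }
              where
              ρ : Vec (List V) 4
              ρ = [ s ] ∷ [ v ] ∷ [ r ] ∷ ws₃ ∷ []
              Z : Zip s t
              Z = zip (step r◂g v◂g (step v◂ s◂ (pt s))) r◂₃ r₃◂ B₃ (good ρ ((`2 ⊕ `1 ⊕ `0) ⊕ `3) (`0 ⊕ `1 ⊕ `2 ⊕ `3) gd)
                    (uniq ([ h ] ∷ [ g ] ∷ [ g₃ ] ∷ fs₃ ∷ []) (`2 ⊕ (`1 ⊕ `0) ⊕ `3) (`0 ⊕ `1 ⊕ `2 ⊕ `3) ue) (cong suc ln)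
              r≢t : r ≢ t
              r≢t refl = head∉ (tail-unique (tl-unique P)) (end∈ B₃)
              t*r : Star t (end P) r
              t*r = r≢t ∘ sym , g , tg , r◂g , λ g≡ → ⊥-elim (head∉ (tail-unique ue) (subst (_∈ g₃ ∷ fs₃) (sym g≡) (lastStep-edge r g₃ ws₃ fs₃)))
            ¬hv : ¬ H P v
            ¬hv hv = case via (flip Z) hv of λ
                { (f , tf , vf , inj₂ (nxt _ _ _ refl)) → no-closing P (s≢t , h , s◂ , tf)
                ; (f , tf , vf , inj₁ f∉) → across f tf vf f∉ }
              where
              s≢t : s ≢ t
              s≢t refl = head∉ (proj₁ gd) (end∈ R)
              Z : Zip s t
              Z = zip (step v◂ s◂ (pt s)) v◂g r◂g B (good ([ s ] ∷ [ v ] ∷ ws′ ∷ []) ((`1 ⊕ `0) ⊕ `2) (`0 ⊕ `1 ⊕ `2) gd)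
                    (uniq ([ h ] ∷ [ g ] ∷ fs′ ∷ []) (`1 ⊕ `0 ⊕ `2) (`0 ⊕ `1 ⊕ `2) ue) (cong suc ln)
              across : ∀ f → t ◂ f → v ◂ f → f ∉ fs′ ++ [ h ] → ⊥
              across f tf vf f∉ with f ≟ᴱ g
              ... | yes refl = r-mid B refl refl tf
              ... | no f≢g = no-near-cycle (cyc R vf tf (good ([ s ] ∷ (v ∷ ws′) ∷ []) `1 (`0 ⊕ `1) gd)
                               (uniq-∷ (λ { (here f≡g) → f≢g f≡g ; (there f∈) → f∉ (∈-++⁺ˡ f∈) }) (tail-unique ue))) ln

        longer : ∀ {κ} → 1 + K ≡ 2 * κ → ∀ {s t} (P : LP s t) → κ ≤ α P → κ ≤ β P → ⊥
        longer {κ} K≡ P α≥ β≥ = <-irrefl refl (begin-strict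
            ℓ          ≤⟨ ℓ≤K ⟩
            K          <⟨ ≤-refl ⟩
            1 + K      ≡⟨ trans K≡ (cong (κ +_) (+-identityʳ κ)) ⟩
            κ + κ      ≤⟨ +-mono-≤ α≥ β≥ ⟩
            α P + β P  ≤⟨ α+β≤ℓ P ⟩
            ℓ          ∎)
          where open ≤-Reasoning

        s∈U : ∀ {s t} → LP s t → s ∈ U
        s∈U P = ∈U (gdP P) (here refl)

        t∈U : ∀ {s t} → LP s t → t ∈ U
        t∈U P = ∈U (gdP P) (there (end∈ (tl P)))

        deg≤1+α : ∀ {s t} (P : LP s t) → deg s ≤ suc (α P)
        deg≤1+α P = ≤-trans (deg≤α+σ P) (≤-trans (+-monoʳ-≤ (α P) (σ≤1 P)) (≤-reflexive (+-comm (α P) 1)))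

        deg≤1+β : ∀ {s t} (P : LP s t) → deg t ≤ suc (β P)
        deg≤1+β P = ≤-trans (deg≤1+α back) (≤-reflexive (cong suc α≡))
          where open Reversal (reversal P)

      -- K odd, that is k even: minimum degree (K + 1) / 2

      module Even {κ} (K≡ : 1 + K ≡ 2 * κ) where

        opaque
          κ≤deg : ∀ {v} → v ∈ U → κ ≤ deg v
          κ≤deg v∈ = *-cancelˡ-≤ 2 (≤-trans (≤-reflexive (sym K≡)) (deg-min v∈))

          -- 2 κ = K + 1 is one short of the bound for an edge.
          low-apart : ∀ {x y} → x ∈ U → y ∈ U → deg x ≤ κ → deg y ≤ κ → ¬ Adj x y
          low-apart x∈ y∈ dx dy x~y = <-irrefl refl (begin-strict
            2 * κ          ≡⟨ sym K≡ ⟩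
            1 + K          <⟨ ≤-refl ⟩
            2 + K          ≤⟨ deg-edge x∈ y∈ x~y ⟩
            deg _ + deg _  ≤⟨ +-mono-≤ dx dy ⟩
            κ + κ          ≡⟨ cong (κ +_) (sym (+-identityʳ κ)) ⟩
            2 * κ          ∎)
            where open ≤-Reasoning

          some-low : ∀ {s t} → LP s t → κ < deg s → κ < deg t → ⊥
          some-low P ds dt = longer K≡ P (≤-pred (≤-trans ds (deg≤1+α P))) (≤-pred (≤-trans dt (deg≤1+β P)))

          -- If t had larger degree, then β ≥ κ, and by `some-low` all starts of longest paths to t
          -- would have degree at most κ. No two of these are adjacent, so `one-sided` applies.
          end-low : ∀ {s t} → LP s t → deg t ≤ κ
          end-low {s} {t} P with deg t ≤? κ
          ... | yes le = le
          ... | no nle = ⊥-elim (one-sided K≡ P (≤-pred (≤-trans (≰⇒> nle) (deg≤1+β P))) (κ≤deg (s∈U P))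
                λ P′ → low-apart (s∈U P) (s∈U P′) (start-low P) (start-low P′))
            where
            start-low : ∀ {s′} → LP s′ t → deg s′ ≤ κ
            start-low P′ = ≮⇒≥ λ lt → some-low P′ lt (≰⇒> nle)

          no-path : ∀ {s t} → LP s t → ⊥
          -- All ends of longest paths now have minimum degree, so rotations are blocked on both
          -- sides.
          no-path {s} {t} P with κ ≤? α P | κ ≤? β P
          ... | _ | yes β≥ = one-sided K≡ P β≥ (κ≤deg (s∈U P)) blocked
            where
            blocked : Blocked s t
            blocked P′ = low-apart (s∈U P) (s∈U P′) (end-low (Reversal.back (reversal P))) (end-low (Reversal.back (reversal P′)))
          ... | yes α≥ | no _ = one-sided K≡ back (≤-trans α≥ (≤-reflexive (sym β≡))) (κ≤deg (t∈U P)) blocked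
            where
            open Reversal (reversal P)
            blocked : Blocked t s
            blocked P′ = low-apart (t∈U P) (s∈U P′) (end-low P) (end-low (Reversal.back (reversal P′)))
          ... | no α≱ | no β≱ = two-sided K≡ P (κ≤deg (s∈U P)) (≰⇒> α≱) (≤-trans (κ≤deg (t∈U P)) (deg≤1+β P))
                (λ P′ → low-apart (s∈U P) (s∈U P′) (end-low (Reversal.back (reversal P))) (end-low (Reversal.back (reversal P′))))
                (λ P′ → low-apart (t∈U P) (s∈U P′) (end-low P) (end-low (Reversal.back (reversal P′))))

      -- K even, that is k odd: minimum degree K / 2 + 1

      module Odd {r : ℕ} (K≡ : K ≡ 2 * r) where

        opaque
          r<deg : ∀ {v} → v ∈ U → r < deg v
          r<deg v∈ = *-cancelˡ-< 2 _ _ (≤-trans (s≤s (≤-reflexive (sym K≡))) (deg-min v∈))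

          r≥2 : 2 ≤ r
          r≥2 with r ≤? 1
          ... | no nle = ≰⇒> nle
          ... | yes le = ⊥-elim (<-irrefl refl (≤-trans K≥3 (≤-trans (≤-reflexive K≡) (*-monoʳ-≤ 2 le))))

          α≥r : ∀ {s t} (P : LP s t) → r ≤ α P
          α≥r P = ≤-pred (≤-trans (r<deg (s∈U P)) (deg≤1+α P))

          β≥r : ∀ {s t} (P : LP s t) → r ≤ β P
          β≥r P = ≤-pred (≤-trans (r<deg (t∈U P)) (deg≤1+β P))

          ℓ≤2r : ℓ ≤ r + r
          ℓ≤2r = ≤-trans ℓ≤K (≤-reflexive (trans K≡ (cong (r +_) (+-identityʳ r))))

          -- Equality throughout: α and β are at least r each, and their sum is at most ℓ ≤ 2 r.
          cover : ∀ {s t} (P : LP s t) (X : PCut P) → F P (Cut.q X) ⊎ H P (Cut.p X)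
          cover P = tight P (≤-trans ℓ≤2r (+-mono-≤ (α≥r P) (β≥r P)))

          α≤r : ∀ {s t} (P : LP s t) → α P ≤ r
          α≤r P = +-cancelʳ-≤ r _ _ (≤-trans (+-monoʳ-≤ (α P) (β≥r P)) (≤-trans (α+β≤ℓ P) ℓ≤2r))

          start-low : ∀ {s t} → LP s t → deg s ≤ suc r
          start-low P = ≤-trans (deg≤1+α P) (s≤s (α≤r P))

          -- Starts of longest paths have degree at most r + 1, and three such degrees do not exceed
          -- the value that `deg-triangle` requires to be exceeded.
          no-triangle : ∀ {a b c t} → LP a t → LP b t → LP c t → Adj a b → Adj a c → Adj b c → ⊥
          no-triangle {a} {b} {c} A B C a~b a~c b~c = <-irrefl refl (begin-strict
            3 * K + 6                       <⟨ deg-triangle (s∈U A) (s∈U B) (s∈U C) a~b a~c b~c ⟩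
            2 * (deg a + deg b + deg c)     ≤⟨ *-monoʳ-≤ 2 (+-mono-≤ (+-mono-≤ (start-low A) (start-low B)) (start-low C)) ⟩
            2 * (suc r + suc r + suc r)     ≡⟨ lemma r ⟩
            3 * (2 * r) + 6                 ≡⟨ cong (λ n → 3 * n + 6) (sym K≡) ⟩
            3 * K + 6                       ∎)
            where
            open ≤-Reasoning
            lemma : ∀ n → 2 * ((1 + n) + (1 + n) + (1 + n)) ≡ 3 * (2 * n) + 6
            lemma = solve-∀

          -- In `B` the gap is occupied from the start, so t does not see p. As `A` ends with the
          -- same step, its gap must be occupied from the start as well.
          shared-gap : ∀ {a b t} (A : LP a t) (B : LP b t) (X : PCut A) (Y : PCut B) → Cut.p X ≡ Cut.p Y → Cut.q X ≡ Cut.q Y →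
                       end A ≡ end B → F B (Cut.q Y) → Adj a (Cut.q X)
          shared-gap {t = t} A B X Y p≡ q≡ end≡ fq with cover A X
          ... | inj₁ fq′ = Star⇒Adj fq′
          ... | inj₂ hp = ⊥-elim (crossing B Y fq (subst (Star t (end B)) p≡ (subst (λ vh → Star t vh (Cut.p X)) end≡ hp)))

          -- The third vertex u exists because α ≤ r < deg s. Were it off the path, it could replace
          -- s, and every new start met by `walk` would form a triangle with s and u. Hence α ≤ 1 <
          -- r, a contradiction.
          third-inside : ∀ {s t} (P : LP s t) → ∃ λ u → u ∈ ws P × u ◂ h₁ P × u ≢ s × u ≢ v₁ P
          third-inside {s} {t} P with third P (<-≤-trans (s≤s (α≤r P)) (r<deg (s∈U P)))
          ... | u , u∈U , uh , u≢s , u≢v with u ∈ⱽ? ws P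
          ...   | yes u∈ = u , u∈ , uh , u≢s , u≢v
          ...   | no u∉ = ⊥-elim (<-irrefl refl (≤-trans r≥2 (≤-trans (α≥r P) (walk P (cover P) noV noR))))
            where
            Pᵤ : LP u t
            Pᵤ = swap-start P u∈U uh u∉
            s~u : Adj s u
            s~u = u≢s ∘ sym , _ , s◂ P , uh
            same-end : ∀ {v ws₁ fs₁ f} → Seg v t ws₁ fs₁ → length ws₁ ≡ ℓ → lastStep u f ws₁ fs₁ ≡ lastStep s f ws₁ fs₁
            same-end (pt _) ln = ⊥-elim (<-irrefl refl (≤-trans ℓ≥2 (≤-reflexive (sym ln))))
            same-end (step _ _ _) _ = refl
            noV : LP (v₁ P) t → ⊥
            noV Pᵥ = no-triangle P Pᵤ Pᵥ s~u (s≢v₁ P , _ , s◂ P , v₁◂ P) (u≢v , _ , uh , v₁◂ P)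
            noR : (X : PCut P) → F P (Cut.q X) → LP (Cut.q X) t → Adj s (Cut.q X) → ⊥
            noR X fq Q s~q = no-triangle P Pᵤ Q s~u s~q (shared-gap Pᵤ P X X refl refl (same-end (tl P) (lnP P)) fq)

          -- The gap after the third vertex of the last hyperedge is not occupied from t. So s sees
          -- q, and by `special` only through the hyperedge by which the path leaves q.
          following : ∀ {s t} (P : LP s t) (X : PCut P) → Cut.p X ◂ proj₂ (end P) → Cut.p X ≢ proj₁ (end P) →
                      ∃ λ e → ∃₂ λ q′ ws′ → ∃ λ fs′ → s ◂ e × Cut.q X ◂ e × q′ ◂ e × Seg q′ t ws′ fs′ ×
                      Cut.vs₂ X ≡ Cut.q X ∷ ws′ × Cut.es₂ X ≡ e ∷ fs′
          following {s} {t} P X pe p≢ with zipAt P X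
          ... | Z , refl , refl , first≡ , last≡ , vs≡ , es≡
            with special (flip Z) (subst (λ vh → Zip.p Z ◂ proj₂ vh) (sym last≡) pe) (λ eq → p≢ (trans eq (cong proj₁ last≡))) | cover P X
          ...   | ¬n₁ , _        | inj₂ hp = ⊥-elim (¬n₁ (subst (λ vh → Star t vh (Zip.p Z)) (sym last≡) hp))
          ...   | _   , onlyNext | inj₁ fq with onlyNext (subst (λ vh → Star s vh (Zip.q Z)) (sym first≡) fq)
          ...     | e , se , qe , nxt q′e R′ vsR≡ esR≡ = e , _ , _ , _ , se , qe , q′e , R′ , trans (sym vs≡) vsR≡ , trans (sym es≡) esR≡

          second-edge : ∀ {q t p p₂ g f ws fs} (q◂ : q ◂ g) (p◂ : p ◂ g) (p◂f : p ◂ f) (p₂◂f : p₂ ◂ f) (S : Seg p₂ t ws fs) →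
                        Good (q ∷ p ∷ ws) → Unique (g ∷ f ∷ fs) → suc (length ws) ≡ ℓ →
                        p ◂ proj₂ (lastStep p f ws fs) → p ≢ proj₁ (lastStep p f ws fs) →
                        ∃ λ k → ∃ λ fs′ → q ◂ k × fs ≡ k ∷ fs′
          second-edge q◂ p◂ p◂f p₂◂f S gd ue ln pe p≢
            with following (lp q◂ p◂ (step p◂f p₂◂f S) gd ue ln) (cut (pt _) p◂f p₂◂f S refl refl) pe p≢
          ... | k , _ , _ , fs′ , qk , _ , _ , _ , _ , fs≡ = k , fs′ , qk , fs≡

        module _ {s t p p₂ p₃ q q′ e f g k ws′ fs′} (p◂f : p ◂ f) (p₂◂f : p₂ ◂ f) (p₂◂k : p₂ ◂ k) (p₃◂k : p₃ ◂ k)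
                 (p◂g : p ◂ g) (q◂g : q ◂ g) (s◂e : s ◂ e) (q◂e : q ◂ e) (q′◂e : q′ ◂ e) (R : Seg q′ t ws′ fs′) where

          opaque
            -- The rotated path starts q, p, p₂, p₃ and keeps its last step, so `p` is again the
            -- third vertex of the last hyperedge, and `following` at the gap after p puts `q` on
            -- `k`.
            through : ∀ {vs es} → Seg p₃ s vs es → Good (p ∷ p₂ ∷ vs ++ q ∷ ws′) → Unique (g ∷ f ∷ k ∷ es ++ e ∷ fs′) →
                      length (p ∷ p₂ ∷ vs ++ q ∷ ws′) ≡ suc ℓ →
                      p ◂ proj₂ (lastStep s e ws′ fs′) → p ≢ proj₁ (lastStep s e ws′ fs′) → q ◂ k
            through {vs} {es} L gd ue ln pe p≢ with second-edge q◂g p◂g p◂f p₂◂f (step p₂◂k p₃◂k (join L s◂e q′◂e R))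
                (good ρ (`3 ⊕ `0 ⊕ `1 ⊕ `2 ⊕ `4) (`0 ⊕ `1 ⊕ `2 ⊕ `3 ⊕ `4) gd) ue
                (suc-injective (trans (len ρ (`0 ⊕ `1 ⊕ `2 ⊕ `3 ⊕ `4) (`3 ⊕ `0 ⊕ `1 ⊕ `2 ⊕ `4)) ln))
                (subst (λ vh → p ◂ proj₂ vh) (sym (lastStep-join L)) pe) (λ eq → p≢ (trans eq (cong proj₁ (lastStep-join L))))
              where
              ρ : Vec (List V) 5
              ρ = [ p ] ∷ [ p₂ ] ∷ vs ∷ [ q ] ∷ ws′ ∷ []
            ... | _ , _ , qk , refl = qk

            -- Once `q` lies on `k`, the order p₂, p, q, p₃ is possible too. The starts s, q, p₂ are
            -- pairwise adjacent: through `e`, through `k`, and by `shared-gap` at the gap before s.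
            rotations : ∀ {v h vs es} → Seg p₃ v vs es → v ◂ h → s ◂ h → q ◂ k → Good (p ∷ p₂ ∷ (vs ++ [ s ]) ++ q ∷ ws′) →
                        Unique (g ∷ f ∷ k ∷ (es ++ [ h ]) ++ e ∷ fs′) → length (p ∷ p₂ ∷ (vs ++ [ s ]) ++ q ∷ ws′) ≡ suc ℓ → LP s t → ⊥
            rotations {v} {h} {vs} {es} L v◂h s◂h q◂k gd ue ln P =
              no-triangle P₃ Q P (p₂≢q , k , p₂◂k , q◂k) (shared-gap P₃ Q X₃ XQ refl refl end≡ s-star) (q≢s , e , q◂e , s◂e)
              where
              ρ : Vec (List V) 6
              ρ = [ p ] ∷ [ p₂ ] ∷ vs ∷ [ s ] ∷ [ q ] ∷ ws′ ∷ []
              τ : Vec (List E) 7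
              τ = [ g ] ∷ [ f ] ∷ [ k ] ∷ es ∷ [ h ] ∷ [ e ] ∷ fs′ ∷ []
              tail : Seg p₃ t (vs ++ s ∷ ws′) (es ++ h ∷ e ∷ fs′)
              tail = join L v◂h s◂h (step s◂e q′◂e R)
              Q : LP q t
              Q = lp q◂g p◂g (step p◂f p₂◂f (step p₂◂k p₃◂k tail)) (good ρ (`4 ⊕ `0 ⊕ `1 ⊕ `2 ⊕ `3 ⊕ `5) (`0 ⊕ `1 ⊕ (`2 ⊕ `3) ⊕ `4 ⊕ `5) gd)
                    (uniq τ (`0 ⊕ `1 ⊕ `2 ⊕ `3 ⊕ `4 ⊕ `5 ⊕ `6) (`0 ⊕ `1 ⊕ `2 ⊕ (`3 ⊕ `4) ⊕ `5 ⊕ `6) ue)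
                    (suc-injective (trans (len ρ (`0 ⊕ `1 ⊕ (`2 ⊕ `3) ⊕ `4 ⊕ `5) (`4 ⊕ `0 ⊕ `1 ⊕ `2 ⊕ `3 ⊕ `5)) ln))
              P₃ : LP p₂ t
              P₃ = lp p₂◂f p◂f (step p◂g q◂g (step q◂k p₃◂k tail)) (good ρ (`1 ⊕ `0 ⊕ `4 ⊕ `2 ⊕ `3 ⊕ `5) (`0 ⊕ `1 ⊕ (`2 ⊕ `3) ⊕ `4 ⊕ `5) gd)
                     (uniq τ (`1 ⊕ `0 ⊕ `2 ⊕ `3 ⊕ `4 ⊕ `5 ⊕ `6) (`0 ⊕ `1 ⊕ `2 ⊕ (`3 ⊕ `4) ⊕ `5 ⊕ `6) ue)
                     (suc-injective (trans (len ρ (`0 ⊕ `1 ⊕ (`2 ⊕ `3) ⊕ `4 ⊕ `5) (`1 ⊕ `0 ⊕ `4 ⊕ `2 ⊕ `3 ⊕ `5)) ln))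
              XQ : PCut Q
              XQ = cut (step p◂f p₂◂f (step p₂◂k p₃◂k L)) v◂h s◂h (step s◂e q′◂e R) refl refl
              X₃ : PCut P₃
              X₃ = cut (step p◂g q◂g (step q◂k p₃◂k L)) v◂h s◂h (step s◂e q′◂e R) refl refl
              end≡ : end P₃ ≡ end Q
              end≡ = trans (lastStep-join L) (sym (lastStep-join L))
              q≢s : q ≢ s
              q≢s q≡s = disjoint-++ (p ∷ p₂ ∷ vs ++ [ s ]) (proj₁ gd) (there (there (∈-++⁺ʳ vs (here refl)))) (here refl) (sym q≡s)
              p₂≢q : p₂ ≢ q
              p₂≢q = disjoint-++ (p ∷ p₂ ∷ vs ++ [ s ]) (proj₁ gd) (there (here refl)) (here refl)
              s-star : F Q s
              s-star = q≢s , e , q◂e , s◂e , λ { refl → ⊥-elim (head∉ ue (∈-++⁺ʳ (f ∷ k ∷ es ++ [ h ]) (here refl))) }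

        opaque
          rotate-twice : ∀ {s t q q′ g e p vsL esL ws′ fs′} → LP s t → Seg p s vsL esL → p ◂ g → q ◂ g → s ◂ e → q ◂ e → q′ ◂ e → Seg q′ t ws′ fs′ →
                         Good (vsL ++ q ∷ ws′) → Unique (g ∷ esL ++ e ∷ fs′) → length (vsL ++ q ∷ ws′) ≡ suc ℓ →
                         p ◂ proj₂ (lastStep s e ws′ fs′) → p ≢ proj₁ (lastStep s e ws′ fs′) → p ≢ s →
                         proj₁ (lastStep q g vsL esL) ≡ p
          rotate-twice _ (pt _) _ _ _ _ _ _ _ _ _ _ _ p≢s = ⊥-elim (p≢s refl)
          rotate-twice _ (step _ _ (pt _)) _ _ _ _ _ _ _ _ _ _ _ _ = refl
          -- Here `p₃` is `s` itself, and `k` and `e` would share both q and s.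
          rotate-twice {q = q} {g = g} {e} {p} P (step {b = p₂} {e = f} p◂f p₂◂f (step {e = k} p₂◂k s◂k (pt s))) p◂g q◂g s◂e q◂e q′◂e R gd ue ln p-end p≢ _ =
            ⊥-elim (disjoint-++ (f ∷ k ∷ []) (tail-unique ue) (there (here refl)) (here refl) (linear q≢s q◂k s◂k q◂e s◂e))
            where
            q≢s : q ≢ s
            q≢s q≡s = disjoint-++ (p ∷ p₂ ∷ s ∷ []) (proj₁ gd) (there (there (here refl))) (here refl) (sym q≡s)
            q◂k : q ◂ k
            q◂k = through p◂f p₂◂f p₂◂k s◂k p◂g q◂g s◂e q◂e q′◂e R (pt s) gd ue ln p-end p≢
          rotate-twice {s} {q = q} {g = g} {e} {p} {ws′ = ws′} {fs′} P (step {b = p₂} {e = f} p◂f p₂◂f (step {b = p₃} {e = k} p₂◂k p₃◂k L@(step {e = m} {vs} {es} x◂ y◂ S))) p◂g q◂g s◂e q◂e q′◂e R gd ue ln p-end p≢ _ =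
            ⊥-elim (rotations p◂f p₂◂f p₂◂k p₃◂k p◂g q◂g s◂e q◂e q′◂e R (LastView.init W) (LastView.v◂ W) (LastView.c◂ W)
              (through p◂f p₂◂f p₂◂k p₃◂k p◂g q◂g s◂e q◂e q′◂e R L gd ue ln p-end p≢)
              (subst (λ vs → Good (p ∷ p₂ ∷ vs ++ q ∷ ws′)) (LastView.vs≡ W) gd)
              (subst (λ es → Unique (g ∷ f ∷ k ∷ es ++ e ∷ fs′)) (LastView.es≡ W) ue)
              (trans (cong (λ vs → length (p ∷ p₂ ∷ vs ++ q ∷ ws′)) (sym (LastView.vs≡ W))) ln) P)
            where
            W : LastView (lastStep p₂ k (p₃ ∷ vs) (m ∷ es)) p₃ s (p₃ ∷ vs) (m ∷ es)
            W = step-view p₂ k x◂ y◂ S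

          second-vertex : ∀ {s t} (P : LP s t) (X : PCut P) → Cut.p X ◂ proj₂ (end P) → Cut.p X ≢ proj₁ (end P) → Cut.p X ≢ s → v₁ P ≡ Cut.p X
          second-vertex {s} {t} P X p-end p≢ p≢s with following P X p-end p≢ | zipAt P X
          ... | e , q′ , ws′ , fs′ , se , qe , q′e , R′ , refl , refl | zip L pg qg R gd ue ln , refl , refl , first≡ , last≡ , refl , refl =
            trans (cong proj₁ (sym first≡)) (rotate-twice P L pg qg se qe q′e R′ gd ue ln
              (subst (λ vh → _ ◂ proj₂ vh) (sym end-here) p-end) (λ eq → p≢ (trans eq (cong proj₁ end-here))) p≢s)
            where
            s≢t : s ≢ t
            s≢t refl = head∉ (proj₁ (gdP P)) (end∈ (tl P))
            same : ∀ {c ws₁ fs₁} → Seg q′ t ws₁ fs₁ → lastStep s e ws₁ fs₁ ≡ lastStep c e ws₁ fs₁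
            same (pt _) = ⊥-elim (no-closing P (s≢t , e , se , q′e))
            same (step _ _ _) = refl
            end-here : lastStep s e ws′ fs′ ≡ end P
            end-here = trans (same R′) last≡

          -- Otherwise, rotating the path twice produces three pairwise adjacent starting vertices of minimum degree.
          third-second : ∀ {s t} (P : LP s t) → v₁ P ◂ proj₂ (end P) × v₁ P ≢ proj₁ (end P)
          third-second {s} {t} P with third-inside (Reversal.back (reversal P))
          ... | u , u∈ , uh , u≢t , u≢v = locate (cutV (tl P) u∈ws)
            where
            open Reversal (reversal P)
            s≢t : s ≢ t
            s≢t refl = head∉ (proj₁ (gdP P)) (end∈ (tl P))
            u-end : u ◂ proj₂ (end P)
            u-end = subst (λ vh → u ◂ proj₂ vh) head≡ uh
            u≢ : u ≢ proj₁ (end P)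
            u≢ eq = u≢v (trans eq (cong proj₁ (sym head≡)))
            t-end : t ◂ proj₂ (end P)
            t-end = subst (λ vh → t ◂ proj₂ vh) head≡ (s◂ back)
            u∈ws : u ∈ ws P
            u∈ws with inner u∈
            ... | there u∈ = u∈
            ... | here refl = ⊥-elim (no-closing P (s≢t , _ , u-end , t-end))
            u≢s : u ≢ s
            u≢s refl = head∉ (proj₁ (gdP P)) u∈ws
            locate : v₁ P ≡ u ⊎ (Σ (PCut P) λ X → Cut.q X ≡ u) → v₁ P ◂ proj₂ (end P) × v₁ P ≢ proj₁ (end P)
            locate (inj₁ refl) = u-end , u≢
            locate (inj₂ (cut A p◂ q◂ (pt _) vs≡ es≡ , refl)) = ⊥-elim (u≢t refl)
            locate (inj₂ (cut {vs₁ = vs₁} {es₁ = es₁} A p◂ q◂ (step {e = g₂} {vs = vs₂} {es₂} q◂′ q₂◂ B) vs≡ es≡ , refl)) =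
              subst (_◂ proj₂ (end P)) (sym v≡u) u-end , λ eq → u≢ (trans (sym v≡u) eq)
              where
              v≡u : v₁ P ≡ u
              v≡u = second-vertex P (cut (join A p◂ q◂ (pt u)) q◂′ q₂◂ B (trans vs≡ (sym (++-assoc vs₁ [ u ] vs₂)))
                      (trans es≡ (sym (++-assoc es₁ [ _ ] (g₂ ∷ es₂))))) u-end u≢ u≢s

          -- By `third-second` for the path and its reversal, the second and the penultimate vertex
          -- lie on both the first and the last hyperedge. Linearity identifies these two, and the
          -- ends become adjacent.
          no-path : ∀ {s t} → LP s t → ⊥
          no-path {s} {t} P = no-closing P (s≢t , h₁ P , s◂ P , subst (t ◂_) (sym h≡) t-end)
            where
            open Reversal (reversal P)
            s≢t : s ≢ t
            s≢t refl = head∉ (proj₁ (gdP P)) (end∈ (tl P))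
            t-end : t ◂ proj₂ (end P)
            t-end = subst (λ vh → t ◂ proj₂ vh) head≡ (s◂ back)
            v◂end : v₁ P ◂ proj₂ (end P)
            v◂end = proj₁ (third-second P)
            v′◂end : proj₁ (end P) ◂ proj₂ (end P)
            v′◂end = subst (λ vh → proj₁ vh ◂ proj₂ vh) head≡ (v₁◂ back)
            v′◂h : proj₁ (end P) ◂ h₁ P
            v′◂h = subst (_◂ h₁ P) (cong proj₁ head≡) (subst (λ vh → v₁ back ◂ proj₂ vh) end≡ (proj₁ (third-second back)))
            h≡ : h₁ P ≡ proj₂ (end P)
            h≡ = linear (proj₂ (third-second P)) (v₁◂ P) v′◂h v◂end v′◂end

    -- Existence of a path with K + 1 hyperedges

    HasPath : ℕ → Set
    HasPath N = ∃₂ λ a b → ∃₂ λ vs es → Seg a b vs es × Good vs × Unique es × length vs ≡ suc N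

    truncate : ∀ N {a b vs es} → Seg a b vs es → Good vs → Unique es → suc N ≤ length vs → HasPath N
    truncate N (pt a) gd ue (s≤s z≤n) = _ , _ , _ , _ , pt a , gd , ue , refl
    truncate N S@(step {vs = vs} _ _ S′) gd ue le with length vs ≟ N
    ... | yes refl = _ , _ , _ , _ , S , gd , ue , refl
    ... | no ≢N with gd | ue
    ...   | _ ∷ u , _ ∷ u⊆ | _ ∷ ue′ = truncate N S′ (u , u⊆) ue′ (≤∧≢⇒< (≤-pred le) (≢N ∘ sym))

    halve : ∀ n → (∃ λ r → n ≡ 2 * r) ⊎ (∃ λ κ → 1 + n ≡ 2 * κ)
    halve zero = inj₁ (0 , refl)
    halve (suc n) with halve n
    ... | inj₁ (r , refl) = inj₂ (suc r , cong suc (sym (+-suc r _)))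
    ... | inj₂ (κ , eq) = inj₁ (κ , eq)

    -- Negated twice: maximality of ℓ is only an assumption to be refuted and the final goal is ⊥,
    -- so the argument involves no search for a longest path.
    extends : ∀ ℓ → 2 ≤ ℓ → ℓ ≤ K → HasPath ℓ → ¬ ¬ HasPath (suc ℓ)
    extends ℓ ℓ≥2 ℓ≤K (_ , _ , vs , es , S , gd , ue , ln) maximal with halve K
    ... | inj₁ (r , K≡) = LongestPath.Odd.no-path Λ {r} K≡ (LongestPath.mkLP Λ S gd ue ln)
      where
      Λ : Longest
      Λ = record { ℓ = ℓ ; ℓ≤K = ℓ≤K ; ℓ≥2 = ℓ≥2 ; longest = λ S gd ue → ≮⇒≥ λ lt → maximal (truncate (suc ℓ) S gd ue lt) }
    ... | inj₂ (κ , K≡) = LongestPath.Even.no-path Λ {κ} K≡ (LongestPath.mkLP Λ S gd ue ln)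
      where
      Λ : Longest
      Λ = record { ℓ = ℓ ; ℓ≤K = ℓ≤K ; ℓ≥2 = ℓ≥2 ; longest = λ S gd ue → ≮⇒≥ λ lt → maximal (truncate (suc ℓ) S gd ue lt) }

    -- Otherwise all neighbours of a vertex share one hyperedge with it, and adjacent vertices have
    -- degree at most 2.
    path-of-length-2 : ¬ ¬ HasPath 2
    path-of-length-2 none = some-vertex U refl
      where
      joined : ∀ {v x w e} → v ∈ U → x ∈ U → v ≢ x → v ◂ e → x ◂ e → w ∈ U → Adj v w → w ◂ e
      joined {v} {x} {w} {e} v∈ x∈ v≢x ve xe w∈ (v≢w , f , vf , wf) with f ≟ᴱ e | w ≟ⱽ x
      ... | yes refl | _ = wf
      ... | no _ | yes refl = xe
      ... | no f≢e | no w≢x = ⊥-elim (none (_ , _ , _ , _ , step wf vf (step ve xe (pt x)) ,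
              (((v≢w ∘ sym) ∷ w≢x ∷ []) ∷ (v≢x ∷ []) ∷ [] ∷ [] , w∈ ∷ v∈ ∷ x∈ ∷ []) , (f≢e ∷ []) ∷ [] ∷ [] , refl))
      some-vertex : ∀ us → U ≡ us → ⊥
      some-vertex [] eq = <-irrefl refl (≤-trans (s≤s z≤n) (≤-trans K+2≤∣U∣ (≤-reflexive (cong length eq))))
      some-vertex (v ∷ us) eq with deg v in deg≡
      ... | zero = <-irrefl refl (≤-trans (≤-trans (s≤s z≤n) (deg-min v∈)) (≤-reflexive (cong (2 *_) deg≡)))
        where
        v∈ : v ∈ U
        v∈ = subst (v ∈_) (sym eq) (here refl)
      ... | suc d with count-witness (Adj? v) U (≤-trans (s≤s z≤n) (≤-reflexive (sym deg≡)))
      ...   | x , x∈ , v~x@(v≢x , e , ve , xe) = low-edge v∈ x∈ v~x (deg≤2 ve (joined v∈ x∈ v≢x ve xe)) (deg≤2 xe (joined x∈ v∈ (v≢x ∘ sym) xe ve))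
        where
        v∈ : v ∈ U
        v∈ = subst (v ∈_) (sym eq) (here refl)

    long-path : ¬ ¬ HasPath (suc K)
    long-path none = climb (K ∸ 1) ≤-refl (none ∘ subst HasPath (cong suc K≡))
      where
      K≡ : 1 + (K ∸ 1) ≡ K
      K≡ = m+[n∸m]≡n (≤-trans (s≤s z≤n) K≥3)
      climb : ∀ n → n ≤ K ∸ 1 → ¬ ¬ HasPath (2 + n)
      climb zero le = path-of-length-2
      climb (suc n) le no-more = climb n (<⇒≤ le) λ path →
        extends (2 + n) (s≤s (s≤s z≤n)) (≤-trans (s≤s le) (≤-reflexive K≡)) path no-more

  -- Induction on the number of vertices

  module Bound (I : Incidence) where
    open Shadow I

    -- The induction hypothesis for shorter lists is the field `sparse`, so a failure at `U` is
    -- already a minimal one.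
    bound : ∀ K → 3 ≤ K → (∀ {a b vs es} → Seg a b vs es → Unique vs → Unique es → length es ≢ suc K) →
            ∀ U → Unique U → D U U ≤ K * length U
    bound K K≥3 no-path U₀ u₀ = go (length U₀) U₀ u₀ ≤-refl
      where
      go : ∀ n U → Unique U → length U ≤ n → D U U ≤ K * length U
      go zero [] u le = z≤n
      go (suc n) U u le with D U U ≤? K * length U
      ... | yes ok = ok
      ... | no nok = ⊥-elim (Minimality.long-path I minimal λ (_ , _ , _ , _ , S , (uv , _) , ue , ln) →
              no-path S uv ue (suc-injective (trans (sym (length-Seg S)) ln)))
        where
        smaller : ∀ s {ss ws} → U ↭ (s ∷ ss) ++ ws → D ws ws ≤ K * length ws
        smaller s {ss} {ws} p = go n ws (uniq ((s ∷ ss) ∷ ws ∷ []) `1 (`0 ⊕ `1) (Unique-resp-↭ p u))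
          (≤-pred (≤-trans (s≤s (≤-trans (m≤n+m (length ws) (length ss)) (≤-reflexive (sym (length-++ ss))))) (≤-trans (≤-reflexive (sym (↭-length p))) le)))
        minimal : Minimal
        minimal = record { U = U ; K = K ; K≥3 = K≥3 ; U-unique = u ; dense = ≰⇒> nok ; sparse = smaller }

  -- From hypergraphs to incidence structures

  module Transfer where
    open import Defs
    open import Data.Fin.Base using (inject₁) renaming (_<_ to _<ᶠ_)
    open import Data.Fin.Subset using (Subset; _-_; ∣_∣; _∩_) renaming (_∈_ to _∈ˢ_)
    open import Data.Fin.Subset.Properties using (_∈?_; x∈p∩q⁺; x∈p⇒∣p-x∣<∣p∣; x∈p∧x≢y⇒x∈p-y)
    open import Data.List.Base using (allFin; cartesianProduct; filter) renaming (lookup to lookupˡ)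
    open import Data.List.Membership.Propositional.Properties using (∈-lookup)
    open import Data.List.Relation.Unary.Any using (index)
    open import Data.List.Relation.Unary.Any.Properties using (lookup-index)
    open import Data.List.Relation.Unary.Unique.Propositional.Properties using (allFin⁺)
    open import Relation.Unary using (｛_｝; _∪_)

    elements≤∣p∣ : ∀ {n} (p : Subset n) xs → Unique xs → All (_∈ˢ p) xs → length xs ≤ ∣ p ∣
    elements≤∣p∣ p [] _ _ = z≤n
    elements≤∣p∣ p (x ∷ xs) (x∉ ∷ u) (x∈ ∷ xs∈) = ≤-trans
      (s≤s (elements≤∣p∣ (p - x) xs u (All.zipWith (λ (x≢y , y∈) → x∈p∧x≢y⇒x∈p-y y∈ (x≢y ∘ sym)) (x∉ , xs∈))))
      (x∈p⇒∣p-x∣<∣p∣ x∈)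

    lookup-injective : ∀ {A : Set} {xs : List A} → Unique xs → ∀ i j → lookupˡ xs i ≡ lookupˡ xs j → i ≡ j
    lookup-injective (_ ∷ _) zero zero _ = refl
    lookup-injective (x∉ ∷ _) zero (suc j) eq = ⊥-elim (All.lookup x∉ (∈-lookup j) eq)
    lookup-injective (x∉ ∷ _) (suc i) zero eq = ⊥-elim (All.lookup x∉ (∈-lookup i) (sym eq))
    lookup-injective (_ ∷ u) (suc i) (suc j) eq = cong suc (lookup-injective u i j eq)

    module _ {n : ℕ} (G : Hypergraph n) (uniform : Uniform (｛ 2 ｝ ∪ ｛ 3 ｝) G) (linear-G : Linear G) where

      edge : Fin (length (hyperedges G)) → Subset n
      edge = lookupˡ (hyperedges G)

      -- Hyperedges are positions in the list, which are easy to compare; since the list is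
      -- repetition-free, distinct positions carry distinct subsets.
      incidence : Incidence
      incidence = record
        { V = Fin n ; E = Fin (length (hyperedges G)) ; _≟ⱽ_ = Fin._≟_ ; _≟ᴱ_ = Fin._≟_
        ; _◂_ = λ v e → v ∈ˢ edge e ; _◂?_ = λ v e → v ∈? edge e
        ; link? = λ a b → Fin.any? λ e → (a ∈? edge e) ×-dec (b ∈? edge e)
        ; linear = one-edge ; size≤3 = small }
        where
        one-edge : ∀ {a b e f} → a ≢ b → a ∈ˢ edge e → b ∈ˢ edge e → a ∈ˢ edge f → b ∈ˢ edge f → e ≡ f
        one-edge {a} {b} {e} {f} a≢b ae be af bf with e Fin.≟ f
        ... | yes e≡f = e≡f
        ... | no e≢f = ⊥-elim (<-irrefl refl (≤-trans
                (elements≤∣p∣ (edge e ∩ edge f) (a ∷ b ∷ []) ((a≢b ∷ []) ∷ [] ∷ []) (x∈p∩q⁺ (ae , af) ∷ x∈p∩q⁺ (be , bf) ∷ []))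
                (linear-G (∈-lookup e) (∈-lookup f) (e≢f ∘ lookup-injective (unique G) e f))))
        ∣edge∣≤3 : ∀ e → ∣ edge e ∣ ≤ 3
        ∣edge∣≤3 e with uniform (∈-lookup e)
        ... | inj₁ two   = ≤-trans (≤-reflexive (sym two)) (s≤s (s≤s z≤n))
        ... | inj₂ three = ≤-reflexive (sym three)
        small : ∀ {a b c d e} → a ∈ˢ edge e → b ∈ˢ edge e → c ∈ˢ edge e → d ∈ˢ edge e →
                a ≢ b → a ≢ c → a ≢ d → b ≢ c → b ≢ d → c ≢ d → ⊥
        small {a} {b} {c} {d} {e} ae be ce de a≢b a≢c a≢d b≢c b≢d c≢d = <-irrefl refl (≤-trans
          (elements≤∣p∣ (edge e) (a ∷ b ∷ c ∷ d ∷ []) ((a≢b ∷ a≢c ∷ a≢d ∷ []) ∷ (b≢c ∷ b≢d ∷ []) ∷ (c≢d ∷ []) ∷ [] ∷ [])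
            (ae ∷ be ∷ ce ∷ de ∷ [])) (∣edge∣≤3 e))

      open Shadow incidence

      berge : ∀ {a b vs es} → Seg a b vs es → Unique vs → Unique es → BergePath G (length es)
      berge {vs = vs} {es} S uv ue = record
        { vertex = at S
        ; hyperedge = λ i → edge (lookupˡ es i)
        ; vertex-injective = λ {i} {j} → at-injective S uv i j
        ; hyperedge-injective = λ {i} {j} eq → lookup-injective ue i j (lookup-injective (unique G) _ _ eq)
        ; hyperedge∈H = λ i → ∈-lookup (lookupˡ es i)
        ; incident = meets S }
        where
        at : ∀ {a b vs es} → Seg a b vs es → Fin (suc (length es)) → Fin n
        at {a} S zero = a
        at (step _ _ S) (suc i) = at S i
        at∈ : ∀ {a b vs es} (S : Seg a b vs es) i → at S i ∈ vs
        at∈ S zero = start∈ S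
        at∈ (step _ _ S) (suc i) = there (at∈ S i)
        at-injective : ∀ {a b vs es} (S : Seg a b vs es) → Unique vs → ∀ i j → at S i ≡ at S j → i ≡ j
        at-injective S u zero zero eq = refl
        at-injective (step _ _ S) (a∉ ∷ u) zero (suc j) eq = ⊥-elim (All.lookup a∉ (at∈ S j) eq)
        at-injective (step _ _ S) (a∉ ∷ u) (suc i) zero eq = ⊥-elim (All.lookup a∉ (at∈ S i) (sym eq))
        at-injective (step _ _ S) (_ ∷ u) (suc i) (suc j) eq = cong suc (at-injective S u i j eq)
        meets : ∀ {a b vs es} (S : Seg a b vs es) i →
                at S (inject₁ i) ∈ˢ edge (lookupˡ es i) × at S (suc i) ∈ˢ edge (lookupˡ es i)
        meets (step a◂ b◂ S) zero = a◂ , b◂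
        meets (step _ _ S) (suc i) = meets S i

      module Count = Graph (∂ G)

      filter-count : ∀ {A : Set} {P : A → Set} (P? : ∀ x → Dec (P x)) xs → length (filter P? xs) ≡ ∑ (𝟙 ∘ P?) xs
      filter-count P? [] = refl
      filter-count P? (x ∷ xs) with P? x
      ... | yes _ = cong suc (filter-count P? xs)
      ... | no _  = filter-count P? xs

      ∑-product : ∀ (f : Fin n × Fin n → ℕ) us ws → ∑ f (cartesianProduct us ws) ≡ ∑ (λ u → ∑ (λ w → f (u , w)) ws) us
      ∑-product f [] ws = refl
      ∑-product f (u ∷ us) ws = trans (∑-++ f (map (u ,_) ws)) (cong₂ _+_ (∑-map ws) (∑-product f us ws))
        where
        ∑-map : ∀ ws → ∑ f (map (u ,_) ws) ≡ ∑ (λ w → f (u , w)) ws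
        ∑-map [] = refl
        ∑-map (w ∷ ws) = cong (f (u , w) +_) (∑-map ws)

      pair? : ∀ u v → Dec (u <ᶠ v × Count.Adj u v)
      pair? u v = (u Fin.<? v) ×-dec Count.adj? u v

      shadow-Adj : ∀ {u v} → Count.Adj u v → Adj u v
      shadow-Adj (u≢v , joint) = u≢v , index joint , lookup-index joint

      -- Each edge is listed once, with u < v; the transposed sum supplies the other order.
      twice-edges : edgeCount (∂ G) + edgeCount (∂ G) ≤ D (allFin n) (allFin n)
      twice-edges = begin
        edgeCount (∂ G) + edgeCount (∂ G)            ≡⟨ cong₂ _+_ rows (trans rows (∑-swap (λ u v → 𝟙 (pair? u v)) vs vs)) ⟩
        ∑ (λ u → ∑ (λ v → 𝟙 (pair? u v)) vs) vs + ∑ (λ v → ∑ (λ u → 𝟙 (pair? u v)) vs) vs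
                                                     ≡⟨ sym (∑-+ (λ u → ∑ (λ v → 𝟙 (pair? u v)) vs) (λ v → ∑ (λ u → 𝟙 (pair? u v)) vs) vs) ⟩
        ∑ (λ u → ∑ (λ v → 𝟙 (pair? u v)) vs + ∑ (λ v → 𝟙 (pair? v u)) vs) vs
                                                     ≤⟨ ∑-mono vs (λ {u} _ → ≤-trans (≤-reflexive (sym (∑-+ (λ v → 𝟙 (pair? u v)) (λ v → 𝟙 (pair? v u)) vs))) (∑-mono vs λ {v} _ → each u v)) ⟩
        D vs vs                                      ∎
        where
        open ≤-Reasoning
        vs : List (Fin n)
        vs = allFin n
        rows : edgeCount (∂ G) ≡ ∑ (λ u → ∑ (λ v → 𝟙 (pair? u v)) vs) vs
        rows = trans (filter-count (λ (u , v) → pair? u v) (cartesianProduct vs vs)) (∑-product (λ (u , v) → 𝟙 (pair? u v)) vs vs)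
        each : ∀ u v → 𝟙 (pair? u v) + 𝟙 (pair? v u) ≤ u ~ v
        each u v with pair? u v | pair? v u
        ... | yes (u<v , _) | yes (v<u , _) = ⊥-elim (Fin.<-asym u<v v<u)
        ... | yes (_ , u~v) | no _ = ≤-reflexive (sym (𝟙-yes (Adj? u v) (shadow-Adj u~v)))
        ... | no _ | yes (_ , v~u) = ≤-reflexive (sym (𝟙-yes (Adj? u v) (Adj-sym (shadow-Adj v~u))))
        ... | no _ | no _ = z≤n

      shadow-bound : ∀ K → 3 ≤ K → ¬ BergePath G (suc K) → edgeCount (∂ G) * 2 ≤ K * n
      shadow-bound K K≥3 none = begin
        edgeCount (∂ G) * 2                       ≡⟨ trans (*-comm (edgeCount (∂ G)) 2) (cong (edgeCount (∂ G) +_) (+-identityʳ _)) ⟩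
        edgeCount (∂ G) + edgeCount (∂ G)         ≤⟨ twice-edges ⟩
        D (allFin n) (allFin n)                   ≤⟨ Bound.bound incidence K K≥3 (λ S uv ue eq → none (subst (BergePath G) eq (berge S uv ue))) (allFin n) (allFin⁺ n) ⟩
        K * length (allFin n)                     ≡⟨ cong (K *_) (length-tabulate id) ⟩
        K * n                                     ∎
        where
        open ≤-Reasoning

-- The bound over the rationals

open import Defs
open import Data.Integer.Base using (+_; _-_)
open import Data.Nat.Base using (ℕ; suc; s≤s; _≥_)
open import Data.Rational.Base using (_≤_; _*_; _/_)
open import Relation.Nullary.Negation.Core using (¬_)
open import Relation.Unary using (｛_｝; _∪_)

theorem3 : ∀ (k : ℕ) → k ≥ 4 →
    ∀ (n : ℕ) (H : Hypergraph n) →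
    Uniform (｛ 2 ｝ ∪ ｛ 3 ｝) H →
    Linear H →
    ¬ BergePath H k →
    + edgeCount (∂ H) / 1 ≤ ((+ k - + 1) / 2) * (+ n / 1)
theorem3 (suc K) (s≤s K≥3) n H uniform linear none = ℚ.toℚᵘ-cancel-≤ (begin
  toℚᵘ (+ edgeCount (∂ H) / 1)               ≃⟨ ℚ.toℚᵘ-fromℚᵘ (mkℚᵘ (+ edgeCount (∂ H)) 0) ⟩
  -- `mkℚᵘ` stores the denominator minus one, so `mkℚᵘ (+ K) 1` is K / 2. Unnormalised fractions are
  -- compared by cross-multiplication, free of common divisors.
  mkℚᵘ (+ edgeCount (∂ H)) 0                 ≤⟨ *≤* numerators ⟩
  mkℚᵘ (+ K) 1 *ᵘ mkℚᵘ (+ n) 0               ≃⟨ ℚᵘ.*-cong (ℚ.toℚᵘ-fromℚᵘ (mkℚᵘ (+ K) 1)) (ℚ.toℚᵘ-fromℚᵘ (mkℚᵘ (+ n) 0)) ⟨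
  toℚᵘ (+ K / 2) *ᵘ toℚᵘ (+ n / 1)           ≃⟨ ℚ.toℚᵘ-homo-* (+ K / 2) (+ n / 1) ⟨
  toℚᵘ ((+ K / 2) * (+ n / 1))               ∎)
  where
  open import Data.Rational.Base using (toℚᵘ)
  open import Data.Rational.Unnormalised.Base using (mkℚᵘ; *≤*) renaming (_*_ to _*ᵘ_)
  import Data.Rational.Properties as ℚ
  import Data.Rational.Unnormalised.Properties as ℚᵘ
  import Data.Integer.Base as ℤ
  import Data.Integer.Properties as ℤ
  open import Relation.Binary.PropositionalEquality using (trans; sym; cong)
  open ℚᵘ.≤-Reasoning
  numerators : + edgeCount (∂ H) ℤ.* + 2 ℤ.≤ (+ K ℤ.* + n) ℤ.* + 1
  numerators = ℤ.≤-trans (ℤ.≤-reflexive (sym (ℤ.pos-* (edgeCount (∂ H)) 2)))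
    (ℤ.≤-trans (ℤ.+≤+ (Development.Transfer.shadow-bound H uniform linear K K≥3 none))
      (ℤ.≤-reflexive (trans (ℤ.pos-* K n) (sym (ℤ.*-identityʳ (+ K ℤ.* + n))))))
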